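{- Let $n>1$ and let $p$ be a prime factor of $n$. There is a randomized oblivious branching program with space $O(\log n)$ and time $\max\{1,n/p^2\}\cdot O(n\log n)$ that computes the $(n,p)$-Non-Occurring Elements problem (defined in the context) with probability at least $1-2/n$. Moreover, it can be implemented with one-way access to random bits. On the other hand, any deterministic oblivious branching program with space $S$ and time $T$ that correctly computes $(n,p)$-Non-Occurring Elements must satisfy $T^2(S+\log T)\geq \Omega(n^3/p)$. (The constants hidden in $O(\cdot)$ and $\Omega(\cdot)$ are absolute, independent of $n$, $p$, $S$, $T$.)
   Context: $[n]=\{1,\ldots,n\}$. **Problem.** For $n>1$ and $p$ a prime factor of $n$, in the $(n,p)$-Non-Occurring Elements problem the input is a list $X=(x_1,\ldots,x_n)\in[n]^n$. The output is a set $Y\subseteq[n]$: if for every $c\in[n]$ the number of indices $i$ with $x_i=c$ is a multiple of $p$ ($0$ included), then $Y$ is the set of elements of $[n]$ that do not occur in $X$; otherwise $Y=\varnothing$. **Branching programs.** A deterministic branching program on inputs $(x_1,\ldots,x_n)\in D^n$ is a layered directed acyclic graph with a unique initial vertex. Each vertex not in the last layer is labeled with an index $i\in[n]$ and has $|D|$ outgoing edges to the next layer, labeled with the elements of $D$. The computation path on an input starts at the initial vertex, at each vertex labeled $i$ queries $x_i$ and follows the outgoing edge labeled with the value of $x_i$, until reaching the last layer. The program has space $S$ and time $T$ if it has at most $T+1$ layers, each containing at most $2^S$ vertices. It is oblivious if within each layer all vertices carry the same index label. To compute a function whose value is a subset of a set $R$, each edge may output arbitrarily many elements of $R$, and the final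 output on an input is the set of all elements output along its computation path. A deterministic program computes the function correctly if the output is the correct set for every input. A randomized (oblivious) branching program with space $S$ and time $T$ is a probability distribution over deterministic (oblivious) branching programs with the same space and time bounds; it computes a function with probability at least $q$ if, for every input, the output is correct with probability at least $q$. It has one-way access to random bits if in each layer the random labels on the vertices and outgoing edges are independent of the rest of the branching program. -}

module Defs where

open import Algebra.Properties.CommutativeMonoid.Sum using (sum)
open import Data.Bool.Base using (Bool; _∧_; if_then_else_)
open import Data.Bool.Properties using () renaming (_≟_ to _≟ᵇ_)
open import Data.Fin.Base using (Fin; zero)
open import Data.Fin.Properties using (all?; _≟_)
open import Data.Fin.Subset using (Subset; ⊥; _∪_)
open import Data.Integer.Base using (+_)
open import Data.List.Base using (List; []; _∷_; length; head; take; drop)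
open import Data.List.Relation.Unary.All using (All)
open import Data.Nat.Base as ℕ using (ℕ; NonZero; _>_; _^_; z<s; >-nonZero)
open import Data.Nat.Divisibility using (_∣?_)
open import Data.Nat.Properties using (<-trans)
open import Data.Product.Base using (_×_; _,_; ∃-syntax)
open import Data.Rational.Base as ℚ using (ℚ; 0ℚ; 1ℚ; _/_)
open import Data.Rational.Properties using (+-0-commutativeMonoid)
open import Data.Unit.Base using (⊤)
open import Data.Vec.Base using (Vec; lookup; count; tabulate)
open import Data.Vec.Properties using (≡-dec)
import Data.Vec.Membership.DecPropositional as DecMembership
open import Function.Base using (_∘_)
open import Relation.Binary.Definitions using (DecidableEquality)
open import Relation.Binary.PropositionalEquality.Core using (_≡_)
open import Relation.Nullary.Decidable.Core using (does; ¬?)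

------------------------------------------------------------------------
-- Non-Occurring Elements.  The set [n] = {1,…,n} is represented by Fin n.

nonOccurring : ∀ {n} → Vec (Fin n) n → Subset n
nonOccurring X = tabulate λ c → does (¬? (c ∈? X))
  where open DecMembership _≟_ using (_∈?_)

NonOccurringElements : (n p : ℕ) → Vec (Fin n) n → Subset n
NonOccurringElements n p X =
  if does (all? λ c → p ∣? count (c ≟_) X) then nonOccurring X else ⊥

------------------------------------------------------------------------
-- Branching programs with n inputs from Fin d, computing subsets of Fin r

-- The v vertices of one layer, with their edges into a next layer of w
-- vertices.  The edge leaving u with label a ends at next u a and outputs
-- the elements of output u a.
record Layer (n d r v w : ℕ) : Set where
  field
    query  : Fin v → Fin n
    next   : Fin v → Fin d → Fin w
    output : Fin v → Fin d → Subset r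

open Layer public

-- Programs whose first layer has v vertices and whose later layers have the
-- listed numbers of vertices.  The vertices of the last layer carry no data.
data Layers (n d r v : ℕ) : List ℕ → Set where
  []  : Layers n d r v []
  _∷_ : ∀ {w ws} → Layer n d r v w → Layers n d r w ws →
        Layers n d r v (w ∷ ws)

-- The first layer consists of the initial vertex only.
record BranchingProgram (n d r : ℕ) : Set where
  field
    widths : List ℕ
    layers : Layers n d r 1 widths

open BranchingProgram public

module _ {n d r : ℕ} where

  run : ∀ {v ws} → Layers n d r v ws → Vec (Fin d) n → Fin v → Subset r
  run []       x u = ⊥
  run (L ∷ Ls) x u = output L u a ∪ run Ls x (next L u a)
    where a = lookup x (query L u)

  ⟦_⟧ : BranchingProgram n d r → Vec (Fin d) n → Subset r
  ⟦ P ⟧ x = run (layers P) x zero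

  -- The first layer is not listed in widths P, so there are
  -- length (widths P) + 1 layers in total.
  HasTime : BranchingProgram n d r → ℕ → Set
  HasTime P T = length (widths P) ℕ.≤ T

  HasSpace : BranchingProgram n d r → ℕ → Set
  HasSpace P S = All (ℕ._≤ 2 ^ S) (1 ∷ widths P)

  ObliviousLayers : ∀ {v ws} → Layers n d r v ws → Set
  ObliviousLayers []       = ⊤
  ObliviousLayers (L ∷ Ls) =
    (∀ u u′ → query L u ≡ query L u′) × ObliviousLayers Ls

  Oblivious : BranchingProgram n d r → Set
  Oblivious P = ObliviousLayers (layers P)

  Computes : BranchingProgram n d r → (Vec (Fin d) n → Subset r) → Set
  Computes P f = ∀ x → ⟦ P ⟧ x ≡ f x

------------------------------------------------------------------------
-- Finitely supported probability distributions with rational weights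

record Distribution (A : Set) : Set where
  field
    size      : ℕ
    weight    : Fin size → ℚ
    outcome   : Fin size → A
    weight≥0  : ∀ i → 0ℚ ℚ.≤ weight i
    weight-Σ≡1 : sum +-0-commutativeMonoid weight ≡ 1ℚ

open Distribution public

Pr : ∀ {A} → Distribution A → (A → Bool) → ℚ
Pr D E = sum +-0-commutativeMonoid λ i →
  if E (outcome D i) then weight D i else 0ℚ

Independent : ∀ {A X Y : Set} → Distribution A → (A → X) → (A → Y) → Set
Independent {_} {X} {Y} D f g = (E : X → Bool) (F : Y → Bool) →
  Pr D (λ a → E (f a) ∧ F (g a)) ≡ Pr D (E ∘ f) ℚ.* Pr D (F ∘ g)

------------------------------------------------------------------------
-- Randomized branching programs

RandomizedBP : (n d r : ℕ) → Set
RandomizedBP n d r = Distribution (BranchingProgram n d r)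

module _ {n d r : ℕ} where

  Always : (BranchingProgram n d r → Set) → RandomizedBP n d r → Set
  Always Q R = ∀ i → Q (outcome R i)

  infix 4 _≟ˢ_
  _≟ˢ_ : DecidableEquality (Subset r)
  _≟ˢ_ = ≡-dec _≟ᵇ_

  ComputesWithProbability : RandomizedBP n d r → ℚ →
                            (Vec (Fin d) n → Subset r) → Set
  ComputesWithProbability R q f =
    ∀ x → q ℚ.≤ Pr R (λ P → does (⟦ P ⟧ x ≟ˢ f x))

  toList : ∀ {v ws} → Layers n d r v ws → List (∃[ v ] ∃[ w ] Layer n d r v w)
  toList []       = []
  toList (L ∷ Ls) = (_ , _ , L) ∷ toList Ls

  -- For every k, the labels, edges and outputs of layer k are independent of
  -- those of all the other layers taken together.
  OneWayRandomness : RandomizedBP n d r → Set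
  OneWayRandomness R = ∀ k → Independent R
    (λ P → head (drop k (toList (layers P))))
    (λ P → take k (toList (layers P)) , drop (ℕ.suc k) (toList (layers P)))

------------------------------------------------------------------------

-- 1 - 2/n
1-2/ : (n : ℕ) → n > 1 → ℚ
1-2/ n n>1 = 1ℚ ℚ.- (+ 2 / n)
  where instance
    n≢0 : NonZero n
    n≢0 = >-nonZero (<-trans z<s n>1)

{-# OPTIONS --safe #-}
module Submission where

-- Upper bound.  First the promise is verified.  The n elements fall into O(1 + n/p²) blocks of
-- size about p²/4, and for each block a bivariate polynomial over Z/p of degree < (p+1)/2 in each
-- variable, whose coefficients are the multiplicities, is evaluated at a random point held in the
-- state.  If some multiplicity is not divisible by p, its polynomial is nonzero and a trial detects
-- this with probability at least 1/4, so 3(log n + 1) trials per block suffice.  If the promise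
-- holds, at most n/p elements occur, each at least p times; a sweep of O((n/p) log n) random
-- queries hits all of them except with probability n⁻², and finds the next occurring element, so
-- n/p + 1 sweeps output all gaps.
--
-- Lower bound.  Cut the program into N = O(T/n) segments with at most n/2 queries each.  For every
-- segment reserve r groups of p variables that it does not query, give each group a common free
-- value and every other variable a fixed value: all these inputs satisfy the promise and have at
-- least n/4 non-occurring elements.  On each input some segment outputs a set Y of at least n/(4N)
-- elements avoiding its own r reserved values, while Y depends only on the initial state of the
-- segment and on the other values.  So each pair (segment, state) serves a fraction
-- (1 - 1/(4N))^r of the inputs, whence 2^(r/(4N)) ≤ N 2^S, where r can be of order n/(pN).

open import Defs
open import Data.Nat.Base using (ℕ; _≤_; _>_; _+_; _*_; _^_; _⊔_)
open import Data.Nat.Divisibility using (_∣_)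
open import Data.Nat.Logarithm using (⌊log₂_⌋)
open import Data.Nat.Primality using (Prime)
open import Data.Product.Base using (_×_; Σ-syntax; ∃-syntax)

import Algebra.Properties.CommutativeMonoid.Sum as CommutativeMonoidSum
import Algebra.Properties.Semiring.Sum as SemiringSum
open import Data.Bool.Base using (Bool; true; false; _∧_; _∨_; not; if_then_else_)
open import Data.Bool.Properties using (∧-identityʳ; ∧-zeroʳ; ∨-assoc; ∨-zeroʳ) renaming (_≟_ to _≟ᵇ_)
open import Data.Fin.Base as Fin using (Fin; zero; suc; toℕ; fromℕ<; combine; inject₁; _↑ˡ_; _↑ʳ_)
import Data.Fin.Properties as Fin
open import Data.Fin.Subset using (Subset; ⊥; _∪_)
open import Data.Fin.Subset.Properties using (∪-identityˡ; ∪-assoc)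
import Data.Integer.Base as ℤ
import Data.Integer.Properties as ℤ
open import Data.List.Base as List using (List; []; _∷_; length; take; drop)
import Data.List.Properties as List
open import Data.List.Relation.Unary.All using (All; []; _∷_)
open import Data.Maybe.Base using (Maybe; just; nothing; maybe′)
open import Data.Nat.Base using (zero; suc; _<_; _∸_; _⊓_; _/_; _%_; z≤n; s≤s; z<s; s<s; NonZero; nonZero; >-nonZero; nonTrivial⇒n>1; ⌊_/2⌋; ⌈_/2⌉)
open import Data.Nat.Divisibility hiding (_∣_; quotient)
open import Data.Nat.DivMod
open import Data.Nat.Logarithm using (⌊log₂⌊n/2⌋⌋≡⌊log₂n⌋∸1; ⌊log₂⌋-mono-≤)
open import Data.Nat.Primality using (euclidsLemma; prime⇒nonZero; prime⇒nonTrivial)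
open import Data.Nat.Properties
open import Data.Nat.Tactic.RingSolver using (solve-∀)
open import Data.Product.Base using (_,_; proj₁; proj₂)
open import Data.Rational.Base as ℚ using (ℚ; 0ℚ; 1ℚ; toℚᵘ; fromℚᵘ)
import Data.Rational.Properties as ℚ
open import Data.Rational.Unnormalised.Base as ℚᵘ using (mkℚᵘ; *≡*; *≤*)
import Data.Rational.Unnormalised.Properties as ℚᵘ
open import Data.Sum.Base using (_⊎_; inj₁; inj₂)
open import Data.Unit.Base using (tt)
open import Data.Vec.Base as Vec using (Vec; []; _∷_; lookup; tabulate; count; _++_; _[_]≔_)
import Data.Vec.Membership.DecPropositional as DecMembership
open import Data.Vec.Membership.Propositional.Properties using (∈-lookup)
import Data.Vec.Properties as Vec
open import Data.Vec.Relation.Unary.All using ([]; _∷_) renaming (All to Allᵛ)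
import Data.Vec.Relation.Unary.All.Properties as Allᵛ
import Data.Vec.Relation.Unary.Any as Any
import Data.Vec.Relation.Unary.Any.Properties as Any
open import Function.Base using (_∘_; id)
open import Relation.Binary.Definitions using (tri<; tri≈; tri>)
open import Relation.Binary.PropositionalEquality
import Relation.Binary.Reasoning.Setoid as SetoidReasoning
open import Relation.Nullary using (Dec; yes; no; does; ¬_; contradiction)
open import Relation.Nullary.Decidable using (dec-true; dec-false)

-- Why two variables: since p divides n, a uniform element of [n] is a uniform residue mod p. A
-- nonzero polynomial in one variable over Z/p is sure to be caught with constant probability only
-- if its degree stays a constant fraction below p. One variable would therefore hold O(p)
-- multiplicities per pass and need about n/p blocks. Two variables hold about p²/4, and
-- verification then costs O((1 + n/p²) n log n), in balance with the (n/p)² log n queries of the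
-- enumeration.
--
-- Obstacles in the lower bound: the segment with a large output is not known in advance, so groups
-- are reserved for all N segments at once, which forces N r p ≤ n/2. With r = 4Ns this gives s of
-- order n/(pN²), that is n³/(pT²). The initial state of a segment depends on the very values that
-- it must avoid, so it is replaced by a fixed state and a union over all states is taken. N =
-- O(T/n) requires T ≥ n, which is proved separately by showing that every variable is read.
--
-- Probabilities are counts over vectors of draws from [n], one draw per layer; rationals appear
-- only at the interface.

private
  module S = SemiringSum +-*-semiring
  module ℚ∑ = CommutativeMonoidSum ℚ.+-0-commutativeMonoid

∣m+n∣n⇒∣m : ∀ {d} m {k} → d ∣ m + k → d ∣ k → d ∣ m
∣m+n∣n⇒∣m {d} m {k} h = ∣m+n∣m⇒∣n (subst (d ∣_) (+-comm m k) h)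

-- Counting by sums over indices and over vectors

𝟙 : Bool → ℕ
𝟙 true = 1
𝟙 false = 0

𝟙≤1 : ∀ b → 𝟙 b ≤ 1
𝟙≤1 true = ≤-refl
𝟙≤1 false = z≤n

𝟙-∧ : ∀ a b → 𝟙 (a ∧ b) ≡ 𝟙 a * 𝟙 b
𝟙-∧ true b = sym (+-identityʳ _)
𝟙-∧ false b = refl

𝟙-∨ : ∀ a b → 𝟙 (a ∨ b) ≤ 𝟙 a + 𝟙 b
𝟙-∨ true b = s≤s z≤n
𝟙-∨ false b = ≤-refl

𝟙+𝟙-not : ∀ b → 𝟙 b + 𝟙 (not b) ≡ 1
𝟙+𝟙-not true = refl
𝟙+𝟙-not false = refl

-- Opaque, so that unification treats sums as rigid.
opaque

  ∑ : ∀ n → (Fin n → ℕ) → ℕ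
  ∑ n f = S.sum f

  infixl 10 ∑
  syntax ∑ n (λ i → e) = ∑[ i < n ] e

  ∑-suc : ∀ {n} (f : Fin (suc n) → ℕ) → ∑ (suc n) f ≡ f zero + ∑ n (f ∘ suc)
  ∑-suc f = refl

  ∑-zero : (f : Fin 0 → ℕ) → ∑ 0 f ≡ 0
  ∑-zero f = refl

  ∑-cong : ∀ {n} {f g : Fin n → ℕ} → (∀ i → f i ≡ g i) → ∑ n f ≡ ∑ n g
  ∑-cong = S.sum-cong-≗

  ∑-+ : ∀ {n} (f g : Fin n → ℕ) → ∑[ i < n ] (f i + g i) ≡ ∑ n f + ∑ n g
  ∑-+ = S.∑-distrib-+

  ∑-swap : ∀ {m n} (f : Fin m → Fin n → ℕ) →
           ∑[ i < m ] ∑[ j < n ] f i j ≡ ∑[ j < n ] ∑[ i < m ] f i j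
  ∑-swap = S.∑-comm

  ∑-*ˡ : ∀ {n} c (f : Fin n → ℕ) → ∑[ i < n ] (c * f i) ≡ c * ∑ n f
  ∑-*ˡ c f = sym (S.*-distribˡ-sum c f)

  ∑-*ʳ : ∀ {n} c (f : Fin n → ℕ) → ∑[ i < n ] (f i * c) ≡ ∑ n f * c
  ∑-*ʳ c f = sym (S.*-distribʳ-sum c f)

  ∑-mono : ∀ {n} {f g : Fin n → ℕ} → (∀ i → f i ≤ g i) → ∑ n f ≤ ∑ n g
  ∑-mono {zero} f≤g = z≤n
  ∑-mono {suc n} f≤g = +-mono-≤ (f≤g zero) (∑-mono (f≤g ∘ suc))

  ∑-const : ∀ n c → ∑[ i < n ] c ≡ n * c
  ∑-const zero c = refl
  ∑-const (suc n) c = cong (c +_) (∑-const n c)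

  term≤∑ : ∀ {n} (f : Fin n → ℕ) i → f i ≤ ∑ n f
  term≤∑ f zero = m≤m+n _ _
  term≤∑ f (suc i) = ≤-trans (term≤∑ (f ∘ suc) i) (m≤n+m _ _)

  ∑-↑ : ∀ m {n} (f : Fin (m + n) → ℕ) →
        ∑ (m + n) f ≡ ∑[ i < m ] f (i ↑ˡ n) + ∑[ j < n ] f (m ↑ʳ j)
  ∑-↑ zero f = refl
  ∑-↑ (suc m) f = trans (cong (f zero +_) (∑-↑ m (f ∘ suc))) (sym (+-assoc (f zero) _ _))

  ∑-combine : ∀ m {n} (f : Fin (m * n) → ℕ) →
              ∑ (m * n) f ≡ ∑[ i < m ] ∑[ j < n ] f (combine i j)
  ∑-combine zero f = refl
  ∑-combine (suc m) {n} f = trans (∑-↑ n f) (cong (∑[ j < n ] f (j ↑ˡ (m * n)) +_) (∑-combine m (f ∘ (n ↑ʳ_))))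

  ∣-∑ : ∀ {d n} {f : Fin n → ℕ} → (∀ i → d ∣ f i) → d ∣ ∑ n f
  ∣-∑ {n = zero} d∣f = _ ∣0
  ∣-∑ {n = suc n} d∣f = ∣m∣n⇒∣m+n (d∣f zero) (∣-∑ (d∣f ∘ suc))

∑-0 : ∀ n → ∑[ i < n ] 0 ≡ 0
∑-0 n = trans (∑-const n 0) (*-zeroʳ n)

opaque
  unfolding ∑

  ∑-δ : ∀ {n} (i : Fin n) (f : Fin n → ℕ) → ∑[ j < n ] (𝟙 (does (j Fin.≟ i)) * f j) ≡ f i
  ∑-δ {suc n} zero f = trans (cong₂ _+_ (+-identityʳ (f zero)) (∑-0 n)) (+-identityʳ _)
  ∑-δ (suc i) f = ∑-δ i (f ∘ suc)

∑-δ₁ : ∀ {n} (i : Fin n) → ∑[ j < n ] 𝟙 (does (j Fin.≟ i)) ≡ 1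
∑-δ₁ i = trans (∑-cong λ j → sym (*-identityʳ _)) (∑-δ i (λ _ → 1))

-- Regrouping by fibres serves twice: positions of an input grouped by value turn a fingerprint into
-- a combination of multiplicities, and variables grouped by label give the multiplicities of a hard
-- input.
∑-fibres : ∀ {m n} (τ : Fin n → Fin m) (g : Fin m → ℕ) →
           ∑[ i < n ] g (τ i) ≡ ∑[ l < m ] (∑[ i < n ] 𝟙 (does (l Fin.≟ τ i)) * g l)
∑-fibres {m} {n} τ g = begin
  ∑[ i < n ] g (τ i)                                     ≡⟨ ∑-cong (λ i → ∑-δ (τ i) g) ⟨
  ∑[ i < n ] ∑[ l < m ] (𝟙 (does (l Fin.≟ τ i)) * g l)   ≡⟨ ∑-swap _ ⟩
  ∑[ l < m ] ∑[ i < n ] (𝟙 (does (l Fin.≟ τ i)) * g l)   ≡⟨ ∑-cong (λ l → ∑-*ʳ (g l) _) ⟩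
  ∑[ l < m ] (∑[ i < n ] 𝟙 (does (l Fin.≟ τ i)) * g l)   ∎
  where open ≡-Reasoning

opaque
  unfolding ∑

  ∑ᵛ : ∀ {M} K → (Vec (Fin M) K → ℕ) → ℕ
  ∑ᵛ zero f = f []
  ∑ᵛ {M} (suc K) f = ∑[ a < M ] ∑ᵛ K (λ v → f (a ∷ v))

  ∑ᵛ-zero : ∀ {M} (f : Vec (Fin M) 0 → ℕ) → ∑ᵛ 0 f ≡ f []
  ∑ᵛ-zero f = refl

  ∑ᵛ-suc : ∀ {M K} (f : Vec (Fin M) (suc K) → ℕ) → ∑ᵛ (suc K) f ≡ ∑[ a < M ] ∑ᵛ K (λ v → f (a ∷ v))
  ∑ᵛ-suc f = refl

  ∑ᵛ-mono : ∀ {M K} {f g : Vec (Fin M) K → ℕ} → (∀ v → f v ≤ g v) → ∑ᵛ K f ≤ ∑ᵛ K g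
  ∑ᵛ-mono {K = zero} f≤g = f≤g []
  ∑ᵛ-mono {K = suc K} f≤g = ∑-mono λ a → ∑ᵛ-mono λ v → f≤g (a ∷ v)

  ∑ᵛ-cong : ∀ {M K} {f g : Vec (Fin M) K → ℕ} → (∀ v → f v ≡ g v) → ∑ᵛ K f ≡ ∑ᵛ K g
  ∑ᵛ-cong {K = zero} f≡g = f≡g []
  ∑ᵛ-cong {K = suc K} f≡g = ∑-cong λ a → ∑ᵛ-cong λ v → f≡g (a ∷ v)

  ∑ᵛ-const : ∀ {M} K c → ∑ᵛ {M} K (λ _ → c) ≡ M ^ K * c
  ∑ᵛ-const zero c = sym (+-identityʳ c)
  ∑ᵛ-const {M} (suc K) c = trans (∑-cong {M} λ _ → ∑ᵛ-const K c) (trans (∑-const M _) (sym (*-assoc M _ _)))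

  ∑ᵛ-+ : ∀ {M K} (f g : Vec (Fin M) K → ℕ) → ∑ᵛ K (λ v → f v + g v) ≡ ∑ᵛ K f + ∑ᵛ K g
  ∑ᵛ-+ {K = zero} f g = refl
  ∑ᵛ-+ {M} {suc K} f g = trans (∑-cong λ a → ∑ᵛ-+ {M} {K} (λ v → f (a ∷ v)) (λ v → g (a ∷ v))) (∑-+ (λ a → ∑ᵛ K λ v → f (a ∷ v)) _)

  ∑ᵛ-*ˡ : ∀ {M K} c (f : Vec (Fin M) K → ℕ) → ∑ᵛ K (λ v → c * f v) ≡ c * ∑ᵛ K f
  ∑ᵛ-*ˡ {K = zero} c f = refl
  ∑ᵛ-*ˡ {M} {suc K} c f = trans (∑-cong λ a → ∑ᵛ-*ˡ {M} {K} c (λ v → f (a ∷ v))) (∑-*ˡ c (λ a → ∑ᵛ K λ v → f (a ∷ v)))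

  ∑ᵛ-sum : ∀ {M K m} (f : Vec (Fin M) K → Fin m → ℕ) →
           ∑ᵛ K (λ v → ∑[ i < m ] f v i) ≡ ∑[ i < m ] ∑ᵛ K (λ v → f v i)
  ∑ᵛ-sum {K = zero} f = refl
  ∑ᵛ-sum {K = suc K} {m} f = trans (∑-cong λ a → ∑ᵛ-sum (λ v → f (a ∷ v))) (∑-swap (λ a i → ∑ᵛ K (λ v → f (a ∷ v) i)))

  ∑ᵛ-++ : ∀ {M} K {L} (f : Vec (Fin M) (K + L) → ℕ) →
          ∑ᵛ (K + L) f ≡ ∑ᵛ K (λ u → ∑ᵛ L (λ w → f (u ++ w)))
  ∑ᵛ-++ zero f = refl
  ∑ᵛ-++ (suc K) f = ∑-cong λ a → ∑ᵛ-++ K (λ v → f (a ∷ v))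

  -- Base `M` digits. They link `Fin`-indexed families, such as the support of a `Distribution`, to
  -- sums over vectors, and let a whole block of values be treated as one coordinate.
  decode : ∀ {M} K → Fin (M ^ K) → Vec (Fin M) K
  decode zero i = []
  decode {M} (suc K) i = Fin.quotient {M} (M ^ K) i ∷ decode K (Fin.remainder {M} (M ^ K) i)

  ∑-decode : ∀ {M} K (f : Vec (Fin M) K → ℕ) → ∑[ i < M ^ K ] f (decode K i) ≡ ∑ᵛ K f
  ∑-decode zero f = +-identityʳ _
  ∑-decode {M} (suc K) f = trans (∑-combine M _) (∑-cong λ a →
    trans (∑-cong λ j → cong (λ (q , r) → f (q ∷ decode K r)) (Fin.remQuot-combine a j)) (∑-decode K (λ v → f (a ∷ v))))

  -- Redrawing a coordinate of a uniform vector leaves it uniform. This replaces conditioning on all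
  -- the other coordinates.
  ∑ᵛ-resample : ∀ {M K} (j : Fin K) (f : Vec (Fin M) K → ℕ) →
                ∑ᵛ K (λ v → ∑[ b < M ] f (v [ j ]≔ b)) ≡ M * ∑ᵛ K f
  ∑ᵛ-resample {M} {suc K} zero f = trans (∑-const M _) (cong (M *_) (∑ᵛ-sum (λ v b → f (b ∷ v))))
  ∑ᵛ-resample {M} {suc K} (suc j) f = trans (∑-cong λ a → ∑ᵛ-resample j (λ v → f (a ∷ v))) (∑-*ˡ M (λ a → ∑ᵛ K λ v → f (a ∷ v)))

∑ᵛ-1 : ∀ {M K} {f : Vec (Fin M) K → ℕ} → (∀ v → f v ≤ 1) → ∑ᵛ K f ≤ M ^ K
∑ᵛ-1 f≤1 = ≤-trans (∑ᵛ-mono f≤1) (≤-reflexive (trans (∑ᵛ-const _ 1) (*-identityʳ _)))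

allᵇ : ∀ {A : Set} {K} → (A → Bool) → Vec A K → Bool
allᵇ P [] = true
allᵇ P (a ∷ v) = P a ∧ allᵇ P v

∑ᵛ-allᵇ : ∀ {M} K (P : Fin M → Bool) → ∑ᵛ K (λ v → 𝟙 (allᵇ P v)) ≡ (∑[ a < M ] 𝟙 (P a)) ^ K
∑ᵛ-allᵇ zero P = ∑ᵛ-zero _
∑ᵛ-allᵇ {M} (suc K) P = begin
  ∑ᵛ (suc K) (λ v → 𝟙 (allᵇ P v))                       ≡⟨ ∑ᵛ-suc _ ⟩
  ∑[ a < M ] ∑ᵛ K (λ v → 𝟙 (P a ∧ allᵇ P v))            ≡⟨ ∑-cong (λ a → trans (∑ᵛ-cong λ v → 𝟙-∧ (P a) _) (∑ᵛ-*ˡ (𝟙 (P a)) _)) ⟩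
  ∑[ a < M ] (𝟙 (P a) * ∑ᵛ K (λ v → 𝟙 (allᵇ P v)))      ≡⟨ ∑-*ʳ _ (𝟙 ∘ P) ⟩
  ∑[ a < M ] 𝟙 (P a) * ∑ᵛ K (λ v → 𝟙 (allᵇ P v))        ≡⟨ cong (∑[ a < M ] 𝟙 (P a) *_) (∑ᵛ-allᵇ K P) ⟩
  (∑[ a < M ] 𝟙 (P a)) ^ suc K                          ∎
  where open ≡-Reasoning

opaque
  unfolding ∑

  count≡∑ : ∀ {A : Set} {P : A → Set} (P? : ∀ a → Dec (P a)) {n} (xs : Vec A n) →
            count P? xs ≡ ∑[ i < n ] 𝟙 (does (P? (lookup xs i)))
  count≡∑ P? [] = refl
  count≡∑ P? (x ∷ xs) with does (P? x)
  ... | true = cong suc (count≡∑ P? xs)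
  ... | false = count≡∑ P? xs

card : ∀ {r} → Subset r → ℕ
card {r} Y = ∑[ c < r ] 𝟙 (lookup Y c)

lookup-∪ : ∀ {r} (Y Z : Subset r) c → lookup (Y ∪ Z) c ≡ lookup Y c ∨ lookup Z c
lookup-∪ Y Z c = Vec.lookup-zipWith _∨_ c Y Z

lookup-⊥ : ∀ {r} (c : Fin r) → lookup ⊥ c ≡ false
lookup-⊥ c = Vec.lookup-replicate c false

card-∪ : ∀ {r} (Y Z : Subset r) → card (Y ∪ Z) ≤ card Y + card Z
card-∪ Y Z = ≤-trans (∑-mono λ c → ≤-trans (≤-reflexive (cong 𝟙 (lookup-∪ Y Z c))) (𝟙-∨ (lookup Y c) _)) (≤-reflexive (∑-+ _ _))

subset-ext : ∀ {r} {Y Z : Subset r} → (∀ c → lookup Y c ≡ lookup Z c) → Y ≡ Z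
subset-ext {Y = Y} {Z} h = trans (sym (Vec.tabulate∘lookup Y)) (trans (Vec.tabulate-cong h) (Vec.tabulate∘lookup Z))

card-⊥ : ∀ {r} → card {r} ⊥ ≡ 0
card-⊥ {r} = trans (∑-cong λ c → cong 𝟙 (lookup-⊥ c)) (∑-0 r)

-- The problem and its promise

occurs : ∀ {n} → Vec (Fin n) n → Fin n → Bool
occurs X c = does (c ∈? X)
  where open DecMembership Fin._≟_ using (_∈?_)

module _ {n : ℕ} (X : Vec (Fin n) n) where
  open DecMembership (Fin._≟_ {n}) using (_∈?_)

  lookup-nonOccurring : ∀ c → lookup (nonOccurring X) c ≡ not (occurs X c)
  lookup-nonOccurring c = Vec.lookup∘tabulate _ c

  occurs-lookup : ∀ i → occurs X (lookup X i) ≡ true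
  occurs-lookup i = dec-true (lookup X i ∈? X) (∈-lookup i X)

  occurs⇒ : ∀ c → occurs X c ≡ true → ∃[ i ] c ≡ lookup X i
  occurs⇒ c eq with c ∈? X
  ... | yes c∈X = Any.index c∈X , Any.lookup-index c∈X

  promise⇒ : ∀ p → (∀ c → p ∣ count (c Fin.≟_) X) → NonOccurringElements n p X ≡ nonOccurring X
  promise⇒ p h rewrite dec-true (Fin.all? λ c → p ∣? count (c Fin.≟_) X) h = refl

  ¬promise⇒ : ∀ p → ¬ (∀ c → p ∣ count (c Fin.≟_) X) → NonOccurringElements n p X ≡ ⊥
  ¬promise⇒ p h rewrite dec-false (Fin.all? λ c → p ∣? count (c Fin.≟_) X) h = refl

-- Branching programs as lists of steps

record Step (n d r : ℕ) (St : Set) : Set where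
  field
    qry : Fin n
    nxt : St → Fin d → St
    out : St → Fin d → Subset r

open Step public

module _ {n d r : ℕ} {St : Set} where

  runˢ : List (Step n d r St) → Vec (Fin d) n → St → Subset r
  runˢ [] x σ = ⊥
  runˢ (s ∷ ss) x σ = out s σ (lookup x (qry s)) ∪ runˢ ss x (nxt s σ (lookup x (qry s)))

  endˢ : List (Step n d r St) → Vec (Fin d) n → St → St
  endˢ [] x σ = σ
  endˢ (s ∷ ss) x σ = endˢ ss x (nxt s σ (lookup x (qry s)))

  reads : List (Step n d r St) → Fin n → Bool
  reads [] v = false
  reads (s ∷ ss) v = does (v Fin.≟ qry s) ∨ reads ss v

  ∑-reads : ∀ ss → ∑[ v < n ] 𝟙 (reads ss v) ≤ length ss
  ∑-reads [] = ≤-reflexive (∑-0 n)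
  ∑-reads (s ∷ ss) = begin
    ∑[ v < n ] 𝟙 (does (v Fin.≟ qry s) ∨ reads ss v)                   ≤⟨ ∑-mono (λ v → 𝟙-∨ (does (v Fin.≟ qry s)) _) ⟩
    ∑[ v < n ] (𝟙 (does (v Fin.≟ qry s)) + 𝟙 (reads ss v))             ≡⟨ ∑-+ _ _ ⟩
    ∑[ v < n ] 𝟙 (does (v Fin.≟ qry s)) + ∑[ v < n ] 𝟙 (reads ss v)    ≤⟨ +-mono-≤ (≤-reflexive (∑-δ₁ (qry s))) (∑-reads ss) ⟩
    suc (length ss)                                                    ∎
    where open ≤-Reasoning

  run-cong : ∀ ss {x y} → (∀ v → reads ss v ≡ true → lookup x v ≡ lookup y v) →
             ∀ σ → runˢ ss x σ ≡ runˢ ss y σ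
  run-cong [] h σ = refl
  run-cong (s ∷ ss) {x} {y} h σ
    rewrite h (qry s) (cong (_∨ reads ss (qry s)) (dec-true (qry s Fin.≟ qry s) refl))
    = cong (_ ∪_) (run-cong ss (λ v eq → h v (trans (cong (does (v Fin.≟ qry s) ∨_) eq) (∨-trueʳ _))) _)
    where
    ∨-trueʳ : ∀ b → b ∨ true ≡ true
    ∨-trueʳ true = refl
    ∨-trueʳ false = refl

  segments : ℕ → (N : ℕ) → List (Step n d r St) → Vec (List (Step n d r St)) N
  segments ℓ zero ss = []
  segments ℓ (suc N) ss = take ℓ ss ∷ segments ℓ N (drop ℓ ss)

  length-segments : ∀ ℓ N ss j → length (lookup (segments ℓ N ss) j) ≤ ℓ
  length-segments ℓ (suc N) ss zero = ≤-trans (≤-reflexive (List.length-take ℓ ss)) (m⊓n≤m ℓ _)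
  length-segments ℓ (suc N) ss (suc j) = length-segments ℓ N (drop ℓ ss) j

  run-split : ∀ ℓ ss x σ → ∀ c → lookup (runˢ ss x σ) c ≡
              lookup (runˢ (take ℓ ss) x σ ∪ runˢ (drop ℓ ss) x (endˢ (take ℓ ss) x σ)) c
  run-split zero ss x σ c = sym (trans (lookup-∪ ⊥ (runˢ ss x σ) c) (cong (_∨ lookup (runˢ ss x σ) c) (lookup-⊥ c)))
  run-split (suc ℓ) [] x σ c = sym (trans (lookup-∪ {r} ⊥ ⊥ c) (cong (_∨ lookup {A = Bool} {r} ⊥ c) (lookup-⊥ c)))
  run-split (suc ℓ) (s ∷ ss) x σ c = begin
    lookup (O ∪ R) c                               ≡⟨ lookup-∪ O R c ⟩
    lookup O c ∨ lookup R c                        ≡⟨ cong (lookup O c ∨_) (trans (run-split ℓ ss x _ c) (lookup-∪ R₁ R₂ c)) ⟩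
    lookup O c ∨ lookup R₁ c ∨ lookup R₂ c         ≡⟨ ∨-assoc (lookup O c) _ _ ⟨
    (lookup O c ∨ lookup R₁ c) ∨ lookup R₂ c       ≡⟨ trans (lookup-∪ (O ∪ R₁) R₂ c) (cong (_∨ lookup R₂ c) (lookup-∪ O R₁ c)) ⟨
    lookup ((O ∪ R₁) ∪ R₂) c                       ∎
    where
    open ≡-Reasoning
    a = lookup x (qry s)
    O = out s σ a
    R = runˢ ss x (nxt s σ a)
    R₁ = runˢ (take ℓ ss) x (nxt s σ a)
    R₂ = runˢ (drop ℓ ss) x (endˢ (take ℓ ss) x (nxt s σ a))

  -- Here `u j` is the state in which segment `j` starts on `x`. Only its existence is exported,
  -- since the later union bound ranges over all states anyway.
  run-segments : ∀ ℓ N ss → length ss ≤ N * ℓ → ∀ x σ → Σ[ u ∈ (Fin N → St) ]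
    (∀ j c → lookup (runˢ (lookup (segments ℓ N ss) j) x (u j)) c ≡ true → lookup (runˢ ss x σ) c ≡ true)
    × card (runˢ ss x σ) ≤ ∑[ j < N ] card (runˢ (lookup (segments ℓ N ss) j) x (u j))
  run-segments ℓ zero [] _ x σ = (λ ()) , (λ ()) , ≤-reflexive (trans (card-⊥ {r}) (sym (∑-zero _)))
  run-segments ℓ (suc N) ss len x σ
    with run-segments ℓ N (drop ℓ ss)
           (≤-trans (≤-reflexive (List.length-drop ℓ ss)) (≤-trans (∸-monoˡ-≤ ℓ len) (≤-reflexive (m+n∸m≡n ℓ _))))
           x (endˢ (take ℓ ss) x σ)
  ... | u , u⊆ , u≥ = u′ , u′⊆ , bound
    where
    R₁ = runˢ (take ℓ ss) x σ
    R₂ = runˢ (drop ℓ ss) x (endˢ (take ℓ ss) x σ)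
    split : ∀ c → lookup (runˢ ss x σ) c ≡ lookup R₁ c ∨ lookup R₂ c
    split c = trans (run-split ℓ ss x σ c) (lookup-∪ R₁ R₂ c)
    u′ : Fin (suc N) → St
    u′ zero = σ
    u′ (suc j) = u j
    u′⊆ : ∀ j c → lookup (runˢ (lookup (segments ℓ (suc N) ss) j) x (u′ j)) c ≡ true → lookup (runˢ ss x σ) c ≡ true
    u′⊆ zero c eq = trans (split c) (cong (_∨ lookup R₂ c) eq)
    u′⊆ (suc j) c eq = trans (split c) (trans (cong (lookup R₁ c ∨_) (u⊆ j c eq)) (∨-zeroʳ _))
    bound : card (runˢ ss x σ) ≤ ∑[ j < suc N ] card (runˢ (lookup (segments ℓ (suc N) ss) j) x (u′ j))
    bound = begin
      card (runˢ ss x σ)   ≡⟨ ∑-cong (λ c → cong 𝟙 (run-split ℓ ss x σ c)) ⟩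
      card (R₁ ∪ R₂)       ≤⟨ card-∪ R₁ R₂ ⟩
      card R₁ + card R₂    ≤⟨ +-monoʳ-≤ (card R₁) u≥ ⟩
      _                    ≡⟨ ∑-suc _ ⟨
      _                    ∎
      where open ≤-Reasoning

-- Reserving groups of variables

-- Exactly `q` choices are needed, not merely `q` or more: groups of size exactly p keep every
-- multiplicity divisible by p.
select : ∀ {n} q (F : Fin n → Bool) → q ≤ ∑[ v < n ] 𝟙 (F v) →
         Σ[ G ∈ (Fin n → Bool) ] (∀ v → G v ≡ true → F v ≡ true) × ∑[ v < n ] 𝟙 (G v) ≡ q
select {n} zero F _ = (λ _ → false) , (λ _ ()) , ∑-0 n
select {zero} (suc q) F q≤ = contradiction (≤-trans q≤ (≤-reflexive (∑-zero _))) λ ()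
select {suc n} (suc q) F q≤ with F zero in F0
... | true with select q (F ∘ suc) (≤-pred (≤-trans q≤ (≤-reflexive (trans (∑-suc _) (cong (λ b → 𝟙 b + ∑[ v < n ] 𝟙 (F (suc v))) F0)))))
...   | G , G⊆F , ∑G = G′ , G′⊆F , trans (∑-suc _) (cong suc ∑G)
  where
  G′ : Fin (suc n) → Bool
  G′ zero = true
  G′ (suc v) = G v
  G′⊆F : ∀ v → G′ v ≡ true → F v ≡ true
  G′⊆F zero _ = F0
  G′⊆F (suc v) = G⊆F v
select {suc n} (suc q) F q≤ | false with select (suc q) (F ∘ suc) (≤-trans q≤ (≤-reflexive (trans (∑-suc _) (cong (λ b → 𝟙 b + ∑[ v < n ] 𝟙 (F (suc v))) F0))))
...   | G , G⊆F , ∑G = G′ , G′⊆F , trans (∑-suc _) ∑G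
  where
  G′ : Fin (suc n) → Bool
  G′ zero = false
  G′ (suc v) = G v
  G′⊆F : ∀ v → G′ v ≡ true → F v ≡ true
  G′⊆F (suc v) = G⊆F v

∑-fibre₀ : ∀ {n K p} (τ : Fin n → Fin (suc K)) →
           (∀ i → ∑[ v < n ] 𝟙 (does (suc i Fin.≟ τ v)) ≡ p) →
           ∑[ v < n ] 𝟙 (does (zero Fin.≟ τ v)) + K * p ≡ n
∑-fibre₀ {n} {K} {p} τ h = begin
  ∑[ v < n ] 𝟙 (does (zero Fin.≟ τ v)) + K * p                                                  ≡⟨ cong (∑[ v < n ] 𝟙 (does (zero Fin.≟ τ v)) +_) (trans (∑-cong h) (∑-const K p)) ⟨
  ∑[ v < n ] 𝟙 (does (zero Fin.≟ τ v)) + ∑[ i < K ] ∑[ v < n ] 𝟙 (does (suc i Fin.≟ τ v))       ≡⟨ ∑-suc (λ l → ∑[ v < n ] 𝟙 (does (l Fin.≟ τ v))) ⟨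
  ∑[ l < suc K ] ∑[ v < n ] 𝟙 (does (l Fin.≟ τ v))                                              ≡⟨ ∑-swap (λ l v → 𝟙 (does (l Fin.≟ τ v))) ⟩
  ∑[ v < n ] ∑[ l < suc K ] 𝟙 (does (l Fin.≟ τ v))                                              ≡⟨ ∑-cong (λ v → ∑-δ₁ (τ v)) ⟩
  ∑[ v < n ] 1                                                                                  ≡⟨ trans (∑-const n 1) (*-identityʳ n) ⟩
  n                                                                                             ∎
  where open ≡-Reasoning

-- Greedy choice. Once `K` groups are placed, n - Kp variables still carry the default label, and at
-- most `ℓ` of them are bad for the next group; `room` leaves at least p to choose from.
assign : ∀ {n p ℓ} K (bad : Fin K → Fin n → Bool) → (∀ i → ∑[ v < n ] 𝟙 (bad i v) ≤ ℓ) → K * p + ℓ ≤ n →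
         Σ[ τ ∈ (Fin n → Fin (suc K)) ] (∀ i → ∑[ v < n ] 𝟙 (does (suc i Fin.≟ τ v)) ≡ p)
                                      × (∀ v i → τ v ≡ suc i → bad i v ≡ false)
assign zero bad _ _ = (λ _ → zero) , (λ ()) , λ v ()
assign {n} {p} {ℓ} (suc K) bad bad≤ room
  with assign K (bad ∘ suc) (bad≤ ∘ suc) (≤-trans (+-monoˡ-≤ ℓ (m≤n+m (K * p) p)) room)
... | τ , ∑τ , τ-good = τ′ , ∑τ′ , τ′-good
  where
  free : Fin n → Bool
  free v = does (zero Fin.≟ τ v) ∧ not (bad zero v)
  le : ∀ a b → 𝟙 a ≤ 𝟙 (a ∧ not b) + 𝟙 b
  le false b = z≤n
  le true false = ≤-refl
  le true true = ≤-refl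
  enough : p ≤ ∑[ v < n ] 𝟙 (free v)
  enough = +-cancelʳ-≤ ℓ _ _ (+-cancelˡ-≤ (K * p) _ _ (begin
    K * p + (p + ℓ)                            ≡⟨ solve-∀′ (K * p) p ℓ ⟩
    suc K * p + ℓ                              ≤⟨ room ⟩
    n                                          ≡⟨ ∑-fibre₀ τ ∑τ ⟨
    ∑[ v < n ] 𝟙 (does (zero Fin.≟ τ v)) + K * p  ≤⟨ +-monoˡ-≤ (K * p) (≤-trans (∑-mono λ v → le (does (zero Fin.≟ τ v)) (bad zero v)) (≤-reflexive (∑-+ _ _))) ⟩
    (∑[ v < n ] 𝟙 (free v) + ∑[ v < n ] 𝟙 (bad zero v)) + K * p   ≤⟨ +-monoˡ-≤ (K * p) (+-monoʳ-≤ (∑[ v < n ] 𝟙 (free v)) (bad≤ zero)) ⟩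
    (∑[ v < n ] 𝟙 (free v) + ℓ) + K * p        ≡⟨ +-comm _ (K * p) ⟩
    K * p + (∑[ v < n ] 𝟙 (free v) + ℓ)        ∎))
    where
    open ≤-Reasoning
    solve-∀′ : ∀ a b c → a + (b + c) ≡ (b + a) + c
    solve-∀′ = solve-∀
  chosen = select p free enough
  G = proj₁ chosen
  -- The recursion handled `bad ∘ suc`, so the new group takes label 1, the old groups move up by
  -- one, and the default label 0 stays.
  lift : Fin (suc K) → Fin (suc (suc K))
  lift zero = zero
  lift (suc i) = suc (suc i)
  τ′ : Fin n → Fin (suc (suc K))
  τ′ v = if G v then suc zero else lift (τ v)
  G⇒0 : ∀ v → G v ≡ true → τ v ≡ zero
  G⇒0 v Gv with τ v | proj₁ (proj₂ chosen) v Gv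
  ... | zero | _ = refl
  G⇒good : ∀ v → G v ≡ true → bad zero v ≡ false
  G⇒good v Gv with does (zero Fin.≟ τ v) | bad zero v | proj₁ (proj₂ chosen) v Gv
  ... | true | false | _ = refl
  lift≢1 : ∀ l → 𝟙 (does (suc zero Fin.≟ lift l)) ≡ 0
  lift≢1 zero = refl
  lift≢1 (suc l) = refl
  lift-suc : ∀ i l → 𝟙 (does (suc (suc i) Fin.≟ lift l)) ≡ 𝟙 (does (suc i Fin.≟ l))
  lift-suc i zero = refl
  lift-suc i (suc l) = refl
  ∑τ′ : ∀ i → ∑[ v < n ] 𝟙 (does (suc i Fin.≟ τ′ v)) ≡ p
  ∑τ′ zero = trans (∑-cong eq) (proj₂ (proj₂ chosen))
    where
    eq : ∀ v → 𝟙 (does (suc zero Fin.≟ τ′ v)) ≡ 𝟙 (G v)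
    eq v with G v
    ... | true = refl
    ... | false = lift≢1 (τ v)
  ∑τ′ (suc i) = trans (∑-cong eq) (∑τ i)
    where
    eq : ∀ v → 𝟙 (does (suc (suc i) Fin.≟ τ′ v)) ≡ 𝟙 (does (suc i Fin.≟ τ v))
    eq v with G v in Gv
    ... | true rewrite G⇒0 v Gv = refl
    ... | false = lift-suc i (τ v)
  τ′-good : ∀ v i → τ′ v ≡ suc i → bad i v ≡ false
  τ′-good v i eq with G v in Gv
  τ′-good v .zero refl | true = G⇒good v Gv
  τ′-good v i eq | false with τ v in τv
  τ′-good v .(suc l) refl | false | suc l = τ-good v l τv

-- Oblivious programs with one state space for all layers

-- Embedding every layer into the same `Fin W` lets any segment be started from any state, as the
-- union bound over pairs of a segment and a state requires.
record Uniform {n d r : ℕ} (P : BranchingProgram n d r) (W T : ℕ) : Set where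
  field
    steps : List (Step n d r (Fin W))
    initial : Fin W
    length≤ : length steps ≤ T
    correct : ∀ x → ⟦ P ⟧ x ≡ runˢ steps x initial

module _ {n d r W : ℕ} (a₀ : Fin d) where

  restrict : ∀ v → Fin W → Maybe (Fin v)
  restrict v σ with toℕ σ <? v
  ... | yes σ<v = just (fromℕ< σ<v)
  ... | no _ = nothing

  restrict-inject≤ : ∀ {v} (v≤W : v ≤ W) u → restrict v (Fin.inject≤ u v≤W) ≡ just u
  restrict-inject≤ {v} v≤W u with toℕ (Fin.inject≤ u v≤W) <? v
  ... | yes lt = cong just (Fin.toℕ-injective (trans (Fin.toℕ-fromℕ< lt) (Fin.toℕ-inject≤ u v≤W)))
  ... | no ≮ = contradiction (subst (_< v) (sym (Fin.toℕ-inject≤ u v≤W)) (Fin.toℕ<n u)) ≮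

  -- The vertex `u` witnesses that the layer is inhabited and so has a query label; by obliviousness
  -- any vertex yields the same one. The edge labelled `a₀` supplies the next witness. States beyond
  -- the width of the layer output nothing.
  normalise : ∀ {v ws} → Layers n d r v ws → All (_≤ W) (v ∷ ws) → Fin v → List (Step n d r (Fin W))
  normalise [] _ u = []
  normalise {v} (L ∷ Ls) (v≤W ∷ w≤W ∷ ps) u = record
    { qry = query L u
    ; nxt = λ σ a → maybe′ (λ u → Fin.inject≤ (next L u a) w≤W) σ (restrict v σ)
    ; out = λ σ a → maybe′ (λ u → output L u a) ⊥ (restrict v σ)
    } ∷ normalise Ls (w≤W ∷ ps) (next L u a₀)

  length-normalise : ∀ {v ws} (Ls : Layers n d r v ws) ps u → length (normalise Ls ps u) ≡ length ws
  length-normalise [] _ u = refl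
  length-normalise (L ∷ Ls) (_ ∷ w≤W ∷ ps) u = cong suc (length-normalise Ls (w≤W ∷ ps) _)

  run-normalise : ∀ {v ws} (Ls : Layers n d r v ws) → ObliviousLayers Ls → ∀ v≤W ps u x u′ →
                  run Ls x u′ ≡ runˢ (normalise Ls (v≤W ∷ ps) u) x (Fin.inject≤ u′ v≤W)
  run-normalise [] _ v≤W ps u x u′ = refl
  run-normalise (L ∷ Ls) (same , obl) v≤W (w≤W ∷ ps) u x u′
    rewrite restrict-inject≤ v≤W u′ | same u u′
    = cong (output L u′ _ ∪_) (run-normalise Ls obl w≤W ps _ x _)

  uniform : ∀ (P : BranchingProgram n d r) {T} → Oblivious P → All (_≤ W) (1 ∷ widths P) → HasTime P T → Uniform P W T
  uniform P obl (1≤W ∷ ps) t = record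
    { steps = normalise (layers P) (1≤W ∷ ps) zero
    ; initial = Fin.inject≤ zero 1≤W
    ; length≤ = ≤-trans (≤-reflexive (length-normalise (layers P) _ _)) t
    ; correct = λ x → run-normalise (layers P) obl 1≤W ps zero x zero
    }

-- The deterministic lower bound

-- Bernoulli's inequality 1 + tz/q ≤ (1 + z/q)^t multiplied by q^(t+1).
bernoulli : ∀ q z t → (q + t * z) * q ^ t ≤ q * (q + z) ^ t
bernoulli q z zero = ≤-reflexive (cong (_* 1) (+-identityʳ q))
bernoulli q z (suc t) = begin
  (q + suc t * z) * q ^ suc t                       ≡⟨ eq₁ q z (t * z) (q ^ t) ⟩
  q * ((q + t * z) * q ^ t) + z * (q * q ^ t)       ≤⟨ +-mono-≤ (*-monoʳ-≤ q (bernoulli q z t)) (*-monoʳ-≤ z (*-monoʳ-≤ q (^-monoˡ-≤ t (m≤m+n q z)))) ⟩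
  q * (q * (q + z) ^ t) + z * (q * (q + z) ^ t)     ≡⟨ eq₂ q z ((q + z) ^ t) ⟩
  q * (q + z) ^ suc t                               ∎
  where
  open ≤-Reasoning
  eq₁ : ∀ q z b c → (q + (z + b)) * (q * c) ≡ q * ((q + b) * c) + z * (q * c)
  eq₁ = solve-∀
  eq₂ : ∀ q z c → q * (q * c) + z * (q * c) ≡ q * ((q + z) * c)
  eq₂ = solve-∀

-- If `z` of `q + z` outcomes are hits and hits have probability at least 1/t, then `t` draws all
-- miss with probability at most 1/2, because tz ≥ q makes the left side of Bernoulli's inequality
-- at least 2. The lower bound uses it for reserved values avoiding an output, the upper bound for
-- samples missing an element.
halving : ∀ q z t → 0 < t → q + z ≤ t * z → 2 * q ^ t ≤ (q + z) ^ t
halving zero z (suc t) _ _ = z≤n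
halving q@(suc _) z t _ h = *-cancelˡ-≤ q (begin
  q * (2 * q ^ t)        ≡⟨ eq q (q ^ t) ⟩
  (q + q) * q ^ t        ≤⟨ *-monoˡ-≤ (q ^ t) (+-monoʳ-≤ q (≤-trans (m≤m+n q z) h)) ⟩
  (q + t * z) * q ^ t    ≤⟨ bernoulli q z t ⟩
  q * (q + z) ^ t        ∎)
  where
  open ≤-Reasoning
  eq : ∀ q a → q * (2 * a) ≡ (q + q) * a
  eq = solve-∀

^-distribʳ-* : ∀ s a b → (a * b) ^ s ≡ a ^ s * b ^ s
^-distribʳ-* zero a b = refl
^-distribʳ-* (suc s) a b = trans (cong (a * b *_) (^-distribʳ-* s a b)) ([m*n]*[o*p]≡[m*o]*[n*p] a b (a ^ s) (b ^ s))

halving^ : ∀ q z t s → 0 < t → q + z ≤ t * z → 2 ^ s * q ^ (t * s) ≤ (q + z) ^ (t * s)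
halving^ q z t s 0<t h = begin
  2 ^ s * q ^ (t * s)       ≡⟨ cong (2 ^ s *_) (^-*-assoc q t s) ⟨
  2 ^ s * (q ^ t) ^ s       ≡⟨ ^-distribʳ-* s 2 (q ^ t) ⟨
  (2 * q ^ t) ^ s           ≤⟨ ^-monoˡ-≤ s (halving q z t 0<t h) ⟩
  ((q + z) ^ t) ^ s         ≡⟨ ^-*-assoc (q + z) t s ⟩
  (q + z) ^ (t * s)         ∎
  where
  open ≤-Reasoning

m<2^[1+⌊log₂m⌋] : ∀ m → m < 2 ^ suc ⌊log₂ m ⌋
m<2^[1+⌊log₂m⌋] m = go m m ≤-refl
  where
  go : ∀ k m → m ≤ k → m < 2 ^ suc ⌊log₂ m ⌋
  go k zero _ = s≤s z≤n
  go k (suc zero) _ = s≤s (s≤s z≤n)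
  go (suc k) m@(suc (suc m′)) (s≤s m≤k) = begin-strict
    m                                  ≡⟨ ⌊n/2⌋+⌈n/2⌉≡n m ⟨
    h + ⌈ m /2⌉                        ≤⟨ +-monoʳ-≤ h (⌊n/2⌋-mono {suc m} {suc (suc m)} (n≤1+n _)) ⟩
    h + suc h                          <⟨ +-mono-<-≤ IH IH ⟩
    2 ^ suc ⌊log₂ h ⌋ + 2 ^ suc ⌊log₂ h ⌋  ≡⟨ cong (2 ^ suc ⌊log₂ h ⌋ +_) (+-identityʳ _) ⟨
    2 ^ suc (suc ⌊log₂ h ⌋)            ≡⟨ cong (λ e → 2 ^ suc e) (trans (cong suc (⌊log₂⌊n/2⌋⌋≡⌊log₂n⌋∸1 m)) (m+[n∸m]≡n (⌊log₂⌋-mono-≤ {2} {m} (s≤s (s≤s z≤n))))) ⟩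
    2 ^ suc ⌊log₂ m ⌋                  ∎
    where
    open ≤-Reasoning
    h = ⌊ m /2⌋
    IH : h < 2 ^ suc ⌊log₂ h ⌋
    IH = go k h (≤-trans (s≤s (⌊n/2⌋≤n m′)) m≤k)

-- Averaging without division; positivity of `B` rules out an empty sum.
pigeonhole-≥ : ∀ {N B} (f : Fin N → ℕ) → 0 < B → B ≤ ∑ N f → ∃[ j ] B ≤ N * f j
pigeonhole-≥ {N} {suc b} f _ B≤ with Fin.any? (λ j → suc b ≤? N * f j)
... | yes found = found
... | no none = contradiction (*-cancelˡ-≤ N ⦃ N≢0 ⦄ (begin
    N * suc b              ≤⟨ *-monoʳ-≤ N B≤ ⟩
    N * ∑ N f              ≡⟨ ∑-*ˡ N f ⟨
    ∑[ j < N ] (N * f j)   ≤⟨ ∑-mono (λ j → ≤-pred (≰⇒> λ le → none (j , le))) ⟩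
    ∑[ j < N ] b           ≡⟨ ∑-const N b ⟩
    N * b                  ∎)) (<⇒≱ ≤-refl)
  where
  open ≤-Reasoning
  nonEmpty : ∀ {N} (f : Fin N → ℕ) → suc b ≤ ∑ N f → NonZero N
  nonEmpty {zero} f B≤ = contradiction (≤-trans B≤ (≤-reflexive (∑-zero f))) λ ()
  nonEmpty {suc _} f B≤ = _
  N≢0 : NonZero N
  N≢0 = nonEmpty f B≤

module _ {n p : ℕ} (1<n : 1 < n) (1<p : 1 < p) (p∣n : p ∣ n) where

  private
    c₀ c₁ : Fin n
    c₀ = fromℕ< (<-trans z<s 1<n)
    c₁ = fromℕ< 1<n
    c₀≢c₁ : c₁ ≢ c₀
    c₀≢c₁ eq = contradiction (trans (sym (Fin.toℕ-fromℕ< 1<n)) (trans (cong toℕ eq) (Fin.toℕ-fromℕ< (<-trans z<s 1<n)))) λ ()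

  -- The constant input `c₀` satisfies the promise because p divides n, and `c₁` belongs to its
  -- output. Changing one variable to `c₁` gives `c₁` multiplicity 1 < p, so the output becomes
  -- empty; the program must notice the change.
  reads-all : ∀ {St} (ss : List (Step n n n St)) σ → (∀ x → NonOccurringElements n p x ≡ runˢ ss x σ) →
              ∀ v → reads ss v ≡ true
  reads-all ss σ h v with reads ss v in unread
  ... | true = refl
  ... | false = contradiction true≡false λ ()
    where
    x y : Vec (Fin n) n
    x = Vec.replicate n c₀
    y = x [ v ]≔ c₁
    agree : ∀ i → reads ss i ≡ true → lookup x i ≡ lookup y i
    agree i ri = sym (Vec.lookup∘update′ (λ { refl → contradiction (trans (sym ri) unread) λ () }) x c₁)
    x-ok : ∀ c → p ∣ count (c Fin.≟_) x
    x-ok c = subst (p ∣_) (sym eq) (∣n⇒∣m*n′ (𝟙 (does (c Fin.≟ c₀))))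
      where
      eq : count (c Fin.≟_) x ≡ n * 𝟙 (does (c Fin.≟ c₀))
      eq = trans (count≡∑ (c Fin.≟_) x) (trans (∑-cong λ i → cong (λ z → 𝟙 (does (c Fin.≟ z))) (Vec.lookup-replicate i c₀)) (∑-const n _))
      ∣n⇒∣m*n′ : ∀ m → p ∣ n * m
      ∣n⇒∣m*n′ m = ∣m⇒∣m*n m p∣n
    y-bad : ¬ (∀ c → p ∣ count (c Fin.≟_) y)
    y-bad ok = contradiction (∣⇒≤ (subst (p ∣_) eq (ok c₁))) (<⇒≱ 1<p)
      where
      pt : ∀ i → 𝟙 (does (c₁ Fin.≟ lookup y i)) ≡ 𝟙 (does (i Fin.≟ v))
      pt i with i Fin.≟ v
      ... | yes refl = cong 𝟙 (dec-true (c₁ Fin.≟ _) (sym (Vec.lookup∘updateAt v x)))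
      ... | no i≢v = cong 𝟙 (dec-false (c₁ Fin.≟ _) λ eq → c₀≢c₁ (trans eq (trans (Vec.lookup∘update′ i≢v x c₁) (Vec.lookup-replicate i c₀))))
      eq : count (c₁ Fin.≟_) y ≡ 1
      eq = trans (count≡∑ (c₁ Fin.≟_) y) (trans (∑-cong pt) (∑-δ₁ v))
    x-out : lookup (nonOccurring x) c₁ ≡ true
    x-out = trans (lookup-nonOccurring x c₁) (cong not c₁∉x)
      where
      c₁∉x : occurs x c₁ ≡ false
      c₁∉x with occurs x c₁ in occ
      ... | false = refl
      ... | true with i , eq ← occurs⇒ x c₁ occ = contradiction (trans eq (Vec.lookup-replicate i c₀)) c₀≢c₁
    true≡false : true ≡ false
    true≡false = begin
      true                                        ≡⟨ x-out ⟨
      lookup (nonOccurring x) c₁                  ≡⟨ cong (λ Y → lookup Y c₁) (promise⇒ x p x-ok) ⟨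
      lookup (NonOccurringElements n p x) c₁      ≡⟨ cong (λ Y → lookup Y c₁) (trans (h x) (trans (run-cong ss agree σ) (sym (h y)))) ⟩
      lookup (NonOccurringElements n p y) c₁      ≡⟨ cong (λ Y → lookup Y c₁) (¬promise⇒ y p y-bad) ⟩
      lookup {n = n} ⊥ c₁                         ≡⟨ lookup-⊥ c₁ ⟩
      false                                       ∎
      where open ≡-Reasoning

  n≤length : ∀ {St} (ss : List (Step n n n St)) σ → (∀ x → NonOccurringElements n p x ≡ runˢ ss x σ) → n ≤ length ss
  n≤length ss σ h = begin
    n                              ≡⟨ trans (∑-const n 1) (*-identityʳ n) ⟨
    ∑[ v < n ] 1                   ≡⟨ ∑-cong (λ v → cong 𝟙 (reads-all ss σ h v)) ⟨
    ∑[ v < n ] 𝟙 (reads ss v)      ≤⟨ ∑-reads ss ⟩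
    length ss                      ∎
    where open ≤-Reasoning

-- The share of hard inputs served by one segment and one state

allᵇ-lookup : ∀ {A : Set} {K} (P : A → Bool) (v : Vec A K) → (∀ i → P (lookup v i) ≡ true) → allᵇ P v ≡ true
allᵇ-lookup P [] h = refl
allᵇ-lookup P (a ∷ v) h rewrite h zero = allᵇ-lookup P v (h ∘ suc)

≢true⇒not : ∀ b → b ≢ true → not b ≡ true
≢true⇒not true h = contradiction refl h
≢true⇒not false h = refl

𝟙-does⇒ : ∀ {A : Set} m (A? : Dec A) → 1 ≤ m * 𝟙 (does A?) → A
𝟙-does⇒ m (yes a) _ = a
𝟙-does⇒ m (no _) le = contradiction (≤-trans le (≤-reflexive (*-zeroʳ m))) λ ()

module _ {n p : ℕ} (1<n : 1 < n) (1<p : 1 < p) (p∣n : p ∣ n) {W : ℕ}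
         (ss : List (Step n n n (Fin W))) (σ₀ : Fin W)
         (computes : ∀ x → NonOccurringElements n p x ≡ runˢ ss x σ₀)
         (ℓ N s : ℕ) (0<N : 0 < N) (short : length ss ≤ N * ℓ) where

  private
    -- A large output contains a share of at least 1/(4N) of [n], so 4N random values avoid it with
    -- probability at most 1/2, and `r` values with probability at most 2^(-s). `K` counts the
    -- reserved groups of all segments, `M` the possible contents of one block.
    r = 4 * N * s
    K = N * r
    M = n ^ r
    c₀ : Fin n
    c₀ = fromℕ< (<-trans z<s 1<n)
    seg : Fin N → List (Step n n n (Fin W))
    seg = lookup (segments ℓ N ss)
    bad : Fin K → Fin n → Bool
    bad i = reads (seg (Fin.quotient r i))

  -- The variables are labelled by τ: label zero means the default value c₀, and label suc i
  -- belongs to block quotient r i.  Each block chooses r values, one per label, independently.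
  module Labelled (τ : Fin n → Fin (suc K)) (∑τ : ∀ i → ∑[ v < n ] 𝟙 (does (suc i Fin.≟ τ v)) ≡ p)
                  (τ-good : ∀ v i → τ v ≡ suc i → bad i v ≡ false) (few : 4 * K ≤ n) where
    private
      value : Vec (Fin M) N → Fin (suc K) → Fin n
      value a zero = c₀
      value a (suc i) = lookup (decode r (lookup a (Fin.quotient r i))) (Fin.remainder {N} r i)

      input : Vec (Fin M) N → Vec (Fin n) n
      input a = tabulate (λ v → value a (τ v))

      lookup-input : ∀ a v → lookup (input a) v ≡ value a (τ v)
      lookup-input a v = Vec.lookup∘tabulate _ v

      fibre-∣ : ∀ l → p ∣ ∑[ v < n ] 𝟙 (does (l Fin.≟ τ v))
      fibre-∣ zero = ∣m+n∣n⇒∣m _ (subst (p ∣_) (sym (∑-fibre₀ τ ∑τ)) p∣n) (n∣m*n K)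
      fibre-∣ (suc i) = ∣-reflexive (sym (∑τ i))

      -- The multiplicity of `c` is the total size of the label classes that received the value `c`.
      -- Each class size is a multiple of p, so coincidences between values, also with the default
      -- `c₀`, do no harm.
      promise : ∀ a c → p ∣ count (c Fin.≟_) (input a)
      promise a c = subst (p ∣_) (sym eq) (∣-∑ λ l → ∣m⇒∣m*n _ (fibre-∣ l))
        where
        eq : count (c Fin.≟_) (input a) ≡ ∑[ l < suc K ] (∑[ v < n ] 𝟙 (does (l Fin.≟ τ v)) * 𝟙 (does (c Fin.≟ value a l)))
        eq = trans (count≡∑ (c Fin.≟_) (input a))
            (trans (∑-cong λ v → cong (λ z → 𝟙 (does (c Fin.≟ z))) (lookup-input a v)) (∑-fibres τ (λ l → 𝟙 (does (c Fin.≟ value a l)))))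

      run≡ : ∀ a → runˢ ss (input a) σ₀ ≡ nonOccurring (input a)
      run≡ a = trans (sym (computes (input a))) (promise⇒ (input a) p (promise a))

      ∑-occurs : ∀ a → ∑[ c < n ] 𝟙 (occurs (input a) c) ≤ suc K
      ∑-occurs a = begin
        ∑[ c < n ] 𝟙 (occurs (input a) c)                               ≤⟨ ∑-mono pt ⟩
        ∑[ c < n ] ∑[ l < suc K ] 𝟙 (does (c Fin.≟ value a l))          ≡⟨ ∑-swap _ ⟩
        ∑[ l < suc K ] ∑[ c < n ] 𝟙 (does (c Fin.≟ value a l))          ≡⟨ ∑-cong (λ l → ∑-δ₁ (value a l)) ⟩
        ∑[ l < suc K ] 1                                                ≡⟨ trans (∑-const (suc K) 1) (*-identityʳ _) ⟩
        suc K                                                           ∎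
        where
        open ≤-Reasoning
        pt : ∀ c → 𝟙 (occurs (input a) c) ≤ ∑[ l < suc K ] 𝟙 (does (c Fin.≟ value a l))
        pt c with occurs (input a) c in occ
        ... | false = z≤n
        ... | true with v , eq ← occurs⇒ (input a) c occ =
          ≤-trans (≤-reflexive (sym (cong 𝟙 (dec-true (c Fin.≟ value a (τ v)) (trans eq (lookup-input a v))))))
                  (term≤∑ (λ l → 𝟙 (does (c Fin.≟ value a l))) (τ v))

      card-nonOccurring : ∀ a → n ≤ 4 * card (nonOccurring (input a))
      card-nonOccurring a = +-cancelʳ-≤ (4 + 4 * K) n _ (begin
        -- At most K + 1 values occur: 4 ≤ 2n pays for the default value, `few` for the others.
        n + (4 + 4 * K)         ≤⟨ +-monoʳ-≤ n (+-mono-≤ {4} {n + n} (+-mono-≤ {2} {n} {2} 1<n 1<n) few) ⟩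
        n + (n + n + n)         ≡⟨ eq₁ n ⟩
        4 * n                   ≤⟨ *-monoʳ-≤ 4 n≤ ⟩
        4 * (card Y + suc K)    ≡⟨ eq₂ (card Y) K ⟩
        4 * card Y + (4 + 4 * K) ∎)
        where
        open ≤-Reasoning
        Y = nonOccurring (input a)
        eq₁ : ∀ n → n + (n + n + n) ≡ 4 * n
        eq₁ = solve-∀
        eq₂ : ∀ y k → 4 * (y + suc k) ≡ 4 * y + (4 + 4 * k)
        eq₂ = solve-∀
        n≤ : n ≤ card Y + suc K
        n≤ = begin
          n                                                                       ≡⟨ trans (∑-const n 1) (*-identityʳ n) ⟨
          ∑[ c < n ] 1                                                            ≡⟨ ∑-cong (λ c → 𝟙+𝟙-not (occurs (input a) c)) ⟨
          ∑[ c < n ] (𝟙 (occurs (input a) c) + 𝟙 (not (occurs (input a) c)))      ≡⟨ ∑-+ _ _ ⟩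
          ∑[ c < n ] 𝟙 (occurs (input a) c) + ∑[ c < n ] 𝟙 (not (occurs (input a) c))  ≤⟨ +-mono-≤ (∑-occurs a) (≤-reflexive (∑-cong λ c → cong 𝟙 (sym (lookup-nonOccurring (input a) c)))) ⟩
          suc K + card Y                                                          ≡⟨ +-comm (suc K) _ ⟩
          card Y + suc K                                                          ∎

      O : Fin N → Fin W → Vec (Fin M) N → Subset n
      O j u a = runˢ (seg j) (input a) u

      large : Fin N → Fin W → Vec (Fin M) N → Bool
      large j u a = does (n ≤? 4 * N * card (O j u a))

      avoids : Subset n → Vec (Fin n) r → Bool
      avoids Y = allᵇ (λ c → not (lookup Y c))

      -- The state `u` is a parameter, not the state in which segment `j` starts on `input a`. This
      -- makes `O j u a` independent of block `j`, at the price of a union over all `W` states.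
      event : Fin N → Fin W → Vec (Fin M) N → Bool
      event j u a = large j u a ∧ avoids (O j u a) (decode r (lookup a j))

      some-event : ∀ a → 1 ≤ ∑[ j < N ] ∑[ u < W ] 𝟙 (event j u a)
      some-event a = goal
        where
        open ≤-Reasoning
        segs = run-segments ℓ N ss short (input a) σ₀
        u = proj₁ segs
        found : ∃[ j ] n ≤ N * (4 * card (O j (u j) a))
        found = pigeonhole-≥ _ (<-trans z<s 1<n) (begin
          n                                              ≤⟨ card-nonOccurring a ⟩
          4 * card (nonOccurring (input a))              ≡⟨ cong (λ Y → 4 * card Y) (run≡ a) ⟨
          4 * card (runˢ ss (input a) σ₀)                ≤⟨ *-monoʳ-≤ 4 (proj₂ (proj₂ segs)) ⟩
          4 * ∑[ j < N ] card (O j (u j) a)              ≡⟨ ∑-*ˡ 4 _ ⟨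
          ∑[ j < N ] (4 * card (O j (u j) a))            ∎)
        j = proj₁ found
        is-large : large j (u j) a ≡ true
        is-large = dec-true (n ≤? _) (≤-trans (proj₂ found) (≤-reflexive (eq N (card (O j (u j) a)))))
          where
          eq : ∀ N z → N * (4 * z) ≡ 4 * N * z
          eq = solve-∀
        is-avoiding : ∀ i → not (lookup (O j (u j) a) (lookup (decode r (lookup a j)) i)) ≡ true
        is-avoiding i = ≢true⇒not (lookup (O j (u j) a) c) λ isOut →
          contradiction (trans (sym (nonocc isOut)) (trans (lookup-nonOccurring (input a) c) (cong not occ))) λ ()
          where
          l = combine j i
          c = lookup (decode r (lookup a j)) i
          value-l : value a (suc l) ≡ c
          value-l = cong (λ (q , t) → lookup (decode r (lookup a q)) t) (Fin.remQuot-combine j i)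
          nonocc : lookup (O j (u j) a) c ≡ true → lookup (nonOccurring (input a)) c ≡ true
          nonocc isOut = trans (cong (λ Y → lookup Y c) (sym (run≡ a))) (proj₁ (proj₂ segs) j c isOut)
          -- A group has p > 0 variables, so each reserved value really occurs in the input; a
          -- correct segment therefore cannot output it.
          labelled : ∃[ v ] 1 ≤ n * 𝟙 (does (suc l Fin.≟ τ v))
          labelled = pigeonhole-≥ _ z<s (≤-trans (<⇒≤ 1<p) (≤-reflexive (sym (∑τ l))))
          τ-labelled : ∀ v → 1 ≤ n * 𝟙 (does (suc l Fin.≟ τ v)) → suc l ≡ τ v
          τ-labelled v = 𝟙-does⇒ n (suc l Fin.≟ τ v)
          v = proj₁ labelled
          occ : occurs (input a) c ≡ true
          occ = subst (λ z → occurs (input a) z ≡ true)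
                  (trans (lookup-input a v) (trans (cong (value a) (sym (τ-labelled v (proj₂ labelled)))) value-l))
                  (occurs-lookup (input a) v)
        goal : 1 ≤ ∑[ j < N ] ∑[ u < W ] 𝟙 (event j u a)
        goal = begin
          1                                              ≡⟨ cong 𝟙 (cong₂ _∧_ is-large (allᵇ-lookup _ (decode r (lookup a j)) is-avoiding)) ⟨
          𝟙 (event j (u j) a)                            ≤⟨ term≤∑ (λ u → 𝟙 (event j u a)) (u j) ⟩
          ∑[ u < W ] 𝟙 (event j u a)                     ≤⟨ term≤∑ (λ j → ∑[ u < W ] 𝟙 (event j u a)) j ⟩
          ∑[ j < N ] ∑[ u < W ] 𝟙 (event j u a)          ∎

      -- Segment j never queries a variable labelled by block j.
      O-resample : ∀ j u a b → O j u (a [ j ]≔ b) ≡ O j u a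
      O-resample j u a b = run-cong (seg j) agree u
        where
        same : ∀ l → (∀ i → l ≡ suc i → Fin.quotient r i ≢ j) → value (a [ j ]≔ b) l ≡ value a l
        same zero _ = refl
        same (suc i) h = cong (λ z → lookup (decode r z) (Fin.remainder {N} r i)) (Vec.lookup∘update′ (h i refl) a b)
        q≢j : ∀ v → reads (seg j) v ≡ true → ∀ i → τ v ≡ suc i → Fin.quotient r i ≢ j
        q≢j v rv i τv eq = contradiction (trans (sym rv) (trans (cong (λ k → reads (seg k) v) (sym eq)) (τ-good v i τv))) λ ()
        agree : ∀ v → reads (seg j) v ≡ true → lookup (input (a [ j ]≔ b)) v ≡ lookup (input a) v
        agree v rv = trans (lookup-input _ v) (trans (same (τ v) (q≢j v rv)) (sym (lookup-input a v)))

      -- With the other blocks fixed, the output `Y` is a fixed set, while the `r` values of block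
      -- `j` are independent and uniform; `halving^` applies with hit probability card Y / n.
      ∑-event-block : ∀ j u a → 2 ^ s * ∑[ b < M ] 𝟙 (event j u (a [ j ]≔ b)) ≤ M
      ∑-event-block j u a = begin
        2 ^ s * ∑[ b < M ] 𝟙 (event j u (a [ j ]≔ b))                         ≡⟨ cong (2 ^ s *_) (∑-cong λ b → cong 𝟙 (cong₂ (λ Y z → does (n ≤? 4 * N * card Y) ∧ avoids Y (decode r z)) (O-resample j u a b) (Vec.lookup∘updateAt j a))) ⟩
        2 ^ s * ∑[ b < M ] 𝟙 (large j u a ∧ avoids (O j u a) (decode r b))    ≡⟨ cong (2 ^ s *_) (∑-decode r (λ w → 𝟙 (large j u a ∧ avoids (O j u a) w))) ⟩
        2 ^ s * ∑ᵛ r (λ w → 𝟙 (large j u a ∧ avoids (O j u a) w))             ≤⟨ bound (n ≤? 4 * N * card Y) ⟩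
        M                                                                     ∎
        where
        open ≤-Reasoning
        Y = O j u a
        q = ∑[ c < n ] 𝟙 (not (lookup Y c))
        q+z : q + card Y ≡ n
        q+z = begin-equality
          q + card Y                                                      ≡⟨ +-comm q _ ⟩
          card Y + q                                                      ≡⟨ ∑-+ _ _ ⟨
          ∑[ c < n ] (𝟙 (lookup Y c) + 𝟙 (not (lookup Y c)))              ≡⟨ ∑-cong (λ c → 𝟙+𝟙-not (lookup Y c)) ⟩
          ∑[ c < n ] 1                                                    ≡⟨ trans (∑-const n 1) (*-identityʳ n) ⟩
          n                                                               ∎
        bound : (d : Dec (n ≤ 4 * N * card Y)) → 2 ^ s * ∑ᵛ r (λ w → 𝟙 (does d ∧ avoids Y w)) ≤ M
        bound (no _) = ≤-trans (≤-reflexive (trans (cong (2 ^ s *_) (trans (∑ᵛ-const r 0) (*-zeroʳ (n ^ r)))) (*-zeroʳ (2 ^ s)))) z≤n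
        bound (yes n≤) = begin
          2 ^ s * ∑ᵛ r (λ w → 𝟙 (avoids Y w))     ≡⟨ cong (2 ^ s *_) (∑ᵛ-allᵇ r _) ⟩
          2 ^ s * q ^ r                           ≤⟨ halving^ q (card Y) (4 * N) s (*-mono-≤ {1} {4} (s≤s z≤n) 0<N) (≤-trans (≤-reflexive q+z) n≤) ⟩
          (q + card Y) ^ r                        ≡⟨ cong (_^ r) q+z ⟩
          M                                       ∎

      instance
        M≢0 : NonZero M
        M≢0 = m^n≢0 n r ⦃ >-nonZero (<-trans z<s 1<n) ⦄

      ∑ᵛ-event : ∀ j u → 2 ^ s * ∑ᵛ N (λ a → 𝟙 (event j u a)) ≤ M ^ N
      ∑ᵛ-event j u = *-cancelˡ-≤ M (begin
        M * (2 ^ s * ∑ᵛ N (λ a → 𝟙 (event j u a)))                          ≡⟨ eq M (2 ^ s) _ ⟩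
        2 ^ s * (M * ∑ᵛ N (λ a → 𝟙 (event j u a)))                          ≡⟨ cong (2 ^ s *_) (∑ᵛ-resample j _) ⟨
        2 ^ s * ∑ᵛ N (λ a → ∑[ b < M ] 𝟙 (event j u (a [ j ]≔ b)))          ≡⟨ ∑ᵛ-*ˡ (2 ^ s) _ ⟨
        ∑ᵛ N (λ a → 2 ^ s * ∑[ b < M ] 𝟙 (event j u (a [ j ]≔ b)))          ≤⟨ ∑ᵛ-mono (∑-event-block j u) ⟩
        ∑ᵛ N (λ a → M)                                                      ≡⟨ trans (∑ᵛ-const N M) (*-comm (M ^ N) M) ⟩
        M * M ^ N                                                           ∎)
        where
        open ≤-Reasoning
        eq : ∀ a b c → a * (b * c) ≡ b * (a * c)
        eq = solve-∀

    2^s≤ : 2 ^ s ≤ N * W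
    2^s≤ = *-cancelʳ-≤ _ _ (M ^ N) ⦃ m^n≢0 M N ⦄ (begin
      2 ^ s * M ^ N                                                        ≡⟨ cong (2 ^ s *_) (trans (∑ᵛ-const N 1) (*-identityʳ _)) ⟨
      2 ^ s * ∑ᵛ N (λ a → 1)                                               ≤⟨ *-monoʳ-≤ (2 ^ s) (∑ᵛ-mono some-event) ⟩
      2 ^ s * ∑ᵛ N (λ a → ∑[ j < N ] ∑[ u < W ] 𝟙 (event j u a))           ≡⟨ cong (2 ^ s *_) (trans (∑ᵛ-sum _) (∑-cong λ j → ∑ᵛ-sum _)) ⟩
      2 ^ s * ∑[ j < N ] ∑[ u < W ] ∑ᵛ N (λ a → 𝟙 (event j u a))           ≡⟨ trans (sym (∑-*ˡ (2 ^ s) _)) (∑-cong λ j → sym (∑-*ˡ (2 ^ s) _)) ⟩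
      ∑[ j < N ] ∑[ u < W ] (2 ^ s * ∑ᵛ N (λ a → 𝟙 (event j u a)))         ≤⟨ ∑-mono (λ j → ∑-mono λ u → ∑ᵛ-event j u) ⟩
      ∑[ j < N ] ∑[ u < W ] (M ^ N)                                        ≡⟨ trans (∑-cong λ j → ∑-const W (M ^ N)) (∑-const N _) ⟩
      N * (W * M ^ N)                                                      ≡⟨ *-assoc N W (M ^ N) ⟨
      N * W * M ^ N                                                        ∎)
      where open ≤-Reasoning

  2^s≤N*W : K * p + ℓ ≤ n → 4 * K ≤ n → 2 ^ s ≤ N * W
  2^s≤N*W room few with assign K bad (λ i → ≤-trans (∑-reads (seg (Fin.quotient r i))) (length-segments ℓ N ss _)) room
  ... | τ , ∑τ , τ-good = Labelled.2^s≤ τ ∑τ τ-good few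

-- Parameters of the lower bound

module _ {n p : ℕ} (1<n : 1 < n) (1<p : 1 < p) (p∣n : p ∣ n) where

  lower-bound : ∀ (P : BranchingProgram n n n) S T → Oblivious P → HasSpace P S → HasTime P T →
                Computes P (NonOccurringElements n p) →
                n ^ 3 ≤ 1152 * (p * (T ^ 2 * (S + ⌊log₂ T ⌋)))
  lower-bound P S T obl space time computes = final
    where
    open ≤-Reasoning
    U = uniform (fromℕ< 1<n) P obl space time
    open Uniform U
    computes′ : ∀ x → NonOccurringElements n p x ≡ runˢ steps x initial
    computes′ x = trans (sym (computes x)) (correct x)
    n≤T : n ≤ T
    n≤T = ≤-trans (n≤length 1<n 1<p p∣n steps initial computes′) length≤
    g = _∣_.quotient p∣n
    n≡gp : n ≡ g * p
    n≡gp = _∣_.equality p∣n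
    ℓ = n / 2
    0<ℓ : 0 < ℓ
    0<ℓ = /-monoˡ-≤ 2 1<n
    instance
      ℓ≢0 : NonZero ℓ
      ℓ≢0 = >-nonZero 0<ℓ
    N = suc (T / ℓ)
    instance
      D≢0 : NonZero (8 * (N * N))
      D≢0 = m*n≢0 8 (N * N)
    -- The largest integer with 2Kp = 8N²sp ≤ n, where `g` is n/p: half of the variables may be
    -- reserved, since a segment reads at most the other half.
    s = g / (8 * (N * N))
    2ℓ≤n : ℓ * 2 ≤ n
    2ℓ≤n = m/n*n≤m n 2
    n≤3ℓ : n ≤ 3 * ℓ
    n≤3ℓ = begin
      n                ≡⟨ m≡m%n+[m/n]*n n 2 ⟩
      n % 2 + ℓ * 2    ≤⟨ +-monoˡ-≤ (ℓ * 2) (≤-trans (≤-pred (m%n<n n 2)) 0<ℓ) ⟩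
      ℓ + ℓ * 2        ≡⟨ cong (ℓ +_) (*-comm ℓ 2) ⟩
      3 * ℓ            ∎
    T≤Nℓ : T ≤ N * ℓ
    T≤Nℓ = begin
      T                  ≡⟨ m≡m%n+[m/n]*n T ℓ ⟩
      T % ℓ + T / ℓ * ℓ  ≤⟨ +-monoˡ-≤ (T / ℓ * ℓ) (<⇒≤ (m%n<n T ℓ)) ⟩
      N * ℓ              ∎
    Nn≤6T : N * n ≤ 6 * T
    Nn≤6T = begin
      N * n                  ≤⟨ *-monoʳ-≤ N n≤3ℓ ⟩
      N * (3 * ℓ)            ≡⟨ eq (T / ℓ) ℓ ⟩
      -- The additional segment from rounding up costs ℓ ≤ n ≤ T; here `n≤T` is essential.
      3 * (ℓ + T / ℓ * ℓ)    ≤⟨ *-monoʳ-≤ 3 (+-mono-≤ (≤-trans (≤-trans (m≤m*n ℓ 2) 2ℓ≤n) n≤T) (m/n*n≤m T ℓ)) ⟩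
      3 * (T + T)            ≡⟨ eq′ T ⟩
      6 * T                  ∎
      where
      eq : ∀ a b → suc a * (3 * b) ≡ 3 * (b + a * b)
      eq = solve-∀
      eq′ : ∀ T → 3 * (T + T) ≡ 6 * T
      eq′ = solve-∀
    K = N * (4 * N * s)
    2Kp≤n : 2 * (K * p) ≤ n
    2Kp≤n = begin
      2 * (K * p)              ≡⟨ eq N s p ⟩
      s * (8 * (N * N)) * p    ≤⟨ *-monoˡ-≤ p (m/n*n≤m g (8 * (N * N))) ⟩
      g * p                    ≡⟨ n≡gp ⟨
      n                        ∎
      where
      eq : ∀ N s p → 2 * (N * (4 * N * s) * p) ≡ s * (8 * (N * N)) * p
      eq = solve-∀
    room : K * p + ℓ ≤ n
    room = *-cancelˡ-≤ 2 (begin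
      2 * (K * p + ℓ)      ≡⟨ *-distribˡ-+ 2 (K * p) ℓ ⟩
      2 * (K * p) + 2 * ℓ  ≤⟨ +-mono-≤ 2Kp≤n (≤-trans (≤-reflexive (*-comm 2 ℓ)) 2ℓ≤n) ⟩
      n + n                ≡⟨ cong (n +_) (+-identityʳ n) ⟨
      2 * n                ∎)
    few : 4 * K ≤ n
    few = begin
      4 * K          ≡⟨ trans (*-assoc 2 2 K) (cong (2 *_) (*-comm 2 K)) ⟩
      2 * (K * 2)    ≤⟨ *-monoʳ-≤ 2 (*-monoʳ-≤ K 1<p) ⟩
      2 * (K * p)    ≤⟨ 2Kp≤n ⟩
      n              ∎
    N≤4T : N ≤ 4 * T
    N≤4T = *-cancelʳ-≤ N (4 * T) 2 (begin
      N * 2          ≤⟨ *-monoʳ-≤ N 1<n ⟩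
      N * n          ≤⟨ Nn≤6T ⟩
      6 * T          ≤⟨ *-monoˡ-≤ T {6} {8} (m≤m+n 6 2) ⟩
      8 * T          ≡⟨ eq T ⟩
      4 * T * 2      ∎)
      where
      eq : ∀ T → 8 * T ≡ 4 * T * 2
      eq = solve-∀
    L = ⌊log₂ T ⌋
    1≤L : 1 ≤ L
    1≤L = ⌊log₂⌋-mono-≤ {2} (≤-trans 1<n n≤T)
    -- The 3 collects N ≤ 4T and T < 2 · 2^L.
    s<3+S+L : suc s ≤ 3 + (S + L)
    s<3+S+L = ≰⇒> λ le → <⇒≱ (begin-strict
      2 ^ s                              ≤⟨ 2^s≤N*W 1<n 1<p p∣n steps initial computes′ ℓ N s z<s (≤-trans length≤ T≤Nℓ) room few ⟩
      N * 2 ^ S                          ≤⟨ *-monoˡ-≤ (2 ^ S) N≤4T ⟩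
      4 * T * 2 ^ S                      <⟨ *-monoˡ-< (2 ^ S) ⦃ m^n≢0 2 S ⦄ (*-monoʳ-< 4 (m<2^[1+⌊log₂m⌋] T)) ⟩
      4 * (2 * 2 ^ L) * 2 ^ S            ≡⟨ trans (eq (2 ^ L) (2 ^ S)) (cong (8 *_) (sym (^-distribˡ-+-* 2 S L))) ⟩
      8 * 2 ^ (S + L)                    ≡⟨ ^-distribˡ-+-* 2 3 (S + L) ⟨
      2 ^ (3 + (S + L))                  ∎) (^-monoʳ-≤ 2 le)
      where
      eq : ∀ a b → 4 * (2 * a) * b ≡ 8 * (b * a)
      eq = solve-∀
    g≤ : g ≤ suc s * (8 * (N * N))
    g≤ = begin
      g                                             ≡⟨ m≡m%n+[m/n]*n g (8 * (N * N)) ⟩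
      g % (8 * (N * N)) + s * (8 * (N * N))         ≤⟨ +-monoˡ-≤ (s * (8 * (N * N))) (<⇒≤ (m%n<n g (8 * (N * N)))) ⟩
      suc s * (8 * (N * N))                         ∎
    -- 1152 = 8 · 4 · 6²: the 8 from the definition of `s`, the 4 from absorbing 3 into S + L by
    -- `1≤L`, and 6² from two uses of `Nn≤6T`. The successor of `s` undoes the rounding in its
    -- definition.
    final : n ^ 3 ≤ 1152 * (p * (T ^ 2 * (S + L)))
    final = begin
      n ^ 3                                             ≡⟨ eq₁ n ⟩
      n * n * n                                         ≡⟨ cong (n * n *_) n≡gp ⟩
      n * n * (g * p)                                   ≤⟨ *-monoʳ-≤ (n * n) (*-monoˡ-≤ p g≤) ⟩
      n * n * (suc s * (8 * (N * N)) * p)               ≡⟨ eq₂ n (suc s) N p ⟩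
      8 * p * (suc s * ((N * n) * (N * n)))             ≤⟨ *-monoʳ-≤ (8 * p) (*-mono-≤ s≤ (*-mono-≤ Nn≤6T Nn≤6T)) ⟩
      8 * p * ((4 * (S + L)) * ((6 * T) * (6 * T)))     ≡⟨ eq₃ p (S + L) T ⟩
      1152 * (p * (T ^ 2 * (S + L)))                    ∎
      where
      s≤ : suc s ≤ 4 * (S + L)
      s≤ = begin
        suc s                      ≤⟨ s<3+S+L ⟩
        3 + (S + L)                ≤⟨ +-monoˡ-≤ (S + L) (*-monoʳ-≤ 3 {1} (≤-trans 1≤L (m≤n+m L S))) ⟩
        3 * (S + L) + (S + L)      ≡⟨ +-comm (3 * (S + L)) _ ⟩
        4 * (S + L)                ∎
      eq₁ : ∀ n → n * (n * (n * 1)) ≡ n * n * n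
      eq₁ = solve-∀
      eq₂ : ∀ n t N p → n * n * (t * (8 * (N * N)) * p) ≡ 8 * p * (t * ((N * n) * (N * n)))
      eq₂ = solve-∀
      eq₃ : ∀ p x T → 8 * p * ((4 * x) * ((6 * T) * (6 * T))) ≡ 1152 * (p * (T * (T * 1) * x))
      eq₃ = solve-∀

-- Uniform distributions and randomized programs

fromℚᵘ-homo-+ : ∀ p q → fromℚᵘ p ℚ.+ fromℚᵘ q ≡ fromℚᵘ (p ℚᵘ.+ q)
fromℚᵘ-homo-+ p q = ℚ.toℚᵘ-injective (begin
  toℚᵘ (fromℚᵘ p ℚ.+ fromℚᵘ q)             ≈⟨ ℚ.toℚᵘ-homo-+ (fromℚᵘ p) (fromℚᵘ q) ⟩
  toℚᵘ (fromℚᵘ p) ℚᵘ.+ toℚᵘ (fromℚᵘ q)     ≈⟨ ℚᵘ.+-cong (ℚ.toℚᵘ-fromℚᵘ p) (ℚ.toℚᵘ-fromℚᵘ q) ⟩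
  p ℚᵘ.+ q                                 ≈⟨ ℚ.toℚᵘ-fromℚᵘ (p ℚᵘ.+ q) ⟨
  toℚᵘ (fromℚᵘ (p ℚᵘ.+ q))                 ∎)
  where open SetoidReasoning ℚᵘ.≃-setoid

fromℚᵘ-homo-* : ∀ p q → fromℚᵘ p ℚ.* fromℚᵘ q ≡ fromℚᵘ (p ℚᵘ.* q)
fromℚᵘ-homo-* p q = ℚ.toℚᵘ-injective (begin
  toℚᵘ (fromℚᵘ p ℚ.* fromℚᵘ q)             ≈⟨ ℚ.toℚᵘ-homo-* (fromℚᵘ p) (fromℚᵘ q) ⟩
  toℚᵘ (fromℚᵘ p) ℚᵘ.* toℚᵘ (fromℚᵘ q)     ≈⟨ ℚᵘ.*-cong (ℚ.toℚᵘ-fromℚᵘ p) (ℚ.toℚᵘ-fromℚᵘ q) ⟩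
  p ℚᵘ.* q                                 ≈⟨ ℚ.toℚᵘ-fromℚᵘ (p ℚᵘ.* q) ⟨
  toℚᵘ (fromℚᵘ (p ℚᵘ.* q))                 ∎)
  where open SetoidReasoning ℚᵘ.≃-setoid

fromℚᵘ-mono-≤ : ∀ {p q} → p ℚᵘ.≤ q → fromℚᵘ p ℚ.≤ fromℚᵘ q
fromℚᵘ-mono-≤ {p} {q} p≤q = ℚ.toℚᵘ-cancel-≤ (begin
  toℚᵘ (fromℚᵘ p)   ≃⟨ ℚ.toℚᵘ-fromℚᵘ p ⟩
  p                 ≤⟨ p≤q ⟩
  q                 ≃⟨ ℚ.toℚᵘ-fromℚᵘ q ⟨
  toℚᵘ (fromℚᵘ q)   ∎)
  where open ℚᵘ.≤-Reasoning

opaque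

  -- Opaque, so that reduction to lowest terms is never unfolded; equations and inequalities between
  -- such fractions become cross products of naturals.
  frac : ℕ → (m : ℕ) → .⦃ NonZero m ⦄ → ℚ
  frac a m = ℤ.+ a ℚ./ m

  frac≡/ : ∀ a m .⦃ _ : NonZero m ⦄ → frac a m ≡ ℤ.+ a ℚ./ m
  frac≡/ a m = refl

  0≡frac : ∀ m .⦃ _ : NonZero m ⦄ → 0ℚ ≡ frac 0 m
  0≡frac (suc m) = ℚ.fromℚᵘ-cong {mkℚᵘ (ℤ.+ 0) 0} {mkℚᵘ (ℤ.+ 0) m} (*≡* refl)

  frac-cong : ∀ a k b m .⦃ _ : NonZero k ⦄ .⦃ _ : NonZero m ⦄ → a * m ≡ b * k → frac a k ≡ frac b m
  frac-cong a (suc k) b (suc m) eq = ℚ.fromℚᵘ-cong {mkℚᵘ (ℤ.+ a) k} {mkℚᵘ (ℤ.+ b) m}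
    (*≡* (trans (sym (ℤ.pos-* a (suc m))) (trans (cong ℤ.+_ eq) (ℤ.pos-* b (suc k)))))

  frac-mono : ∀ a k b m .⦃ _ : NonZero k ⦄ .⦃ _ : NonZero m ⦄ → a * m ≤ b * k → frac a k ℚ.≤ frac b m
  frac-mono a (suc k) b (suc m) le = fromℚᵘ-mono-≤ {mkℚᵘ (ℤ.+ a) k} {mkℚᵘ (ℤ.+ b) m}
    (*≤* (subst₂ ℤ._≤_ (ℤ.pos-* a (suc m)) (ℤ.pos-* b (suc k)) (ℤ.+≤+ le)))

  frac-* : ∀ a k b m .⦃ _ : NonZero k ⦄ .⦃ _ : NonZero m ⦄ →
           frac a k ℚ.* frac b m ≡ frac (a * b) (k * m) ⦃ m*n≢0 k m ⦄
  frac-* a (suc k) b (suc m) = trans (fromℚᵘ-homo-* (mkℚᵘ (ℤ.+ a) k) (mkℚᵘ (ℤ.+ b) m))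
    (cong (ℚ._/ (suc k * suc m)) (sym (ℤ.pos-* a b)))

  frac-+ : ∀ a k b m .⦃ _ : NonZero k ⦄ .⦃ _ : NonZero m ⦄ →
           frac a k ℚ.+ frac b m ≡ frac (a * m + b * k) (k * m) ⦃ m*n≢0 k m ⦄
  frac-+ a (suc k) b (suc m) = trans (fromℚᵘ-homo-+ (mkℚᵘ (ℤ.+ a) k) (mkℚᵘ (ℤ.+ b) m))
    (cong (ℚ._/ (suc k * suc m)) (sym (trans (ℤ.pos-+ (a * suc m) (b * suc k)) (cong₂ ℤ._+_ (ℤ.pos-* a (suc m)) (ℤ.pos-* b (suc k))))))

  1≡frac : 1ℚ ≡ frac 1 1
  1≡frac = refl

∑ℚ-𝟙 : ∀ {s} m .⦃ _ : NonZero m ⦄ (e : Fin s → Bool) →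
       ℚ∑.sum (λ i → if e i then frac 1 m else 0ℚ) ≡ frac (∑[ i < s ] 𝟙 (e i)) m
∑ℚ-𝟙 {zero} m e = trans (0≡frac m) (cong (λ c → frac c m) (sym (∑-zero (𝟙 ∘ e))))
∑ℚ-𝟙 {suc s} m e = trans (cong₂ ℚ._+_ (head-term (e zero)) (∑ℚ-𝟙 m (e ∘ suc)))
                    (trans (frac-+ (𝟙 (e zero)) m c m)
                           (frac-cong (𝟙 (e zero) * m + c * m) (m * m) (∑[ i < suc s ] 𝟙 (e i)) m ⦃ m*n≢0 m m ⦄
                             (trans (eq (𝟙 (e zero)) c m) (cong (_* (m * m)) (sym (∑-suc (𝟙 ∘ e)))))))
  where
  c = ∑[ i < s ] 𝟙 (e (suc i))
  head-term : ∀ b → (if b then frac 1 m else 0ℚ) ≡ frac (𝟙 b) m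
  head-term true = refl
  head-term false = 0≡frac m
  eq : ∀ a c m → (a * m + c * m) * m ≡ (a + c) * (m * m)
  eq = solve-∀

module _ {A : Set} (M : ℕ) .⦃ _ : NonZero M ⦄ (outcomeᵘ : Fin M → A) where

  uniformᵈ : Distribution A
  uniformᵈ = record
    { size = M
    ; weight = λ _ → frac 1 M
    ; outcome = outcomeᵘ
    ; weight≥0 = λ _ → ℚ.≤-trans (ℚ.≤-reflexive (0≡frac M)) (frac-mono 0 M 1 M z≤n)
    ; weight-Σ≡1 = trans (∑ℚ-𝟙 {M} M (λ _ → true))
        (trans (frac-cong (∑[ i < M ] 1) M 1 1 (trans (*-identityʳ (∑[ i < M ] 1)) (trans (∑-const M 1) (*-comm M 1)))) (sym 1≡frac))
    }

  Pr-uniformᵈ : ∀ E → Pr uniformᵈ E ≡ frac (∑[ i < M ] 𝟙 (E (outcomeᵘ i))) M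
  Pr-uniformᵈ E = ∑ℚ-𝟙 {M} M (E ∘ outcomeᵘ)

-- Each entry is a function of its own draw alone. Random programs of this shape have one-way access
-- to their random bits.
instantiate : ∀ {A X : Set} {K} → Vec (A → X) K → Vec A K → List X
instantiate [] [] = []
instantiate (f ∷ fs) (a ∷ v) = f a ∷ instantiate fs v

length-instantiate : ∀ {A X : Set} {K} (fs : Vec (A → X) K) v → length (instantiate fs v) ≡ K
length-instantiate [] [] = refl
length-instantiate (f ∷ fs) (a ∷ v) = cong suc (length-instantiate fs v)

module _ {X : Set} {M : ℕ} where

  private
    at : ℕ → List X → Maybe X
    at k xs = List.head (drop k xs)
    others : ℕ → List X → List X × List X
    others k xs = take k xs , drop (suc k) xs

  -- The sum factors because entry `k` is a function of draw `k` and the rest of the other draws.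
  -- The factor `M ^ K` clears the denominators; past the end of the list `E` sees the constant
  -- `nothing`.
  ∑ᵛ-independent : ∀ k {K} (fs : Vec (Fin M → X) K) (E : Maybe X → Bool) (F : List X × List X → Bool) →
    ∑ᵛ K (λ v → 𝟙 (E (at k (instantiate fs v)) ∧ F (others k (instantiate fs v)))) * M ^ K
    ≡ ∑ᵛ K (λ v → 𝟙 (E (at k (instantiate fs v)))) * ∑ᵛ K (λ v → 𝟙 (F (others k (instantiate fs v))))
  ∑ᵛ-independent zero [] E F =
    trans (cong (_* 1) (∑ᵛ-zero _)) (trans (*-identityʳ _) (trans (𝟙-∧ (E nothing) _) (sym (cong₂ _*_ (∑ᵛ-zero _) (∑ᵛ-zero _)))))
  ∑ᵛ-independent (suc k) [] E F =
    trans (cong (_* 1) (∑ᵛ-zero _)) (trans (*-identityʳ _) (trans (𝟙-∧ (E nothing) _) (sym (cong₂ _*_ (∑ᵛ-zero _) (∑ᵛ-zero _)))))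
  ∑ᵛ-independent zero {suc K} (f ∷ fs) E F = begin
    ∑ᵛ (suc K) (λ v → 𝟙 (E (at 0 (instantiate (f ∷ fs) v)) ∧ F (others 0 (instantiate (f ∷ fs) v)))) * M ^ suc K
      ≡⟨ cong (_* M ^ suc K) (trans (∑ᵛ-suc _) (∑-cong λ a → trans (∑ᵛ-cong λ v → 𝟙-∧ (e a) _) (∑ᵛ-*ˡ (𝟙 (e a)) _))) ⟩
    ∑[ a < M ] (𝟙 (e a) * c) * M ^ suc K
      ≡⟨ cong (_* M ^ suc K) (∑-*ʳ c (𝟙 ∘ e)) ⟩
    ∑[ a < M ] 𝟙 (e a) * c * (M * M ^ K)
      ≡⟨ eq (∑[ a < M ] 𝟙 (e a)) c M (M ^ K) ⟩
    (∑[ a < M ] 𝟙 (e a) * M ^ K) * (M * c)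
      ≡⟨ cong₂ _*_ (sym (∑-*ʳ (M ^ K) (𝟙 ∘ e))) (sym (∑-const M c)) ⟩
    ∑[ a < M ] (𝟙 (e a) * M ^ K) * ∑[ a < M ] c
      ≡⟨ cong₂ _*_ (trans (∑ᵛ-suc _) (∑-cong λ a → trans (∑ᵛ-const K (𝟙 (e a))) (*-comm (M ^ K) _))) (∑ᵛ-suc _) ⟨
    _ ∎
    where
    open ≡-Reasoning
    e : Fin M → Bool
    e a = E (just (f a))
    c = ∑ᵛ K (λ v → 𝟙 (F ([] , instantiate fs v)))
    eq : ∀ x c m w → x * c * (m * w) ≡ (x * w) * (m * c)
    eq = solve-∀
  ∑ᵛ-independent (suc k) {suc K} (f ∷ fs) E F = begin
    ∑ᵛ (suc K) (λ v → 𝟙 (E (at (suc k) (instantiate (f ∷ fs) v)) ∧ F (others (suc k) (instantiate (f ∷ fs) v)))) * M ^ suc K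
      ≡⟨ cong (_* M ^ suc K) (∑ᵛ-suc _) ⟩
    ∑[ a < M ] cEF a * (M * M ^ K)
      ≡⟨ eq (∑ M cEF) M (M ^ K) ⟩
    M * (∑[ a < M ] cEF a * M ^ K)
      ≡⟨ cong (M *_) (∑-*ʳ (M ^ K) cEF) ⟨
    M * ∑[ a < M ] (cEF a * M ^ K)
      -- For each fixed first draw, the first entry is absorbed into `F`.
      ≡⟨ cong (M *_) (∑-cong λ a → ∑ᵛ-independent k fs E (λ (xs , ys) → F (f a ∷ xs , ys))) ⟩
    M * ∑[ a < M ] (cE * cF a)
      ≡⟨ cong (M *_) (∑-*ˡ cE cF) ⟩
    M * (cE * ∑ M cF)
      ≡⟨ *-assoc M cE _ ⟨
    M * cE * ∑ M cF
      ≡⟨ cong₂ _*_ (trans (∑ᵛ-suc _) (∑-const M cE)) (∑ᵛ-suc _) ⟨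
    _ ∎
    where
    open ≡-Reasoning
    cEF cF : Fin M → ℕ
    cEF a = ∑ᵛ K (λ v → 𝟙 (E (at k (instantiate fs v)) ∧ F (f a ∷ take k (instantiate fs v) , drop (suc k) (instantiate fs v))))
    cF a = ∑ᵛ K (λ v → 𝟙 (F (f a ∷ take k (instantiate fs v) , drop (suc k) (instantiate fs v))))
    cE = ∑ᵛ K (λ v → 𝟙 (E (at k (instantiate fs v))))
    eq : ∀ x m w → x * (m * w) ≡ m * (x * w)
    eq = solve-∀

-- From randomized step lists to randomized branching programs

record Encoding (St : Set) (W : ℕ) : Set where
  field
    encode : St → Fin W
    decodeˢ : Fin W → St
    decode-encode : ∀ σ → decodeˢ (encode σ) ≡ σ

module Program {n d r W : ℕ} {St : Set} (enc : Encoding St W) (σ₀ : St) where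
  open Encoding enc

  layer : Step n d r St → Layer n d r W W
  layer s = record
    { query = λ _ → qry s
    ; next = λ u a → encode (nxt s (decodeˢ u) a)
    ; output = λ u a → out s (decodeˢ u) a
    }

  firstLayer : Step n d r St → Layer n d r 1 W
  firstLayer s = record
    { query = λ _ → qry s
    ; next = λ _ a → encode (nxt s σ₀ a)
    ; output = λ _ a → out s σ₀ a
    }

  innerLayers : (ss : List (Step n d r St)) → Layers n d r W (List.map (λ _ → W) ss)
  innerLayers [] = []
  innerLayers (s ∷ ss) = layer s ∷ innerLayers ss

  program : List (Step n d r St) → BranchingProgram n d r
  program [] = record { widths = [] ; layers = [] }
  program (s ∷ ss) = record { widths = W ∷ List.map (λ _ → W) ss ; layers = firstLayer s ∷ innerLayers ss }

  run-innerLayers : ∀ ss x σ → run (innerLayers ss) x (encode σ) ≡ runˢ ss x σ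
  run-innerLayers [] x σ = refl
  run-innerLayers (s ∷ ss) x σ rewrite decode-encode σ = cong (out s σ _ ∪_) (run-innerLayers ss x _)

  run-program : ∀ ss x → ⟦ program ss ⟧ x ≡ runˢ ss x σ₀
  run-program [] x = refl
  run-program (s ∷ ss) x = cong (out s σ₀ _ ∪_) (run-innerLayers ss x _)

  oblivious-innerLayers : ∀ ss → ObliviousLayers (innerLayers ss)
  oblivious-innerLayers [] = tt
  oblivious-innerLayers (s ∷ ss) = (λ _ _ → refl) , oblivious-innerLayers ss

  oblivious-program : ∀ ss → Oblivious (program ss)
  oblivious-program [] = tt
  oblivious-program (s ∷ ss) = (λ _ _ → refl) , oblivious-innerLayers ss

  time-program : ∀ ss → HasTime (program ss) (length ss)
  time-program [] = z≤n
  time-program (s ∷ ss) = s≤s (≤-reflexive (List.length-map _ ss))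

  space-program : ∀ ss {S} → W ≤ 2 ^ S → HasSpace (program ss) S
  space-program ss {S} W≤ = m^n>0 2 S ∷ widths≤ ss
    where
    inner : ∀ ss → All (_≤ 2 ^ S) (List.map (λ _ → W) ss)
    inner [] = []
    inner (s ∷ ss) = W≤ ∷ inner ss
    widths≤ : ∀ ss → All (_≤ 2 ^ S) (widths (program ss))
    widths≤ [] = []
    widths≤ (s ∷ ss) = W≤ ∷ inner ss

  private
    AnyLayer = ∃[ v ] ∃[ w ] Layer n d r v w

  layersOf : ∀ {A : Set} {K} → Vec (A → Step n d r St) K → Vec (A → AnyLayer) K
  layersOf [] = []
  layersOf (f ∷ fs) = (λ a → 1 , W , firstLayer (f a)) ∷ Vec.map (λ f a → W , W , layer (f a)) fs

  toList-innerLayers : ∀ {A : Set} {K} (fs : Vec (A → Step n d r St) K) v →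
    toList (innerLayers (instantiate fs v)) ≡ instantiate (Vec.map (λ f a → W , W , layer (f a)) fs) v
  toList-innerLayers [] [] = refl
  toList-innerLayers (f ∷ fs) (a ∷ v) = cong ((W , W , layer (f a)) ∷_) (toList-innerLayers fs v)

  toList-program : ∀ {A : Set} {K} (fs : Vec (A → Step n d r St) K) v →
    toList (layers (program (instantiate fs v))) ≡ instantiate (layersOf fs) v
  toList-program [] [] = refl
  toList-program (f ∷ fs) (a ∷ v) = cong ((1 , W , firstLayer (f a)) ∷_) (toList-innerLayers fs v)

module Randomized {n W : ℕ} {St : Set} (enc : Encoding St W) (σ₀ : St) (1<n : 1 < n)
                  {K : ℕ} (fs : Vec (Fin n → Step n n n St) K) where
  open Program {n} {n} {n} enc σ₀

  private
    instance
      M≢0 : NonZero (n ^ K)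
      M≢0 = m^n≢0 n K ⦃ >-nonZero (<-trans z<s 1<n) ⦄
    P : Vec (Fin n) K → BranchingProgram n n n
    P v = program (instantiate fs v)

  randomized : RandomizedBP n n n
  randomized = uniformᵈ (n ^ K) (P ∘ decode K)

  private
    Pr≡ : ∀ E → Pr randomized E ≡ frac (∑ᵛ K (λ v → 𝟙 (E (P v)))) (n ^ K)
    Pr≡ E = trans (Pr-uniformᵈ (n ^ K) (P ∘ decode K) E) (cong (λ c → frac c (n ^ K)) (∑-decode K (λ v → 𝟙 (E (P v)))))

  oneWay : OneWayRandomness randomized
  oneWay k E F = begin
    Pr randomized (λ Q → E (atᴾ Q) ∧ F (othersᴾ Q))                    ≡⟨ Pr≡ (λ Q → E (atᴾ Q) ∧ F (othersᴾ Q)) ⟩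
    frac cEF (n ^ K)                                                   ≡⟨ frac-cong cEF (n ^ K) (cE * cF) (n ^ K * n ^ K) ⦃ _ ⦄ ⦃ m*n≢0 (n ^ K) (n ^ K) ⦄ eq ⟩
    frac (cE * cF) (n ^ K * n ^ K) ⦃ m*n≢0 (n ^ K) (n ^ K) ⦄           ≡⟨ frac-* cE (n ^ K) cF (n ^ K) ⟨
    frac cE (n ^ K) ℚ.* frac cF (n ^ K)                                ≡⟨ cong₂ ℚ._*_ (Pr≡ (E ∘ atᴾ)) (Pr≡ (F ∘ othersᴾ)) ⟨
    Pr randomized (E ∘ atᴾ) ℚ.* Pr randomized (F ∘ othersᴾ)            ∎
    where
    open ≡-Reasoning
    atᴾ : BranchingProgram n n n → _
    atᴾ Q = List.head (drop k (toList (layers Q)))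
    othersᴾ : BranchingProgram n n n → _
    othersᴾ Q = take k (toList (layers Q)) , drop (suc k) (toList (layers Q))
    cEF = ∑ᵛ K (λ v → 𝟙 (E (atᴾ (P v)) ∧ F (othersᴾ (P v))))
    cE = ∑ᵛ K (λ v → 𝟙 (E (atᴾ (P v))))
    cF = ∑ᵛ K (λ v → 𝟙 (F (othersᴾ (P v))))
    gs = layersOf fs
    independent : cEF * n ^ K ≡ cE * cF
    independent = trans (cong (_* n ^ K) (∑ᵛ-cong λ v → cong (λ xs → 𝟙 (E (List.head (drop k xs)) ∧ F (take k xs , drop (suc k) xs))) (toList-program fs v)))
      (trans (∑ᵛ-independent k gs E F)
        (sym (cong₂ _*_ (∑ᵛ-cong λ v → cong (λ xs → 𝟙 (E (List.head (drop k xs)))) (toList-program fs v))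
                        (∑ᵛ-cong λ v → cong (λ xs → 𝟙 (F (take k xs , drop (suc k) xs))) (toList-program fs v)))))
    eq : cEF * (n ^ K * n ^ K) ≡ cE * cF * n ^ K
    eq = trans (sym (*-assoc cEF (n ^ K) (n ^ K))) (cong (_* n ^ K) independent)

  private
    _≟ᶠ_ = _≟ˢ_ {n} {n} {n}

  -- The hypothesis bounds the failure probability by 1/n, which is half of the error allowed.
  computesᴾ : ∀ (f : Vec (Fin n) n → Subset n) →
    (∀ x → n * ∑ᵛ K (λ v → 𝟙 (not (does (runˢ (instantiate fs v) x σ₀ ≟ᶠ f x)))) ≤ n ^ K) →
    ComputesWithProbability randomized (1-2/ n 1<n) f
  computesᴾ f rare x = begin
    1ℚ ℚ.- (ℤ.+ 2 ℚ./ n)                      ≡⟨ cong (λ q → 1ℚ ℚ.- q) (frac≡/ 2 n) ⟨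
    1ℚ ℚ.- 2/n                              ≤⟨ ℚ.+-monoˡ-≤ (ℚ.- 2/n) 1≤ ⟩
    (q ℚ.+ 2/n) ℚ.- 2/n                     ≡⟨ trans (ℚ.+-assoc q 2/n (ℚ.- 2/n)) (trans (cong (q ℚ.+_) (ℚ.+-inverseʳ 2/n)) (ℚ.+-identityʳ q)) ⟩
    q                                       ≡⟨ Pr≡ (λ Q → does (⟦ Q ⟧ x ≟ᶠ f x)) ⟨
    Pr randomized (λ Q → does (⟦ Q ⟧ x ≟ᶠ f x)) ∎
    where
    open ℚ.≤-Reasoning
    instance
      n≢0 : NonZero n
      n≢0 = >-nonZero (<-trans z<s 1<n)
    2/n = frac 2 n
    c = ∑ᵛ K (λ v → 𝟙 (does (⟦ P v ⟧ x ≟ᶠ f x)))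
    q = frac c (n ^ K)
    b = ∑ᵛ K (λ v → 𝟙 (not (does (runˢ (instantiate fs v) x σ₀ ≟ᶠ f x))))
    pt : ∀ v → 1 ≤ 𝟙 (does (⟦ P v ⟧ x ≟ᶠ f x)) + 𝟙 (not (does (runˢ (instantiate fs v) x σ₀ ≟ᶠ f x)))
    pt v rewrite run-program (instantiate fs v) x = ≤-reflexive (sym (𝟙+𝟙-not (does (runˢ (instantiate fs v) x σ₀ ≟ᶠ f x))))
    M≤ : n ^ K ≤ c + b
    M≤ = ≤-trans (≤-reflexive (sym (trans (∑ᵛ-const K 1) (*-identityʳ (n ^ K))))) (≤-trans (∑ᵛ-mono pt) (≤-reflexive (∑ᵛ-+ _ _)))
    count≤ : 1 * (n ^ K * n) ≤ (c * n + 2 * n ^ K) * 1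
    count≤ = ≤-trans (≤-reflexive (trans (+-identityʳ _) (*-comm (n ^ K) n))) (≤-trans (*-monoʳ-≤ n M≤)
      (≤-trans (≤-reflexive (trans (*-distribˡ-+ n c b) (cong (_+ n * b) (*-comm n c))))
      (≤-trans (+-monoʳ-≤ (c * n) (≤-trans (rare x) (m≤m+n (n ^ K) _))) (≤-reflexive (sym (*-identityʳ _))))))
    1≤ : 1ℚ ℚ.≤ q ℚ.+ 2/n
    1≤ = ℚ.≤-trans (ℚ.≤-reflexive 1≡frac) (ℚ.≤-trans
           (frac-mono 1 1 (c * n + 2 * n ^ K) (n ^ K * n) ⦃ _ ⦄ ⦃ m*n≢0 (n ^ K) n ⦄ count≤)
           (ℚ.≤-reflexive (sym (frac-+ c (n ^ K) 2 n))))

-- Polynomials modulo p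

𝟙-mono : ∀ {A B : Set} (A? : Dec A) (B? : Dec B) → (A → B) → 𝟙 (does A?) ≤ 𝟙 (does B?)
𝟙-mono (no _) _ _ = z≤n
𝟙-mono (yes a) B? f = ≤-reflexive (cong 𝟙 (sym (dec-true B? (f a))))

eval : ∀ {h} → Vec ℕ h → ℕ → ℕ
eval [] x = 0
eval (c ∷ cs) x = c + x * eval cs x

-- The quotient of the division by X - r.
deflate : ∀ {h} → Vec ℕ (suc h) → ℕ → Vec ℕ h
deflate {zero} (c ∷ []) r = []
deflate {suc h} (c ∷ cs) r = eval cs r ∷ deflate cs r

-- P(x) - P(r) = (x - r) Q(x), with both sides moved so that no subtraction occurs.
eval-deflate : ∀ {h} (P : Vec ℕ (suc h)) r x →
               eval P x + r * eval (deflate P r) x ≡ eval P r + x * eval (deflate P r) x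
eval-deflate {zero} (c ∷ []) r x = eq c x r
  where
  eq : ∀ c x r → c + x * 0 + r * 0 ≡ c + r * 0 + x * 0
  eq = solve-∀
eval-deflate {suc h} (c ∷ cs) r x = begin
  c + x * eval cs x + r * (eval cs r + x * q)      ≡⟨ eq₁ c x (eval cs x) r (eval cs r) q ⟩
  c + x * (eval cs x + r * q) + r * eval cs r      ≡⟨ cong (λ z → c + x * z + r * eval cs r) (eval-deflate cs r x) ⟩
  c + x * (eval cs r + x * q) + r * eval cs r      ≡⟨ eq₂ c x r (eval cs r) q ⟩
  c + r * eval cs r + x * (eval cs r + x * q)      ∎
  where
  open ≡-Reasoning
  q = eval (deflate cs r) x
  eq₁ : ∀ c x a r b q → c + x * a + r * (b + x * q) ≡ c + x * (a + r * q) + r * b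
  eq₁ = solve-∀
  eq₂ : ∀ c x r b q → c + x * (b + x * q) + r * b ≡ c + r * b + x * (b + x * q)
  eq₂ = solve-∀

-- The coefficients of the quotient are the values at `r` of the tails of `P`. If they vanish mod p,
-- then so does the constant term, and the tail has the root `r` again.
deflate-∣ : ∀ {p h} (P : Vec ℕ (suc h)) r → p ∣ eval P r → (∀ i → p ∣ lookup (deflate P r) i) → ∀ i → p ∣ lookup P i
deflate-∣ {p} {zero} (c ∷ []) r root _ zero = ∣m+n∣n⇒∣m c root (subst (p ∣_) (sym (*-zeroʳ r)) (p ∣0))
deflate-∣ {h = suc h} (c ∷ cs) r root all zero = ∣m+n∣n⇒∣m c root (∣n⇒∣m*n r (all zero))
deflate-∣ {h = suc h} (c ∷ cs) r root all (suc i) = deflate-∣ cs r (all zero) (all ∘ suc) i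

module _ {p : ℕ} (prime : Prime p) where
  private
    instance
      p≢0 : NonZero p
      p≢0 = prime⇒nonZero prime

  roots : ∀ {h} → Vec ℕ h → ℕ
  roots P = ∑[ x < p ] 𝟙 (does (p ∣? eval P (toℕ x)))

  -- p divides (x - r) Q(x) but not x - r, as 0 < |x - r| < p. There are two cases because
  -- subtraction is truncated.
  root-deflate : ∀ {h} (P : Vec ℕ (suc h)) {r x} → r < p → x < p → r ≢ x →
                 p ∣ eval P r → p ∣ eval P x → p ∣ eval (deflate P r) x
  root-deflate P {r} {x} r<p x<p r≢x p∣r p∣x with ≤-total r x
  ... | inj₁ r≤x = conclude (euclidsLemma (x ∸ r) q prime (∣m+n∣m⇒∣n (subst (p ∣_) eq p∣x) p∣r))
    where
    q = eval (deflate P r) x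
    eq : eval P x ≡ eval P r + (x ∸ r) * q
    eq = +-cancelʳ-≡ (r * q) _ _ (begin
      eval P x + r * q                       ≡⟨ eval-deflate P r x ⟩
      eval P r + x * q                       ≡⟨ cong (λ z → eval P r + z * q) (m∸n+n≡m r≤x) ⟨
      eval P r + (x ∸ r + r) * q             ≡⟨ cong (eval P r +_) (*-distribʳ-+ q (x ∸ r) r) ⟩
      eval P r + ((x ∸ r) * q + r * q)       ≡⟨ +-assoc (eval P r) _ _ ⟨
      eval P r + (x ∸ r) * q + r * q         ∎)
      where open ≡-Reasoning
    conclude : _ → p ∣ q
    conclude (inj₂ p∣q) = p∣q
    conclude (inj₁ p∣d) = contradiction p∣d (>⇒∤ ⦃ >-nonZero (m<n⇒0<n∸m (≤∧≢⇒< r≤x r≢x)) ⦄ (≤-<-trans (m∸n≤m x r) x<p))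
  ... | inj₂ x≤r = conclude (euclidsLemma (r ∸ x) q prime (∣m+n∣m⇒∣n (subst (p ∣_) eq p∣r) p∣x))
    where
    q = eval (deflate P r) x
    eq : eval P r ≡ eval P x + (r ∸ x) * q
    eq = +-cancelʳ-≡ (x * q) _ _ (begin
      eval P r + x * q                       ≡⟨ eval-deflate P r x ⟨
      eval P x + r * q                       ≡⟨ cong (λ z → eval P x + z * q) (m∸n+n≡m x≤r) ⟨
      eval P x + (r ∸ x + x) * q             ≡⟨ cong (eval P x +_) (*-distribʳ-+ q (r ∸ x) x) ⟩
      eval P x + ((r ∸ x) * q + x * q)       ≡⟨ +-assoc (eval P x) _ _ ⟨
      eval P x + (r ∸ x) * q + x * q         ∎)
      where open ≡-Reasoning
    conclude : _ → p ∣ q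
    conclude (inj₂ p∣q) = p∣q
    conclude (inj₁ p∣d) = contradiction p∣d (>⇒∤ ⦃ >-nonZero (m<n⇒0<n∸m (≤∧≢⇒< x≤r (r≢x ∘ sym))) ⦄ (≤-<-trans (m∸n≤m r x) r<p))

  -- Lagrange's bound on the number of roots, read backwards: dividing by a root loses one
  -- coefficient and at most that one root.
  many-roots : ∀ {h} (P : Vec ℕ h) → h ≤ roots P → ∀ i → p ∣ lookup P i
  many-roots {suc h} P h≤ = deflate-∣ P (toℕ r) p∣r (many-roots (deflate P (toℕ r)) (≤-pred (begin
    suc h                                                                          ≤⟨ h≤ ⟩
    roots P                                                                        ≤⟨ ∑-mono pt ⟩
    ∑[ x < p ] (𝟙 (does (x Fin.≟ r)) + 𝟙 (does (p ∣? eval Q (toℕ x))))             ≡⟨ ∑-+ _ _ ⟩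
    ∑[ x < p ] 𝟙 (does (x Fin.≟ r)) + roots Q                                      ≡⟨ cong (_+ roots Q) (∑-δ₁ r) ⟩
    suc (roots Q)                                                                  ∎)))
    where
    open ≤-Reasoning
    found = pigeonhole-≥ {p} (λ x → 𝟙 (does (p ∣? eval P (toℕ x)))) z<s (≤-trans (s≤s z≤n) h≤)
    r = proj₁ found
    p∣r : p ∣ eval P (toℕ r)
    p∣r = 𝟙-does⇒ p (p ∣? eval P (toℕ r)) (proj₂ found)
    Q = deflate P (toℕ r)
    pt : ∀ x → 𝟙 (does (p ∣? eval P (toℕ x))) ≤ 𝟙 (does (x Fin.≟ r)) + 𝟙 (does (p ∣? eval Q (toℕ x)))
    pt x with x Fin.≟ r
    ... | yes _ = ≤-trans (𝟙≤1 _) (m≤m+n 1 _)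
    ... | no x≢r = 𝟙-mono (p ∣? eval P (toℕ x)) (p ∣? eval Q (toℕ x)) λ p∣x →
      root-deflate P (Fin.toℕ<n r) (Fin.toℕ<n x) (λ eq → x≢r (Fin.toℕ-injective (sym eq))) p∣r p∣x

  eval-% : ∀ {h} (P : Vec ℕ h) i x → ∃[ t ] eval P (p * i + x) ≡ eval P x + p * t
  eval-% [] i x = 0 , sym (*-zeroʳ p)
  eval-% (c ∷ cs) i x with t , eq ← eval-% cs i x = i * (e + p * t) + x * t , (begin
    c + (p * i + x) * eval cs (p * i + x)      ≡⟨ cong (λ z → c + (p * i + x) * z) eq ⟩
    c + (p * i + x) * (e + p * t)              ≡⟨ eq′ c p i x e t ⟩
    c + x * e + p * (i * (e + p * t) + x * t)  ∎)
    where
    open ≡-Reasoning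
    e = eval cs x
    eq′ : ∀ c p i x e t → c + (p * i + x) * (e + p * t) ≡ c + x * e + p * (i * (e + p * t) + x * t)
    eq′ = solve-∀

  -- A nonzero polynomial of degree below h then vanishes on at most half of the residues.
  module _ {h : ℕ} (2h≤ : 2 * h ≤ suc p) where

    few-roots : ∀ {n} → p ∣ n → (P : Vec ℕ h) → ∀ i → ¬ p ∣ lookup P i →
                2 * ∑[ d < n ] 𝟙 (does (p ∣? eval P (toℕ d))) ≤ n
    few-roots (divides-refl k) P i p∤ = begin
      -- As p divides n, the n evaluation points hit each residue exactly `k` times.
      2 * ∑[ d < k * p ] 𝟙 (does (p ∣? eval P (toℕ d)))                              ≡⟨ cong (2 *_) (∑-combine k _) ⟩
      2 * ∑[ i < k ] ∑[ j < p ] 𝟙 (does (p ∣? eval P (toℕ (combine i j))))           ≤⟨ *-monoʳ-≤ 2 (∑-mono λ i → ∑-mono λ j → pt i j) ⟩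
      2 * ∑[ i < k ] roots P                                                         ≡⟨ cong (2 *_) (∑-const k (roots P)) ⟩
      2 * (k * roots P)                                                              ≡⟨ eq k (roots P) ⟩
      k * (2 * roots P)                                                              ≤⟨ *-monoʳ-≤ k (≤-pred (≤-trans (≤-trans (n≤1+n _) (≤-trans (≤-reflexive (eq′ (roots P))) (*-monoʳ-≤ 2 roots<h))) 2h≤)) ⟩
      k * p                                                                          ∎
      where
      open ≤-Reasoning
      eq : ∀ k z → 2 * (k * z) ≡ k * (2 * z)
      eq = solve-∀
      eq′ : ∀ z → 2 + 2 * z ≡ 2 * suc z
      eq′ = solve-∀
      roots<h : roots P < h
      roots<h = ≰⇒> λ h≤ → p∤ (many-roots P h≤ i)
      pt : ∀ i j → 𝟙 (does (p ∣? eval P (toℕ (combine {k} i j)))) ≤ 𝟙 (does (p ∣? eval P (toℕ j)))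
      pt i j = 𝟙-mono (p ∣? _) (p ∣? _) λ p∣ → ∣m+n∣n⇒∣m (eval P (toℕ j))
        (subst (p ∣_) (trans (cong (eval P) (Fin.toℕ-combine i j)) (proj₂ (eval-% P (toℕ i) (toℕ j)))) p∣) (m∣m*n _)

    eval₂ : (Fin h → Fin h → ℕ) → ℕ → ℕ → ℕ
    eval₂ m α β = eval (tabulate λ i → eval (tabulate (m i)) β) α

    -- The Schwartz-Zippel argument: row `i` vanishes for at most half of the β; for every other β
    -- the polynomial in α is nonzero and vanishes for at most half of the α. Hence the share 1/2 +
    -- 1/4 = 3/4.
    few-roots₂ : ∀ {n} → p ∣ n → ∀ (m : Fin h → Fin h → ℕ) i j → ¬ p ∣ m i j →
                 4 * ∑[ β < n ] ∑[ α < n ] 𝟙 (does (p ∣? eval₂ m (toℕ α) (toℕ β))) ≤ 3 * (n * n)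
    few-roots₂ {n} p∣n m i j p∤ = begin
      4 * ∑[ β < n ] ∑[ α < n ] 𝟙 (does (p ∣? eval₂ m (toℕ α) (toℕ β)))            ≡⟨ *-assoc 2 2 (∑[ β < n ] ∑[ α < n ] 𝟙 (does (p ∣? eval₂ m (toℕ α) (toℕ β)))) ⟩
      2 * (2 * ∑[ β < n ] ∑[ α < n ] 𝟙 (does (p ∣? eval₂ m (toℕ α) (toℕ β))))      ≡⟨ cong (2 *_) (∑-*ˡ 2 _) ⟨
      2 * ∑[ β < n ] (2 * ∑[ α < n ] 𝟙 (does (p ∣? eval₂ m (toℕ α) (toℕ β))))      ≤⟨ *-monoʳ-≤ 2 (∑-mono given-β) ⟩
      2 * ∑[ β < n ] (n + n * bad β)                                               ≡⟨ cong (2 *_) (∑-+ (λ _ → n) _) ⟩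
      2 * (∑[ β < n ] n + ∑[ β < n ] (n * bad β))                                  ≡⟨ cong (2 *_) (cong₂ _+_ (∑-const n n) (∑-*ˡ n bad)) ⟩
      2 * (n * n + n * ∑ n bad)                                                    ≡⟨ eq n (∑ n bad) ⟩
      2 * (n * n) + n * (2 * ∑ n bad)                                              ≤⟨ +-monoʳ-≤ (2 * (n * n)) (*-monoʳ-≤ n (few-roots p∣n (tabulate (m i)) j (p∤ ∘ subst (p ∣_) (Vec.lookup∘tabulate (m i) j)))) ⟩
      2 * (n * n) + n * n                                                          ≡⟨ +-comm (2 * (n * n)) (n * n) ⟩
      3 * (n * n)                                                                  ∎
      where
      open ≤-Reasoning
      bad : Fin n → ℕ
      bad β = 𝟙 (does (p ∣? eval (tabulate (m i)) (toℕ β)))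
      eq : ∀ n b → 2 * (n * n + n * b) ≡ 2 * (n * n) + n * (2 * b)
      eq = solve-∀
      2n≡ : 2 * n ≡ n + n * 1
      2n≡ = trans (cong (n +_) (+-identityʳ n)) (cong (n +_) (sym (*-identityʳ n)))
      row : Fin n → Fin h → ℕ
      row β i = eval (tabulate (m i)) (toℕ β)
      given-β : ∀ β → 2 * ∑[ α < n ] 𝟙 (does (p ∣? eval₂ m (toℕ α) (toℕ β))) ≤ n + n * bad β
      given-β β with p ∣? eval (tabulate (m i)) (toℕ β)
      ... | yes _ = ≤-trans (*-monoʳ-≤ 2 (≤-trans (∑-mono {g = λ _ → 1} λ α → 𝟙≤1 _) (≤-reflexive (trans (∑-const n 1) (*-identityʳ n))))) (≤-reflexive 2n≡)
      ... | no p∤β = ≤-trans (few-roots p∣n (tabulate (row β)) i (p∤β ∘ subst (p ∣_) (Vec.lookup∘tabulate (row β) i))) (m≤m+n n _)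

opaque
  unfolding ∑

  eval-tabulate : ∀ {h} (f : Fin h → ℕ) x → eval (tabulate f) x ≡ ∑[ i < h ] (f i * x ^ toℕ i)
  eval-tabulate {zero} f x = refl
  eval-tabulate {suc h} f x = cong₂ _+_ (sym (*-identityʳ (f zero)))
    (trans (cong (x *_) (eval-tabulate (f ∘ suc) x)) (trans (sym (∑-*ˡ x (λ i → f (suc i) * x ^ toℕ i))) (∑-cong {h} λ i → eq x (f (suc i)) (x ^ toℕ i))))
    where
    eq : ∀ x a b → x * (a * b) ≡ a * (x * b)
    eq = solve-∀

-- Random machines and their survival

module _ {n d r : ℕ} {St : Set} where

  run-++ : ∀ (ss ts : List (Step n d r St)) x σ → runˢ (ss List.++ ts) x σ ≡ runˢ ss x σ ∪ runˢ ts x (endˢ ss x σ)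
  run-++ [] ts x σ = sym (∪-identityˡ _)
  run-++ (s ∷ ss) ts x σ = trans (cong (out s σ _ ∪_) (run-++ ss ts x _)) (sym (∪-assoc (out s σ (lookup x (qry s))) _ _))

  end-++ : ∀ (ss ts : List (Step n d r St)) x σ → endˢ (ss List.++ ts) x σ ≡ endˢ ts x (endˢ ss x σ)
  end-++ [] ts x σ = refl
  end-++ (s ∷ ss) ts x σ = end-++ ss ts x _

instantiate-++ : ∀ {A X : Set} {K L} (fs : Vec (A → X) K) (gs : Vec (A → X) L) u w →
                 instantiate (fs ++ gs) (u ++ w) ≡ instantiate fs u List.++ instantiate gs w
instantiate-++ [] gs [] w = refl
instantiate-++ (f ∷ fs) gs (a ∷ u) w = cong (f a ∷_) (instantiate-++ fs gs u w)

module Machine {n : ℕ} where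

  -- While verifying the promise, r₁ and r₂ hold the evaluation point (β, α) and r₃ the partial
  -- fingerprint modulo p; while enumerating, r₁ is the least element not yet decided and r₂ the
  -- least sampled value ≥ r₁ (n if there is none).
  record State : Set where
    constructor state
    field
      alive : Bool
      r₁ r₂ r₃ : Fin (suc n)
  open State public

  RStep : Set
  RStep = Fin n → Step n n n State

  Silent : RStep → Set
  Silent f = ∀ d σ a → out (f d) σ a ≡ ⊥

  -- Truncation takes effect only for the successor of an empty sample, n + 1, which becomes n and
  -- so marks the enumeration as finished.
  clamp : ℕ → Fin (suc n)
  clamp m = fromℕ< (s≤s (m⊓n≤n m n))

  toℕ-clamp : ∀ {m} → m ≤ n → toℕ (clamp m) ≡ m
  toℕ-clamp m≤n = trans (Fin.toℕ-fromℕ< _) (m≤n⇒m⊓n≡m m≤n)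

  run-silent : ∀ {K} {fs : Vec RStep K} → Allᵛ Silent fs → ∀ v x σ → runˢ (instantiate fs v) x σ ≡ ⊥
  run-silent [] [] x σ = refl
  run-silent (s ∷ ps) (a ∷ v) x σ = trans (cong₂ _∪_ (s a σ _) (run-silent ps v x _)) (∪-identityˡ ⊥)

  module _ (x : Vec (Fin n) n) where

    end : ∀ {K} → Vec RStep K → Vec (Fin n) K → State → State
    end fs v σ = endˢ (instantiate fs v) x σ

    end-++ᵛ : ∀ {K L} (fs : Vec RStep K) (gs : Vec RStep L) u w σ → end (fs ++ gs) (u ++ w) σ ≡ end gs w (end fs u σ)
    end-++ᵛ fs gs u w σ = trans (cong (λ ss → endˢ ss x σ) (instantiate-++ fs gs u w)) (end-++ (instantiate fs u) _ x σ)

    -- The program fs ends alive with probability at most c/d, and never when started dead.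
    record Survival {K} (fs : Vec RStep K) (c d : ℕ) : Set where
      constructor survival
      field
        bound : ∀ σ → d * ∑ᵛ K (λ v → 𝟙 (alive (end fs v σ))) ≤ c * 𝟙 (alive σ) * n ^ K
    open Survival public

    -- The state after `fs` depends on its draws, but the bound for `gs` holds from every state and
    -- its draws are fresh, so the probabilities multiply.
    survival-++ : ∀ {K L} {fs : Vec RStep K} {gs : Vec RStep L} {c d c′ d′} →
                  Survival fs c d → Survival gs c′ d′ → Survival (fs ++ gs) (c * c′) (d * d′)
    survival-++ {K} {L} {fs} {gs} {c} {d} {c′} {d′} S S′ = survival λ σ → begin
      d * d′ * ∑ᵛ (K + L) (λ v → 𝟙 (alive (end (fs ++ gs) v σ)))
        ≡⟨ cong (d * d′ *_) (trans (∑ᵛ-++ K _) (∑ᵛ-cong λ u → ∑ᵛ-cong λ w → cong (𝟙 ∘ alive) (end-++ᵛ fs gs u w σ))) ⟩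
      d * d′ * ∑ᵛ K (λ u → ∑ᵛ L (λ w → 𝟙 (alive (end gs w (end fs u σ)))))
        ≡⟨ trans (*-assoc d d′ _) (cong (d *_) (sym (∑ᵛ-*ˡ d′ _))) ⟩
      d * ∑ᵛ K (λ u → d′ * ∑ᵛ L (λ w → 𝟙 (alive (end gs w (end fs u σ)))))
        ≤⟨ *-monoʳ-≤ d (∑ᵛ-mono λ u → bound S′ (end fs u σ)) ⟩
      d * ∑ᵛ K (λ u → c′ * 𝟙 (alive (end fs u σ)) * n ^ L)
        ≡⟨ cong (d *_) (trans (∑ᵛ-cong λ u → eq₁ c′ (𝟙 (alive (end fs u σ))) (n ^ L)) (∑ᵛ-*ˡ (c′ * n ^ L) _)) ⟩
      d * (c′ * n ^ L * ∑ᵛ K (λ u → 𝟙 (alive (end fs u σ))))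
        ≡⟨ eq₂ d (c′ * n ^ L) _ ⟩
      c′ * n ^ L * (d * ∑ᵛ K (λ u → 𝟙 (alive (end fs u σ))))
        ≤⟨ *-monoʳ-≤ (c′ * n ^ L) (bound S σ) ⟩
      c′ * n ^ L * (c * 𝟙 (alive σ) * n ^ K)
        ≡⟨ eq₃ c′ (n ^ L) c (𝟙 (alive σ)) (n ^ K) ⟩
      c * c′ * 𝟙 (alive σ) * (n ^ K * n ^ L)
        ≡⟨ cong (c * c′ * 𝟙 (alive σ) *_) (^-distribˡ-+-* n K L) ⟨
      c * c′ * 𝟙 (alive σ) * n ^ (K + L) ∎
      where
      open ≤-Reasoning
      eq₁ : ∀ a b c → a * b * c ≡ a * c * b
      eq₁ = solve-∀
      eq₂ : ∀ a b c → a * (b * c) ≡ b * (a * c)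
      eq₂ = solve-∀
      eq₃ : ∀ a b c d e → a * b * (c * d * e) ≡ c * a * d * (e * b)
      eq₃ = solve-∀

    survival-[] : Survival [] 1 1
    survival-[] = survival λ σ → ≤-reflexive (trans (*-identityˡ _) (trans (∑ᵛ-zero _) (sym (trans (*-identityʳ _) (*-identityˡ (𝟙 (alive σ)))))))

    survival-mono : ∀ {K} (fs : Vec RStep K) → (∀ v σ → 𝟙 (alive (end fs v σ)) ≤ 𝟙 (alive σ)) → Survival fs 1 1
    survival-mono {K} fs h = survival λ σ → begin
      1 * ∑ᵛ K (λ v → 𝟙 (alive (end fs v σ)))   ≡⟨ *-identityˡ _ ⟩
      ∑ᵛ K (λ v → 𝟙 (alive (end fs v σ)))       ≤⟨ ∑ᵛ-mono (λ v → h v σ) ⟩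
      ∑ᵛ K (λ v → 𝟙 (alive σ))                  ≡⟨ ∑ᵛ-const K _ ⟩
      n ^ K * 𝟙 (alive σ)                       ≡⟨ trans (*-comm (n ^ K) _) (cong (_* n ^ K) (sym (*-identityˡ (𝟙 (alive σ))))) ⟩
      1 * 𝟙 (alive σ) * n ^ K                   ∎
      where open ≤-Reasoning

    survival-replicate : ∀ {K} {fs : Vec RStep K} {c d} R → Survival fs c d → Survival (Vec.concat (Vec.replicate R fs)) (c ^ R) (d ^ R)
    survival-replicate zero S = survival-[]
    survival-replicate (suc R) S = survival-++ S (survival-replicate R S)

    survival-concat₁ : ∀ {B K} (fss : Vec (Vec RStep K) B) → (∀ i → Survival (lookup fss i) 1 1) → Survival (Vec.concat fss) 1 1
    survival-concat₁ [] h = survival-[]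
    survival-concat₁ (fs ∷ fss) h = survival-++ (h zero) (survival-concat₁ fss (h ∘ suc))

    -- One block that detects the violation suffices, since no other block can revive a dead run.
    survival-concat : ∀ {B K c d} (fss : Vec (Vec RStep K) B) → (∀ i → Survival (lookup fss i) 1 1) →
                      ∀ i → Survival (lookup fss i) c d → Survival (Vec.concat fss) c d
    survival-concat {c = c} {d} (fs ∷ fss) h zero S =
      subst₂ (Survival (fs ++ Vec.concat fss)) (*-identityʳ c) (*-identityʳ d) (survival-++ S (survival-concat₁ fss (h ∘ suc)))
    survival-concat {c = c} {d} (fs ∷ fss) h (suc i) S =
      subst₂ (Survival (fs ++ Vec.concat fss)) (*-identityˡ c) (*-identityˡ d) (survival-++ (h zero) (survival-concat fss (h ∘ suc) i S))

    Preserves : ∀ {K} → Vec RStep K → Set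
    Preserves fs = ∀ v σ → alive (end fs v σ) ≡ alive σ

    preserves-concat : ∀ {B K} (fss : Vec (Vec RStep K) B) → (∀ i → Preserves (lookup fss i)) → Preserves (Vec.concat fss)
    preserves-concat [] h [] σ = refl
    preserves-concat {K = K} (fs ∷ fss) h v σ with u , w , refl ← Vec.splitAt K v =
      trans (cong alive (end-++ᵛ fs (Vec.concat fss) u w σ)) (trans (preserves-concat fss (h ∘ suc) w _) (h zero u σ))

  -- Fingerprints of the multiplicities modulo p

  module Fingerprint {p : ℕ} (prime : Prime p) (p∣n : p ∣ n) (1<n : 1 < n) {h : ℕ} (2h≤ : 2 * h ≤ suc p)
                     (A : Fin n → ℕ) (B₁ B₂ : Fin n → Fin h)
                     (injective : ∀ c c′ → A c ≡ A c′ → B₁ c ≡ B₁ c′ → B₂ c ≡ B₂ c′ → c ≡ c′) where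
    private
      instance
        p≢0 : NonZero p
        p≢0 = prime⇒nonZero prime
        n≢0 : NonZero n
        n≢0 = >-nonZero (<-trans z<s 1<n)
      p≤n : p ≤ n
      p≤n = ∣⇒≤ p∣n
      c₀ : Fin n
      c₀ = fromℕ< 1<n

    term : ℕ → ℕ → ℕ → Fin n → ℕ
    term a β α c = 𝟙 (does (A c ≟ a)) * (β ^ toℕ (B₂ c) * α ^ toℕ (B₁ c))

    -- Every layer has to query an index and receives a draw. These three query `c₀` and discard its
    -- value.
    drawβ drawα check : RStep
    drawβ d = record { qry = c₀ ; nxt = λ σ _ → record σ { r₁ = inject₁ d } ; out = λ _ _ → ⊥ }
    drawα d = record { qry = c₀ ; nxt = λ σ _ → record σ { r₂ = inject₁ d ; r₃ = zero } ; out = λ _ _ → ⊥ }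
    check d = record { qry = c₀ ; nxt = λ σ _ → record σ { alive = alive σ ∧ does (toℕ (r₃ σ) % p ≟ 0) } ; out = λ _ _ → ⊥ }

    scan : ℕ → Fin n → RStep
    scan a i d = record
      { qry = i
      ; nxt = λ σ c → record σ { r₃ = clamp ((toℕ (r₃ σ) + term a (toℕ (r₁ σ)) (toℕ (r₂ σ)) c) % p) }
      ; out = λ _ _ → ⊥ }

    round : ℕ → Vec RStep (2 + (n + 1))
    round a = drawβ ∷ drawα ∷ tabulate (scan a) ++ check ∷ []

    silent-round : ∀ a → Allᵛ Silent (round a)
    silent-round a = (λ _ _ _ → refl) ∷ (λ _ _ _ → refl) ∷ Allᵛ.++⁺ (Allᵛ.tabulate⁺ λ i _ _ _ → refl) ((λ _ _ _ → refl) ∷ [])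

    module _ (x : Vec (Fin n) n) where

      fingerprint : ℕ → ℕ → ℕ → ℕ
      fingerprint a β α = ∑[ i < n ] term a β α (lookup x i)

      -- `g` lists the indices still to be read, for the induction. Reducing mod p after each
      -- addition keeps `r₃` within its register and preserves the final residue.
      alive-scan : ∀ a {k} (g : Fin k → Fin n) v σ →
        alive (end x (tabulate (scan a ∘ g) ++ check ∷ []) v σ) ≡
        alive σ ∧ does ((toℕ (r₃ σ) + ∑[ i < k ] term a (toℕ (r₁ σ)) (toℕ (r₂ σ)) (lookup x (g i))) % p ≟ 0)
      alive-scan a {zero} g (d ∷ []) σ = cong (λ z → alive σ ∧ does (z % p ≟ 0)) (sym (trans (cong (toℕ (r₃ σ) +_) (∑-zero _)) (+-identityʳ _)))
      alive-scan a {suc k} g (d ∷ v) σ = trans (alive-scan a (g ∘ suc) v _) (cong (λ z → alive σ ∧ does (z ≟ 0)) (begin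
        (toℕ (clamp ((toℕ (r₃ σ) + t) % p)) + s) % p     ≡⟨ cong (λ z → (z + s) % p) (toℕ-clamp (≤-trans (<⇒≤ (m%n<n (toℕ (r₃ σ) + t) p)) p≤n)) ⟩
        ((toℕ (r₃ σ) + t) % p + s) % p                   ≡⟨ %-distribˡ-+ ((toℕ (r₃ σ) + t) % p) s p ⟩
        ((toℕ (r₃ σ) + t) % p % p + s % p) % p           ≡⟨ cong (λ z → (z + s % p) % p) (m%n%n≡m%n (toℕ (r₃ σ) + t) p) ⟩
        ((toℕ (r₃ σ) + t) % p + s % p) % p               ≡⟨ %-distribˡ-+ (toℕ (r₃ σ) + t) s p ⟨
        (toℕ (r₃ σ) + t + s) % p                         ≡⟨ cong (_% p) (trans (+-assoc (toℕ (r₃ σ)) t s) (cong (toℕ (r₃ σ) +_) (sym (∑-suc _)))) ⟩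
        (toℕ (r₃ σ) + ∑[ i < suc k ] term a (toℕ (r₁ σ)) (toℕ (r₂ σ)) (lookup x (g i))) % p ∎))
        where
        open ≡-Reasoning
        t = term a (toℕ (r₁ σ)) (toℕ (r₂ σ)) (lookup x (g zero))
        s = ∑[ i < k ] term a (toℕ (r₁ σ)) (toℕ (r₂ σ)) (lookup x (g (suc i)))

      alive-round : ∀ a β α v σ → alive (end x (round a) (β ∷ α ∷ v) σ) ≡ alive σ ∧ does (fingerprint a (toℕ β) (toℕ α) % p ≟ 0)
      alive-round a β α v σ = trans (alive-scan a id v _)
        (cong₂ (λ y z → alive σ ∧ does (fingerprint a y z % p ≟ 0)) (Fin.toℕ-inject₁ β) (Fin.toℕ-inject₁ α))

      survival-round₁ : ∀ a → Survival x (round a) 1 1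
      survival-round₁ a = survival-mono x (round a) λ { (β ∷ α ∷ v) σ → ≤-trans (≤-reflexive (cong 𝟙 (alive-round a β α v σ))) (le (alive σ) _) }
        where
        le : ∀ b c → 𝟙 (b ∧ c) ≤ 𝟙 b
        le true c = 𝟙≤1 c
        le false c = z≤n

      -- Linearity in the multiplicities makes the test one-sided: under the promise the fingerprint
      -- is 0 mod p at every point.
      fingerprint-counts : ∀ a β α → fingerprint a β α ≡ ∑[ c < n ] (count (c Fin.≟_) x * term a β α c)
      fingerprint-counts a β α = trans (∑-fibres (lookup x) (term a β α)) (∑-cong λ c → cong (_* term a β α c) (sym (count≡∑ (c Fin.≟_) x)))

      preserves-round : (∀ c → p ∣ count (c Fin.≟_) x) → ∀ a → Preserves x (round a)
      preserves-round ok a (β ∷ α ∷ v) σ = trans (alive-round a β α v σ) (trans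
        (cong (alive σ ∧_) (dec-true (fingerprint a (toℕ β) (toℕ α) % p ≟ 0)
          (n∣m⇒m%n≡0 (fingerprint a (toℕ β) (toℕ α)) p (subst (p ∣_) (sym (fingerprint-counts a (toℕ β) (toℕ α))) (∣-∑ λ c → ∣m⇒∣m*n (term a (toℕ β) (toℕ α) c) (ok c))))))
        (∧-identityʳ (alive σ)))

      -- The coefficient matrix of block `a`. As a sum of products of indicators it also covers
      -- positions to which no element belongs, and its sums collapse by `∑-δ`.
      multiplicity : ℕ → Fin h → Fin h → ℕ
      multiplicity a b₁ b₂ = ∑[ i < n ] (𝟙 (does (b₁ Fin.≟ B₁ (lookup x i))) * (𝟙 (does (b₂ Fin.≟ B₂ (lookup x i))) * 𝟙 (does (A (lookup x i) ≟ a))))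

      eval₂-multiplicity : ∀ a β α → eval₂ prime 2h≤ (multiplicity a) α β ≡ fingerprint a β α
      eval₂-multiplicity a β α = begin
        eval₂ prime 2h≤ (multiplicity a) α β
          ≡⟨ trans (eval-tabulate _ α) (∑-cong λ b₁ → cong (_* α ^ toℕ b₁) (eval-tabulate (multiplicity a b₁) β)) ⟩
        ∑[ b₁ < h ] ((∑[ b₂ < h ] (multiplicity a b₁ b₂ * β ^ toℕ b₂)) * α ^ toℕ b₁)
          ≡⟨ ∑-cong (λ b₁ → cong (_* α ^ toℕ b₁) (trans (∑-cong λ b₂ → sym (∑-*ʳ (β ^ toℕ b₂) _)) (∑-swap (λ b₂ i → I₁ b₁ i * (I₂ b₂ i * I₃ i) * β ^ toℕ b₂)))) ⟩
        ∑[ b₁ < h ] ((∑[ i < n ] ∑[ b₂ < h ] (I₁ b₁ i * (I₂ b₂ i * I₃ i) * β ^ toℕ b₂)) * α ^ toℕ b₁)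
          ≡⟨ ∑-cong (λ b₁ → cong (_* α ^ toℕ b₁) (∑-cong λ i → trans (∑-cong λ b₂ → eq₁ (I₁ b₁ i) (I₂ b₂ i) (I₃ i) (β ^ toℕ b₂)) (trans (∑-*ˡ (I₁ b₁ i * I₃ i) _) (cong (I₁ b₁ i * I₃ i *_) (∑-δ (B₂ (lookup x i)) (λ b₂ → β ^ toℕ b₂)))))) ⟩
        ∑[ b₁ < h ] ((∑[ i < n ] (I₁ b₁ i * I₃ i * β ^ E₂ i)) * α ^ toℕ b₁)
          ≡⟨ trans (∑-cong λ b₁ → sym (∑-*ʳ (α ^ toℕ b₁) _)) (∑-swap (λ b₁ i → I₁ b₁ i * I₃ i * β ^ E₂ i * α ^ toℕ b₁)) ⟩
        ∑[ i < n ] ∑[ b₁ < h ] (I₁ b₁ i * I₃ i * β ^ E₂ i * α ^ toℕ b₁)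
          ≡⟨ ∑-cong (λ i → trans (∑-cong λ b₁ → eq₂ (I₁ b₁ i) (I₃ i) (β ^ E₂ i) (α ^ toℕ b₁)) (∑-δ (B₁ (lookup x i)) (λ b₁ → I₃ i * (β ^ E₂ i * α ^ toℕ b₁)))) ⟩
        fingerprint a β α ∎
        where
        open ≡-Reasoning
        I₁ I₂ : Fin h → Fin n → ℕ
        I₁ b i = 𝟙 (does (b Fin.≟ B₁ (lookup x i)))
        I₂ b i = 𝟙 (does (b Fin.≟ B₂ (lookup x i)))
        I₃ E₂ : Fin n → ℕ
        I₃ i = 𝟙 (does (A (lookup x i) ≟ a))
        E₂ i = toℕ (B₂ (lookup x i))
        eq₁ : ∀ a b c d → a * (b * c) * d ≡ a * c * (b * d)
        eq₁ = solve-∀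
        eq₂ : ∀ a b c d → a * b * c * d ≡ a * (b * (c * d))
        eq₂ = solve-∀

      multiplicity-count : ∀ c → multiplicity (A c) (B₁ c) (B₂ c) ≡ count (c Fin.≟_) x
      multiplicity-count c = trans (∑-cong pt) (sym (count≡∑ (c Fin.≟_) x))
        where
        pt′ : ∀ c′ (d₁ : Dec (B₁ c ≡ B₁ c′)) (d₂ : Dec (B₂ c ≡ B₂ c′)) (d₃ : Dec (A c′ ≡ A c)) →
              𝟙 (does d₁) * (𝟙 (does d₂) * 𝟙 (does d₃)) ≡ 𝟙 (does (c Fin.≟ c′))
        pt′ c′ (yes e₁) (yes e₂) (yes e₃) = cong 𝟙 (sym (dec-true (c Fin.≟ c′) (injective c c′ (sym e₃) e₁ e₂)))
        pt′ c′ (no e₁) _ _ = cong 𝟙 (sym (dec-false (c Fin.≟ c′) λ { refl → e₁ refl }))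
        pt′ c′ (yes _) (no e₂) _ = cong 𝟙 (sym (dec-false (c Fin.≟ c′) λ { refl → e₂ refl }))
        pt′ c′ (yes _) (yes _) (no e₃) = cong 𝟙 (sym (dec-false (c Fin.≟ c′) λ { refl → e₃ refl }))
        pt : ∀ i → _ ≡ 𝟙 (does (c Fin.≟ lookup x i))
        pt i = pt′ (lookup x i) (B₁ c Fin.≟ B₁ (lookup x i)) (B₂ c Fin.≟ B₂ (lookup x i)) (A (lookup x i) ≟ A c)

      survival-round : ∀ c → ¬ p ∣ count (c Fin.≟_) x → Survival x (round (A c)) 3 4
      survival-round c p∤ = survival λ σ → begin
        4 * ∑ᵛ (2 + (n + 1)) (λ v → 𝟙 (alive (end x (round (A c)) v σ)))
          ≡⟨ cong (4 *_) (trans (∑ᵛ-suc _) (∑-cong λ β → ∑ᵛ-suc _)) ⟩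
        4 * ∑[ β < n ] ∑[ α < n ] ∑ᵛ (n + 1) (λ v → 𝟙 (alive (end x (round (A c)) (β ∷ α ∷ v) σ)))
          ≡⟨ cong (4 *_) (∑-cong λ β → ∑-cong λ α → trans (∑ᵛ-cong λ v → cong 𝟙 (alive-round (A c) β α v σ)) (∑ᵛ-const (n + 1) _)) ⟩
        4 * ∑[ β < n ] ∑[ α < n ] (w * 𝟙 (alive σ ∧ does (fingerprint (A c) (toℕ β) (toℕ α) % p ≟ 0)))
          ≤⟨ *-monoʳ-≤ 4 (∑-mono λ β → ∑-mono λ α → *-monoʳ-≤ w (≤-trans (≤-reflexive (𝟙-∧ (alive σ) _)) (*-monoʳ-≤ (𝟙 (alive σ)) (root β α)))) ⟩
        4 * ∑[ β < n ] ∑[ α < n ] (w * (𝟙 (alive σ) * Z β α))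
          ≡⟨ cong (4 *_) (trans (∑-cong λ β → trans (∑-*ˡ w _) (cong (w *_) (∑-*ˡ (𝟙 (alive σ)) (Z β)))) (trans (∑-*ˡ w _) (cong (w *_) (∑-*ˡ (𝟙 (alive σ)) (λ β → ∑ n (Z β)))))) ⟩
        4 * (w * (𝟙 (alive σ) * ∑[ β < n ] ∑[ α < n ] Z β α))
          ≡⟨ eq₁ w (𝟙 (alive σ)) _ ⟩
        w * (𝟙 (alive σ) * (4 * ∑[ β < n ] ∑[ α < n ] Z β α))
          ≤⟨ *-monoʳ-≤ w (*-monoʳ-≤ (𝟙 (alive σ)) (few-roots₂ prime 2h≤ p∣n (multiplicity (A c)) (B₁ c) (B₂ c) (p∤ ∘ subst (p ∣_) (multiplicity-count c)))) ⟩
        w * (𝟙 (alive σ) * (3 * (n * n)))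
          ≡⟨ eq₂ w (𝟙 (alive σ)) n ⟩
        3 * 𝟙 (alive σ) * (n * (n * w)) ∎
        where
        open ≤-Reasoning
        w = n ^ (n + 1)
        Z : Fin n → Fin n → ℕ
        Z β α = 𝟙 (does (p ∣? eval₂ prime 2h≤ (multiplicity (A c)) (toℕ α) (toℕ β)))
        root : ∀ β α → 𝟙 (does (fingerprint (A c) (toℕ β) (toℕ α) % p ≟ 0)) ≤ Z β α
        root β α = 𝟙-mono (fingerprint (A c) (toℕ β) (toℕ α) % p ≟ 0) (p ∣? _) λ eq →
          subst (p ∣_) (sym (eval₂-multiplicity (A c) (toℕ β) (toℕ α))) (m%n≡0⇒n∣m (fingerprint (A c) (toℕ β) (toℕ α)) p eq)
        eq₁ : ∀ w b z → 4 * (w * (b * z)) ≡ w * (b * (4 * z))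
        eq₁ = solve-∀
        eq₂ : ∀ w b n → w * (b * (3 * (n * n))) ≡ 3 * b * (n * (n * w))
        eq₂ = solve-∀

-- Enumeration of the non-occurring elements

pick : ∀ {P Q X : Set} → Dec P → Dec Q → X → X → X
pick (yes _) (yes _) a b = a
pick (yes _) (no _) a b = b
pick (no _) _ a b = b

excluded : ∀ {A : Set} (A? : Dec A) o → (A → o ≢ true) → does A? ∧ true ∨ false ≡ does A? ∧ not o
excluded (no _) o _ = refl
excluded (yes _) false _ = refl
excluded (yes a) true h = contradiction refl (h a)

𝟙-∧-mono : ∀ {A B : Set} (A? : Dec A) (B? : Dec B) o → (A → B) → 𝟙 (does A? ∧ o) ≤ 𝟙 (does B? ∧ o)
𝟙-∧-mono (no _) _ _ _ = z≤n
𝟙-∧-mono (yes a) B? o f = ≤-reflexive (cong (λ b → 𝟙 (b ∧ o)) (sym (dec-true B? (f a))))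

module Enumerate {n : ℕ} (1<n : 1 < n) where
  open Machine {n}

  private
    c₀ : Fin n
    c₀ = fromℕ< 1<n

  interval : ℕ → ℕ → Subset n
  interval lo hi = tabulate λ c → does (lo ≤? toℕ c) ∧ does (toℕ c <? hi)

  reset sample emit : RStep
  reset d = record { qry = c₀ ; nxt = λ σ _ → record σ { r₁ = zero ; r₂ = clamp n } ; out = λ _ _ → ⊥ }
  sample d = record
    -- The queried index is the draw itself, shared by all states, so the layer is oblivious.
    { qry = d
    ; nxt = λ σ c → record σ { r₂ = pick (toℕ (r₁ σ) ≤? toℕ c) (toℕ c <? toℕ (r₂ σ)) (inject₁ c) (r₂ σ) }
    ; out = λ _ _ → ⊥ }
  emit d = record
    { qry = c₀
    -- `r₂` itself occurs, so the next gap starts right after it.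
    ; nxt = λ σ _ → record σ { r₁ = clamp (suc (toℕ (r₂ σ))) ; r₂ = clamp n }
    ; out = λ σ _ → if alive σ then interval (toℕ (r₁ σ)) (toℕ (r₂ σ)) else ⊥ }

  sweepsLength : ℕ → ℕ → ℕ
  sweepsLength m zero = 0
  sweepsLength m (suc j) = m + suc (sweepsLength m j)

  sweeps : ∀ m j → Vec RStep (sweepsLength m j)
  sweeps m zero = []
  sweeps m (suc j) = Vec.replicate m sample ++ emit ∷ sweeps m j

  module _ (x : Vec (Fin n) n) where

    -- `P` is the set of indices queried. `attained` holds whatever was drawn, so a sweep can
    -- overlook an occurring element but never stop at a non-occurring one below n.
    record Sampled (σ σ′ : State) (P : Fin n → Set) : Set where
      field
        alive≡ : alive σ′ ≡ alive σ
        r₁≡ : r₁ σ′ ≡ r₁ σ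
        r₂≤ : toℕ (r₂ σ′) ≤ toℕ (r₂ σ)
        minimal : ∀ d → P d → toℕ (r₁ σ) ≤ toℕ (lookup x d) → toℕ (r₂ σ′) ≤ toℕ (lookup x d)
        attained : r₂ σ′ ≡ r₂ σ ⊎ (∃[ d ] toℕ (r₂ σ′) ≡ toℕ (lookup x d) × toℕ (r₁ σ) ≤ toℕ (lookup x d))
    open Sampled

    sample-spec : ∀ d σ → Sampled σ (nxt (sample d) σ (lookup x d)) (λ d′ → d′ ≡ d)
    sample-spec d σ with toℕ (r₁ σ) ≤? toℕ (lookup x d) | toℕ (lookup x d) <? toℕ (r₂ σ)
    ... | yes lo≤ | yes <hi = record
      { alive≡ = refl ; r₁≡ = refl
      ; r₂≤ = ≤-trans (≤-reflexive (Fin.toℕ-inject₁ _)) (<⇒≤ <hi)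
      ; minimal = λ { _ refl _ → ≤-reflexive (Fin.toℕ-inject₁ _) }
      ; attained = inj₂ (d , Fin.toℕ-inject₁ _ , lo≤) }
    ... | yes lo≤ | no ≮hi = record
      { alive≡ = refl ; r₁≡ = refl ; r₂≤ = ≤-refl ; minimal = λ { _ refl _ → ≮⇒≥ ≮hi } ; attained = inj₁ refl }
    ... | no lo≰ | _ = record
      { alive≡ = refl ; r₁≡ = refl ; r₂≤ = ≤-refl ; minimal = λ { _ refl lo≤ → contradiction lo≤ lo≰ } ; attained = inj₁ refl }

    samples-spec : ∀ {m} (v : Vec (Fin n) m) σ →
                   Sampled σ (end x (Vec.replicate m sample) v σ) (λ d → ∃[ i ] d ≡ lookup v i)
    samples-spec [] σ = record { alive≡ = refl ; r₁≡ = refl ; r₂≤ = ≤-refl ; minimal = λ { _ (() , _) } ; attained = inj₁ refl }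
    samples-spec {suc m} (d ∷ v) σ = record
      { alive≡ = trans (alive≡ S) (alive≡ S₁)
      ; r₁≡ = trans (r₁≡ S) (r₁≡ S₁)
      ; r₂≤ = ≤-trans (r₂≤ S) (r₂≤ S₁)
      ; minimal = λ { d′ (zero , eq) lo≤ → ≤-trans (r₂≤ S) (minimal S₁ d′ eq lo≤)
                    ; d′ (suc i , eq) lo≤ → minimal S d′ (i , eq) (subst (λ r → toℕ r ≤ _) (sym (r₁≡ S₁)) lo≤) }
      ; attained = attains (attained S) (attained S₁)
      }
      where
      σ₁ = nxt (sample d) σ (lookup x d)
      S₁ = sample-spec d σ
      S = samples-spec v σ₁
      attains : (r₂ (end x (Vec.replicate m sample) v σ₁) ≡ r₂ σ₁ ⊎ _) → (r₂ σ₁ ≡ r₂ σ ⊎ _) → _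
      attains (inj₁ e) (inj₁ e₁) = inj₁ (trans e e₁)
      attains (inj₁ e) (inj₂ (d , e₁ , lo≤)) = inj₂ (d , trans (cong toℕ e) e₁ , lo≤)
      attains (inj₂ (d , e , lo≤)) _ = inj₂ (d , e , subst (λ r → toℕ r ≤ _) (r₁≡ S₁) lo≤)

    misses : ∀ {m} → Vec (Fin n) m → Fin n → Bool
    misses v c = occurs x c ∧ allᵇ (λ d → not (does (c Fin.≟ lookup x d))) v

    bad : ∀ {m} → Vec (Fin n) m → Bool
    bad v = does (Fin.any? λ c → misses v c ≟ᵇ true)

    ¬allᵇ⇒hit : ∀ {m} c (v : Vec (Fin n) m) → allᵇ (λ d → not (does (c Fin.≟ lookup x d))) v ≢ true →
                ∃[ i ] c ≡ lookup x (lookup v i)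
    ¬allᵇ⇒hit c [] h = contradiction refl h
    ¬allᵇ⇒hit c (d ∷ v) h with c Fin.≟ lookup x d
    ... | yes eq = zero , eq
    ... | no _ with i , eq ← ¬allᵇ⇒hit c v h = suc i , eq

    hit : ∀ {m} (v : Vec (Fin n) m) → bad v ≡ false → ∀ c → occurs x c ≡ true → ∃[ i ] c ≡ lookup x (lookup v i)
    hit v good c occ with Fin.any? (λ c → misses v c ≟ᵇ true)
    ... | no none = ¬allᵇ⇒hit c v λ all → none (c , cong₂ _∧_ occ all)

    -- Union bound over the elements: n misses of probability n⁻³ each.
    ∑-bad : ∀ m → (∀ c → occurs x c ≡ true → n * (n * n) * (∑[ d < n ] 𝟙 (not (does (c Fin.≟ lookup x d)))) ^ m ≤ n ^ m) →
            n * n * ∑ᵛ m (λ v → 𝟙 (bad v)) ≤ n ^ m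
    ∑-bad m rare = *-cancelˡ-≤ n ⦃ >-nonZero (<-trans z<s 1<n) ⦄ (begin
      n * (n * n * ∑ᵛ m (λ v → 𝟙 (bad v)))                        ≡⟨ *-assoc n (n * n) _ ⟨
      n * (n * n) * ∑ᵛ m (λ v → 𝟙 (bad v))                        ≤⟨ *-monoʳ-≤ (n * (n * n)) (∑ᵛ-mono bad≤) ⟩
      n * (n * n) * ∑ᵛ m (λ v → ∑[ c < n ] 𝟙 (misses v c))        ≡⟨ trans (cong (n * (n * n) *_) (∑ᵛ-sum _)) (sym (∑-*ˡ (n * (n * n)) _)) ⟩
      ∑[ c < n ] (n * (n * n) * ∑ᵛ m (λ v → 𝟙 (misses v c)))      ≤⟨ ∑-mono each ⟩
      ∑[ c < n ] (n ^ m)                                          ≡⟨ ∑-const n _ ⟩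
      n * n ^ m                                                   ∎)
      where
      open ≤-Reasoning
      bad≤ : ∀ v → 𝟙 (bad v) ≤ ∑[ c < n ] 𝟙 (misses v c)
      bad≤ v with Fin.any? (λ c → misses v c ≟ᵇ true)
      ... | no _ = z≤n
      ... | yes (c , eq) = ≤-trans (≤-reflexive (sym (cong 𝟙 eq))) (term≤∑ (λ c → 𝟙 (misses v c)) c)
      each : ∀ c → n * (n * n) * ∑ᵛ m (λ v → 𝟙 (misses v c)) ≤ n ^ m
      each c with occurs x c in occ
      ... | true = ≤-trans (≤-reflexive (cong (n * (n * n) *_) (∑ᵛ-allᵇ m _))) (rare c occ)
      ... | false = ≤-trans (≤-reflexive (trans (cong (n * (n * n) *_) (trans (∑ᵛ-const m 0) (*-zeroʳ (n ^ m)))) (*-zeroʳ (n * (n * n))))) z≤n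

    target : ℕ → Subset n
    target lo = tabulate λ c → does (lo ≤? toℕ c) ∧ not (occurs x c)

    -- The number of sweeps that suffice to reach lo = n.
    measure : ℕ → ℕ
    measure lo = ∑[ c < n ] 𝟙 (does (lo ≤? toℕ c) ∧ occurs x c) + 𝟙 (does (lo <? n))

    -- A sweep that missed nothing: `b` is the least occurring element from `lo` on, or n if there
    -- is none.
    module Sweep (lo b : ℕ) (lo≤b : lo ≤ b) (b≤n : b ≤ n)
                (minimal : ∀ c → occurs x c ≡ true → lo ≤ toℕ c → b ≤ toℕ c)
                (attained : b < n → ∃[ c ] occurs x c ≡ true × b ≡ toℕ c) where

      private
        b′ = toℕ (clamp (suc b))
        b′≡ : b < n → b′ ≡ suc b
        b′≡ = toℕ-clamp
        b′≥ : ∀ {c} → c ≤ b → c < n → c < b′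
        b′≥ c≤b c<n = subst (_ <_) (sym (Fin.toℕ-fromℕ< _)) (⊓-glb (s≤s c≤b) c<n)
        b′≤ : b′ ≤ suc b
        b′≤ = ≤-trans (≤-reflexive (Fin.toℕ-fromℕ< _)) (m⊓n≤m (suc b) n)

        occurs-b : ∀ c → toℕ c ≡ b → occurs x c ≡ true
        occurs-b c c≡b with c′ , occ′ , eq ← attained (subst (_< n) c≡b (Fin.toℕ<n c)) =
          subst (λ z → occurs x z ≡ true) (Fin.toℕ-injective (trans (sym eq) (sym c≡b))) occ′

      emitted : ∀ c → does (lo ≤? toℕ c) ∧ does (toℕ c <? b) ∨ does (b′ ≤? toℕ c) ∧ not (occurs x c)
                      ≡ does (lo ≤? toℕ c) ∧ not (occurs x c)
      emitted c with <-cmp (toℕ c) b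
      ... | tri< c<b _ _
        rewrite dec-true (toℕ c <? b) c<b
              | dec-false (b′ ≤? toℕ c) (<⇒≱ (b′≥ (<⇒≤ c<b) (Fin.toℕ<n c)))
        = excluded (lo ≤? toℕ c) (occurs x c) λ lo≤c occ → <⇒≱ c<b (minimal c occ lo≤c)
      emitted c | tri≈ _ c≡b _
        rewrite dec-false (toℕ c <? b) (≤⇒≯ (≤-reflexive (sym c≡b)))
              | dec-false (b′ ≤? toℕ c) (<⇒≱ (b′≥ (≤-reflexive c≡b) (Fin.toℕ<n c)))
              | occurs-b c c≡b | ∧-zeroʳ (does (lo ≤? toℕ c))
        = refl
      emitted c | tri> _ _ c>b
        rewrite dec-false (toℕ c <? b) (<-asym c>b)
              | dec-true (b′ ≤? toℕ c) (≤-trans b′≤ c>b)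
              | dec-true (lo ≤? toℕ c) (≤-trans lo≤b (<⇒≤ c>b))
        = refl

      emit-target : interval lo b ∪ target b′ ≡ target lo
      emit-target = subset-ext λ c → begin
        lookup (interval lo b ∪ target b′) c                     ≡⟨ lookup-∪ (interval lo b) (target b′) c ⟩
        lookup (interval lo b) c ∨ lookup (target b′) c          ≡⟨ cong₂ _∨_ (Vec.lookup∘tabulate _ c) (Vec.lookup∘tabulate _ c) ⟩
        _                                                        ≡⟨ emitted c ⟩
        _                                                        ≡⟨ Vec.lookup∘tabulate _ c ⟨
        lookup (target lo) c                                     ∎
        where open ≡-Reasoning

      -- If b < n, then `b` itself leaves the count of occurring elements. The second summand of
      -- `measure` pays for the last sweep, which outputs the gap after the greatest occurring
      -- element.
      measure-step : ∀ {j} → measure lo ≤ suc j → measure b′ ≤ j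
      measure-step {j} h with b <? n
      ... | no b≮n = ≤-trans (≤-reflexive measure≡0) z≤n
        where
        b′≡n : b′ ≡ n
        b′≡n = trans (Fin.toℕ-fromℕ< _) (m≥n⇒m⊓n≡n (≤-trans (≮⇒≥ b≮n) (n≤1+n b)))
        pt : ∀ c → 𝟙 (does (b′ ≤? toℕ c) ∧ occurs x c) ≡ 0
        pt c = cong (λ z → 𝟙 (z ∧ occurs x c)) (dec-false (b′ ≤? toℕ c) (<⇒≱ (subst (toℕ c <_) (sym b′≡n) (Fin.toℕ<n c))))
        measure≡0 : measure b′ ≡ 0
        measure≡0 = cong₂ _+_ (trans (∑-cong pt) (∑-0 n)) (cong 𝟙 (dec-false (b′ <? n) (≤⇒≯ (≤-reflexive (sym b′≡n)))))
      ... | yes b<n = ≤-pred (begin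
        suc (measure b′)
          ≡⟨ cong (λ z → suc (∑[ c < n ] 𝟙 (does (z ≤? toℕ c) ∧ occurs x c) + 𝟙 (does (z <? n)))) (b′≡ b<n) ⟩
        suc (∑[ c < n ] 𝟙 (does (suc b ≤? toℕ c) ∧ occurs x c) + 𝟙 (does (suc b <? n)))
          ≡⟨ cong (λ z → z + ∑[ c < n ] 𝟙 (does (suc b ≤? toℕ c) ∧ occurs x c) + 𝟙 (does (suc b <? n))) (∑-δ₁ c*) ⟨
        ∑[ c < n ] 𝟙 (does (c Fin.≟ c*)) + ∑[ c < n ] 𝟙 (does (suc b ≤? toℕ c) ∧ occurs x c) + 𝟙 (does (suc b <? n))
          ≡⟨ cong (_+ 𝟙 (does (suc b <? n))) (∑-+ _ _) ⟨
        ∑[ c < n ] (𝟙 (does (c Fin.≟ c*)) + 𝟙 (does (suc b ≤? toℕ c) ∧ occurs x c)) + 𝟙 (does (suc b <? n))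
          ≤⟨ +-mono-≤ (∑-mono pt) (≤-trans (𝟙≤1 (does (suc b <? n))) (≤-reflexive (cong 𝟙 (sym (dec-true (lo <? n) (≤-<-trans lo≤b b<n)))))) ⟩
        measure lo
          ≤⟨ h ⟩
        suc j ∎)
        where
        open ≤-Reasoning
        c* = proj₁ (attained b<n)
        occ* = proj₁ (proj₂ (attained b<n))
        b≡ = proj₂ (proj₂ (attained b<n))
        pt : ∀ c → 𝟙 (does (c Fin.≟ c*)) + 𝟙 (does (suc b ≤? toℕ c) ∧ occurs x c) ≤ 𝟙 (does (lo ≤? toℕ c) ∧ occurs x c)
        pt c with c Fin.≟ c*
        ... | yes refl rewrite dec-false (suc b ≤? toℕ c) (<⇒≱ (s≤s (≤-reflexive (sym b≡))))
                             | dec-true (lo ≤? toℕ c) (≤-trans lo≤b (≤-reflexive b≡)) | occ* = ≤-refl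
        ... | no _ = 𝟙-∧-mono (suc b ≤? toℕ c) (lo ≤? toℕ c) (occurs x c) λ b<c → ≤-trans lo≤b (<⇒≤ b<c)

    silent-samples : ∀ m → Allᵛ Silent (Vec.replicate m sample)
    silent-samples zero = []
    silent-samples (suc m) = (λ _ _ _ → refl) ∷ silent-samples m

    private
      _≟ᶠ_ = _≟ˢ_ {n} {n} {n}

    swept : ∀ m j → Vec (Fin n) (sweepsLength m j) → State → Subset n
    swept m j v σ = runˢ (instantiate (sweeps m j) v) x σ

    wrong : ∀ m j → State → Vec (Fin n) (sweepsLength m j) → ℕ
    wrong m j σ v = 𝟙 (not (does (swept m j v σ ≟ᶠ target (toℕ (r₁ σ)))))

    swept-suc : ∀ m j u d w σ → swept m (suc j) (u ++ d ∷ w) σ ≡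
                 let σ′ = end x (Vec.replicate m sample) u σ in
                 (if alive σ′ then interval (toℕ (r₁ σ′)) (toℕ (r₂ σ′)) else ⊥) ∪ swept m j w (nxt (emit d) σ′ (lookup x c₀))
    swept-suc m j u d w σ = begin
      runˢ (instantiate (Vec.replicate m sample ++ emit ∷ sweeps m j) (u ++ d ∷ w)) x σ   ≡⟨ cong (λ ss → runˢ ss x σ) (instantiate-++ (Vec.replicate m sample) (emit ∷ sweeps m j) u (d ∷ w)) ⟩
      _                                                                                  ≡⟨ run-++ (instantiate (Vec.replicate m sample) u) (instantiate (emit ∷ sweeps m j) (d ∷ w)) x σ ⟩
      _                                                                                  ≡⟨ cong (_∪ runˢ (instantiate (emit ∷ sweeps m j) (d ∷ w)) x (end x (Vec.replicate m sample) u σ)) (run-silent (silent-samples m) u x σ) ⟩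
      _                                                                                  ≡⟨ ∪-identityˡ _ ⟩
      _                                                                                  ∎
      where open ≡-Reasoning

    good-sweep : ∀ m j σ u d w → alive σ ≡ true → toℕ (r₂ σ) ≡ n → bad u ≡ false →
                 let σ′ = nxt (emit d) (end x (Vec.replicate m sample) u σ) (lookup x c₀) in
                 alive σ′ ≡ true × toℕ (r₂ σ′) ≡ n
                 × (measure (toℕ (r₁ σ)) ≤ suc j → measure (toℕ (r₁ σ′)) ≤ j)
                 × (swept m j w σ′ ≡ target (toℕ (r₁ σ′)) → swept m (suc j) (u ++ d ∷ w) σ ≡ target (toℕ (r₁ σ)))
    good-sweep m j σ u d w live r₂≡n good = trans (alive≡ S) live , toℕ-clamp ≤-refl , measure-step , correct
      where
      S = samples-spec u σ
      σ₁ = end x (Vec.replicate m sample) u σ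
      lo = toℕ (r₁ σ)
      lo≤n : lo ≤ n
      lo≤n = ≤-pred (Fin.toℕ<n (r₁ σ))
      σ′ = nxt (emit d) σ₁ (lookup x c₀)
      lo≤ : (r₂ σ₁ ≡ r₂ σ ⊎ (∃[ d ] toℕ (r₂ σ₁) ≡ toℕ (lookup x d) × lo ≤ toℕ (lookup x d))) → lo ≤ toℕ (r₂ σ₁)
      lo≤ (inj₁ e) = ≤-trans lo≤n (≤-reflexive (sym (trans (cong toℕ e) r₂≡n)))
      lo≤ (inj₂ (d , e , le)) = ≤-trans le (≤-reflexive (sym e))
      min : ∀ c → occurs x c ≡ true → lo ≤ toℕ c → toℕ (r₂ σ₁) ≤ toℕ c
      min c occ le with i , refl ← hit u good c occ = minimal S (lookup u i) (i , refl) le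
      att : (r₂ σ₁ ≡ r₂ σ ⊎ (∃[ d ] toℕ (r₂ σ₁) ≡ toℕ (lookup x d) × lo ≤ toℕ (lookup x d))) →
            toℕ (r₂ σ₁) < n → ∃[ c ] occurs x c ≡ true × toℕ (r₂ σ₁) ≡ toℕ c
      att (inj₁ e) lt = contradiction (trans (cong toℕ e) r₂≡n) (<⇒≢ lt)
      att (inj₂ (d , e , _)) _ = lookup x d , occurs-lookup x d , e
      open Sweep lo (toℕ (r₂ σ₁)) (lo≤ (attained S)) (≤-pred (Fin.toℕ<n (r₂ σ₁))) min (att (attained S))
      correct : swept m j w σ′ ≡ target (toℕ (r₁ σ′)) → swept m (suc j) (u ++ d ∷ w) σ ≡ target lo
      correct eq = begin
        swept m (suc j) (u ++ d ∷ w) σ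
          ≡⟨ swept-suc m j u d w σ ⟩
        (if alive σ₁ then interval (toℕ (r₁ σ₁)) (toℕ (r₂ σ₁)) else ⊥) ∪ swept m j w σ′
          ≡⟨ cong₂ _∪_ (cong₂ (λ a r → if a then interval (toℕ r) (toℕ (r₂ σ₁)) else ⊥) (trans (alive≡ S) live) (r₁≡ S)) eq ⟩
        interval lo (toℕ (r₂ σ₁)) ∪ target (toℕ (r₁ σ′))
          ≡⟨ emit-target ⟩
        target lo ∎
        where open ≡-Reasoning

    -- Union bound over the sweeps by induction: the first one is bad with probability at most n⁻²;
    -- otherwise it restores the hypotheses with a smaller measure, and the remaining draws are
    -- fresh.
    ∑-wrong : ∀ m → n * n * ∑ᵛ m (λ v → 𝟙 (bad v)) ≤ n ^ m →
              ∀ j σ → alive σ ≡ true → toℕ (r₂ σ) ≡ n → measure (toℕ (r₁ σ)) ≤ j →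
              n * n * ∑ᵛ (sweepsLength m j) (wrong m j σ) ≤ j * n ^ sweepsLength m j
    ∑-wrong m rare zero σ live r₂≡n meas = ≤-reflexive (trans (cong (n * n *_) (trans (∑ᵛ-zero _) wrong≡0)) (*-zeroʳ (n * n)))
      where
      lo≮n : ¬ toℕ (r₁ σ) < n
      lo≮n lt = contradiction (≤-trans (≤-trans (≤-reflexive (cong 𝟙 (sym (dec-true (toℕ (r₁ σ) <? n) lt)))) (m≤n+m _ _)) meas) λ ()
      target≡⊥ : ⊥ ≡ target (toℕ (r₁ σ))
      target≡⊥ = subset-ext λ c → trans (lookup-⊥ c) (sym (trans (Vec.lookup∘tabulate _ c)
        (cong (_∧ not (occurs x c)) (dec-false (toℕ (r₁ σ) ≤? toℕ c) λ le → lo≮n (≤-<-trans le (Fin.toℕ<n c))))))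
      wrong≡0 : wrong m zero σ [] ≡ 0
      wrong≡0 = cong (𝟙 ∘ not) (dec-true (⊥ ≟ᶠ target (toℕ (r₁ σ))) target≡⊥)
    ∑-wrong m rare (suc j) σ live r₂≡n meas = begin
      n * n * ∑ᵛ (m + suc L) (wrong m (suc j) σ)
        ≡⟨ cong (n * n *_) (trans (∑ᵛ-++ m _) (∑ᵛ-cong λ u → ∑ᵛ-suc _)) ⟩
      n * n * ∑ᵛ m (λ u → ∑[ d < n ] ∑ᵛ L (λ w → wrong m (suc j) σ (u ++ d ∷ w)))
        ≡⟨ ∑ᵛ-*ˡ (n * n) _ ⟨
      ∑ᵛ m (λ u → n * n * ∑[ d < n ] ∑ᵛ L (λ w → wrong m (suc j) σ (u ++ d ∷ w)))
        ≡⟨ ∑ᵛ-cong (λ u → ∑-*ˡ (n * n) _) ⟨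
      ∑ᵛ m (λ u → ∑[ d < n ] (n * n * ∑ᵛ L (λ w → wrong m (suc j) σ (u ++ d ∷ w))))
        ≤⟨ ∑ᵛ-mono (λ u → ∑-mono λ d → given u d) ⟩
      ∑ᵛ m (λ u → ∑[ d < n ] ((n * n * 𝟙 (bad u) + j) * n ^ L))
        ≡⟨ ∑ᵛ-cong (λ u → trans (∑-const n _) (eq₁ n (n * n) (𝟙 (bad u)) j (n ^ L))) ⟩
      ∑ᵛ m (λ u → n ^ suc L * (n * n * 𝟙 (bad u) + j))
        ≡⟨ trans (∑ᵛ-*ˡ (n ^ suc L) _) (cong (n ^ suc L *_) (trans (∑ᵛ-+ _ _) (cong₂ _+_ (∑ᵛ-*ˡ (n * n) _) (∑ᵛ-const m j)))) ⟩
      n ^ suc L * (n * n * ∑ᵛ m (λ u → 𝟙 (bad u)) + n ^ m * j)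
        ≤⟨ *-monoʳ-≤ (n ^ suc L) (+-monoˡ-≤ (n ^ m * j) rare) ⟩
      n ^ suc L * (n ^ m + n ^ m * j)
        ≡⟨ eq₂ (n ^ suc L) (n ^ m) j ⟩
      suc j * (n ^ m * n ^ suc L)
        ≡⟨ cong (suc j *_) (^-distribˡ-+-* n m (suc L)) ⟨
      suc j * n ^ (m + suc L) ∎
      where
      open ≤-Reasoning
      L = sweepsLength m j
      eq₁ : ∀ n q b j w → n * ((q * b + j) * w) ≡ n * w * (q * b + j)
      eq₁ = solve-∀
      eq₂ : ∀ a b j → a * (b + b * j) ≡ suc j * (b * a)
      eq₂ = solve-∀
      all≤ : ∀ {f : Vec (Fin n) L → ℕ} → (∀ w → f w ≤ 1) → n * n * ∑ᵛ L f ≤ (n * n * 1 + j) * n ^ L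
      all≤ h = ≤-trans (*-monoʳ-≤ (n * n) (∑ᵛ-1 h)) (*-monoˡ-≤ (n ^ L) (≤-trans (≤-reflexive (sym (*-identityʳ (n * n)))) (m≤m+n _ j)))
      given : ∀ u d → n * n * ∑ᵛ L (λ w → wrong m (suc j) σ (u ++ d ∷ w)) ≤ (n * n * 𝟙 (bad u) + j) * n ^ L
      given u d with bad u in good
      ... | true = all≤ λ w → 𝟙≤1 _
      ... | false = begin
        n * n * ∑ᵛ L (λ w → wrong m (suc j) σ (u ++ d ∷ w))     ≤⟨ *-monoʳ-≤ (n * n) (∑ᵛ-mono better) ⟩
        n * n * ∑ᵛ L (wrong m j σ′)                             ≤⟨ ∑-wrong m rare j σ′ (proj₁ G) (proj₁ (proj₂ G)) (proj₁ (proj₂ (proj₂ G)) meas) ⟩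
        j * n ^ L                                               ≡⟨ cong (λ z → (z + j) * n ^ L) (*-zeroʳ (n * n)) ⟨
        (n * n * 0 + j) * n ^ L                                 ∎
        where
        σ′ = nxt (emit d) (end x (Vec.replicate m sample) u σ) (lookup x c₀)
        -- Any vector would do here: the components taken from `G` concern only the state after the
        -- sweep, which does not depend on later draws.
        G = good-sweep m j σ u d (Vec.replicate L d) live r₂≡n good
        better : ∀ w → wrong m (suc j) σ (u ++ d ∷ w) ≤ wrong m j σ′ w
        better w = not-mono (swept m j w σ′ ≟ᶠ target (toℕ (r₁ σ′))) (swept m (suc j) (u ++ d ∷ w) σ ≟ᶠ target (toℕ (r₁ σ)))
                            (proj₂ (proj₂ (proj₂ (good-sweep m j σ u d w live r₂≡n good))))
          where
          not-mono : ∀ {A B : Set} (A? : Dec A) (B? : Dec B) → (A → B) → 𝟙 (not (does B?)) ≤ 𝟙 (not (does A?))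
          not-mono A? (yes _) f = z≤n
          not-mono (no _) (no _) f = ≤-refl
          not-mono (yes a) (no ¬b) f = contradiction (f a) ¬b

    dead-sweeps : ∀ m j v σ → alive σ ≡ false → swept m j v σ ≡ ⊥
    dead-sweeps m zero [] σ dead = refl
    dead-sweeps m (suc j) v σ dead with u , d ∷ w , refl ← Vec.splitAt m v =
      trans (swept-suc m j u d w σ) (trans
        (cong₂ _∪_ (cong (λ a → if a then interval (toℕ (r₁ σ₁)) (toℕ (r₂ σ₁)) else ⊥) dead₁) (dead-sweeps m j w _ dead₁))
        (∪-identityˡ ⊥))
      where
      σ₁ = end x (Vec.replicate m sample) u σ
      dead₁ : alive σ₁ ≡ false
      dead₁ = trans (alive≡ (samples-spec u σ)) dead

-- State encoding and the complete algorithm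

bool-encoding : Encoding Bool 2
bool-encoding = record
  { encode = λ { false → zero ; true → suc zero }
  ; decodeˢ = λ { zero → false ; (suc _) → true }
  ; decode-encode = λ { false → refl ; true → refl }
  }

×-encoding : ∀ {A B V W} → Encoding A V → Encoding B W → Encoding (A × B) (V * W)
×-encoding {A} {B} {V} {W} E F = record
  { encode = λ (a , b) → combine (encode E a) (encode F b)
  ; decodeˢ = λ i → decodeˢ E (Fin.quotient {V} W i) , decodeˢ F (Fin.remainder {V} W i)
  ; decode-encode = λ (a , b) → trans (cong (λ (i , j) → decodeˢ E i , decodeˢ F j) (Fin.remQuot-combine (encode E a) (encode F b)))
                                      (cong₂ _,_ (decode-encode E a) (decode-encode F b))
  }
  where open Encoding

id-encoding : ∀ {W} → Encoding (Fin W) W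
id-encoding = record { encode = id ; decodeˢ = id ; decode-encode = λ _ → refl }

-- (3/4)³ = 27/64 < 1/2, so three trials halve the survival probability.
survival-probability : ∀ n q → n ≤ 2 ^ q → n * 3 ^ (3 * q) ≤ 4 ^ (3 * q)
survival-probability n q n≤ = begin
  n * 3 ^ (3 * q)        ≤⟨ *-monoˡ-≤ (3 ^ (3 * q)) n≤ ⟩
  2 ^ q * 3 ^ (3 * q)    ≡⟨ cong (2 ^ q *_) (^-*-assoc 3 3 q) ⟨
  2 ^ q * 27 ^ q         ≡⟨ ^-distribʳ-* q 2 27 ⟨
  54 ^ q                 ≤⟨ ^-monoˡ-≤ q (m≤m+n 54 10) ⟩
  64 ^ q                 ≡⟨ ^-*-assoc 4 3 q ⟩
  4 ^ (3 * q)            ∎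
  where open ≤-Reasoning

cube≤ : ∀ n q → n ≤ 2 ^ q → n * (n * n) ≤ 2 ^ (3 * q)
cube≤ n q n≤ = begin
  n * (n * n)                ≤⟨ *-mono-≤ n≤ (*-mono-≤ n≤ n≤) ⟩
  2 ^ q * (2 ^ q * 2 ^ q)    ≡⟨ cong (λ z → 2 ^ q * (2 ^ q * z)) (*-identityʳ (2 ^ q)) ⟨
  (2 ^ q) ^ 3                ≡⟨ ^-*-assoc 2 q 3 ⟩
  2 ^ (q * 3)                ≡⟨ cong (2 ^_) (*-comm q 3) ⟩
  2 ^ (3 * q)                ∎
  where open ≤-Reasoning

module Algorithm {n p : ℕ} (1<n : 1 < n) (1<p : 1 < p) (prime : Prime p) (p∣n : p ∣ n)
                 (q : ℕ) (n<2^q : n < 2 ^ q) (q≤2L : q ≤ 2 * ⌊log₂ n ⌋) where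

  -- Elements are split as c = (a h + b₁) h + b₂, and block a is fingerprinted by the bivariate
  -- polynomial with coefficients count c at α^b₁ β^b₂.  There are about 4n/p² blocks.
  private
    instance
      n≢0 : NonZero n
      n≢0 = >-nonZero (<-trans z<s 1<n)
      p≢0 : NonZero p
      p≢0 = prime⇒nonZero prime
    k = _∣_.quotient p∣n
    n≡kp : n ≡ k * p
    n≡kp = _∣_.equality p∣n
    0<k : 0 < k
    0<k = positive k n≡kp
      where
      positive : ∀ k → n ≡ k * p → 0 < k
      positive zero eq = contradiction (subst (1 <_) eq 1<n) λ ()
      positive (suc k) _ = z<s
    -- The largest `h` with 2h ≤ p + 1. Also 2h ≥ p, so a full block has h² ≥ p²/4 elements.
    h = suc p / 2
    0<h : 0 < h
    0<h = /-monoˡ-≤ 2 (<⇒≤ (s<s 1<p))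
    instance
      h≢0 : NonZero h
      h≢0 = >-nonZero 0<h
    2h≤ : 2 * h ≤ suc p
    2h≤ = ≤-trans (≤-reflexive (*-comm 2 h)) (m/n*n≤m (suc p) 2)
    R = 3 * q
    -- An element of multiplicity at least p is missed by `k` = n/p draws with probability at most
    -- 1/2, so by `m` draws with probability at most 2^(-3q) ≤ n⁻³. The cube survives union bounds
    -- over n elements and at most n sweeps.
    m = k * (3 * q)
    B : ℕ
    B = suc (n / h / h)

    A : Fin n → ℕ
    A c = toℕ c / h / h
    B₁ B₂ : Fin n → Fin h
    B₁ c = (toℕ c / h) mod h
    B₂ c = toℕ c mod h

    injective : ∀ c c′ → A c ≡ A c′ → B₁ c ≡ B₁ c′ → B₂ c ≡ B₂ c′ → c ≡ c′
    injective c c′ eA e₁ e₂ = Fin.toℕ-injective (divMod (toℕ c) (toℕ c′) (divMod (toℕ c / h) (toℕ c′ / h) eA e₁) e₂)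
      where
      divMod : ∀ a b → a / h ≡ b / h → a mod h ≡ b mod h → a ≡ b
      divMod a b e/ emod = trans (m≡m%n+[m/n]*n a h) (trans (cong₂ (λ r d → r + d * h) e% e/) (sym (m≡m%n+[m/n]*n b h)))
        where
        e% : a % h ≡ b % h
        e% = trans (sym (Fin.toℕ-fromℕ< (m%n<n a h))) (trans (cong toℕ emod) (Fin.toℕ-fromℕ< (m%n<n b h)))

    A<B : ∀ c → A c < B
    A<B c = s≤s (/-monoˡ-≤ h (/-monoˡ-≤ h (<⇒≤ (Fin.toℕ<n c))))

  open Machine {n}
  open Fingerprint prime p∣n 1<n {h} 2h≤ A B₁ B₂ injective
  open Enumerate {n} 1<n

  private
    trials : ℕ → Vec RStep (R * (2 + (n + 1)))
    trials a = Vec.concat {m = 2 + (n + 1)} {n = R} (Vec.replicate R (round a))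
    verify : Vec RStep (B * (R * (2 + (n + 1))))
    verify = Vec.concat {m = R * (2 + (n + 1))} {n = B} (tabulate {n = B} (trials ∘ toℕ))
    K₁ = B * (R * (2 + (n + 1)))
    K₂ = sweepsLength m (suc k)
    K = K₁ + suc K₂
    steps : Vec RStep K
    steps = verify ++ reset ∷ sweeps m (suc k)
    σ₀ : State
    σ₀ = state true zero zero zero
    W = 2 * (suc n * (suc n * suc n))

    encoding : Encoding State W
    encoding = record
      { encode = λ (state a b c d) → encode (a , b , c , d)
      ; decodeˢ = λ i → let (a , b , c , d) = decodeˢ i in state a b c d
      ; decode-encode = λ (state a b c d) → cong (λ (a , b , c , d) → state a b c d) (decode-encode (a , b , c , d))
      }
      where open Encoding (×-encoding bool-encoding (×-encoding id-encoding (×-encoding id-encoding id-encoding)))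

    silent-concat : ∀ {B K} (fss : Vec (Vec RStep K) B) → (∀ i → Allᵛ Silent (lookup fss i)) → Allᵛ Silent (Vec.concat fss)
    silent-concat [] h = []
    silent-concat (fs ∷ fss) h = Allᵛ.++⁺ (h zero) (silent-concat fss (h ∘ suc))

    silent-verify : Allᵛ Silent verify
    silent-verify = silent-concat {B} {R * (2 + (n + 1))} (tabulate {n = B} (trials ∘ toℕ)) λ i → subst (Allᵛ Silent) (sym (Vec.lookup∘tabulate (trials ∘ toℕ) i))
      (silent-concat {R} {2 + (n + 1)} (Vec.replicate R (round (toℕ i))) λ j → subst (Allᵛ Silent) (sym (Vec.lookup-replicate j (round (toℕ i)))) (silent-round (toℕ i)))

    module _ (x : Vec (Fin n) n) where

      after : Vec (Fin n) K₁ → Fin n → State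
      after u d = nxt (reset d) (end x verify u σ₀) (lookup x (qry (reset d)))

      run-steps : ∀ u d w → runˢ (instantiate steps (u ++ d ∷ w)) x σ₀ ≡ swept x m (suc k) w (after u d)
      run-steps u d w = begin
        runˢ (instantiate steps (u ++ d ∷ w)) x σ₀
          ≡⟨ cong (λ ss → runˢ ss x σ₀) (instantiate-++ verify (reset ∷ sweeps m (suc k)) u (d ∷ w)) ⟩
        runˢ (instantiate verify u List.++ instantiate (reset ∷ sweeps m (suc k)) (d ∷ w)) x σ₀
          ≡⟨ run-++ (instantiate verify u) (instantiate (reset ∷ sweeps m (suc k)) (d ∷ w)) x σ₀ ⟩
        runˢ (instantiate verify u) x σ₀ ∪ (⊥ ∪ swept x m (suc k) w (after u d))
          ≡⟨ cong₂ _∪_ (run-silent silent-verify u x σ₀) (∪-identityˡ _) ⟩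
        ⊥ ∪ swept x m (suc k) w (after u d)
          ≡⟨ ∪-identityˡ _ ⟩
        swept x m (suc k) w (after u d) ∎
        where open ≡-Reasoning

      cnt : Fin n → ℕ
      cnt c = count (c Fin.≟_) x

      f : Subset n
      f = NonOccurringElements n p x

      _≟ᶠ_ = _≟ˢ_ {n} {n} {n}

      wrongs : Vec (Fin n) K → ℕ
      wrongs v = 𝟙 (not (does (runˢ (instantiate steps v) x σ₀ ≟ᶠ f)))

      ∑-wrongs : ∑ᵛ K wrongs ≡ ∑ᵛ K₁ (λ u → ∑[ d < n ] ∑ᵛ K₂ (λ w → 𝟙 (not (does (swept x m (suc k) w (after u d) ≟ᶠ f)))))
      ∑-wrongs = trans (∑ᵛ-++ K₁ wrongs) (∑ᵛ-cong λ u → trans (∑ᵛ-suc _) (∑-cong λ d → ∑ᵛ-cong λ w →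
        cong (λ Y → 𝟙 (not (does (Y ≟ᶠ f)))) (run-steps u d w)))

      n^K : n ^ K ≡ n ^ K₁ * (n * n ^ K₂)
      n^K = ^-distribˡ-+-* n K₁ (suc K₂)

      occurs⇒1≤cnt : ∀ c → occurs x c ≡ true → 1 ≤ cnt c
      occurs⇒1≤cnt c occ with i , eq ← occurs⇒ x c occ = ≤-trans (≤-reflexive (sym (cong 𝟙 (dec-true (c Fin.≟ lookup x i) eq))))
        (≤-trans (term≤∑ (λ i → 𝟙 (does (c Fin.≟ lookup x i))) i) (≤-reflexive (sym (count≡∑ (c Fin.≟_) x))))

      module Kept (ok : ∀ c → p ∣ cnt c) where

        p≤cnt : ∀ c → occurs x c ≡ true → p ≤ cnt c
        p≤cnt c occ = ∣⇒≤ ⦃ >-nonZero (occurs⇒1≤cnt c occ) ⦄ (ok c)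

        f≡ : f ≡ target x 0
        f≡ = trans (promise⇒ x p ok) (subset-ext λ c → trans (lookup-nonOccurring x c) (sym (Vec.lookup∘tabulate _ c)))

        ∑-cnt : ∑[ c < n ] cnt c ≡ n
        ∑-cnt = begin
          ∑[ c < n ] cnt c                                             ≡⟨ ∑-cong (λ c → count≡∑ (c Fin.≟_) x) ⟩
          ∑[ c < n ] ∑[ i < n ] 𝟙 (does (c Fin.≟ lookup x i))          ≡⟨ ∑-swap _ ⟩
          ∑[ i < n ] ∑[ c < n ] 𝟙 (does (c Fin.≟ lookup x i))          ≡⟨ ∑-cong (λ i → ∑-δ₁ (lookup x i)) ⟩
          ∑[ i < n ] 1                                                 ≡⟨ trans (∑-const n 1) (*-identityʳ n) ⟩
          n                                                            ∎
          where open ≡-Reasoning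

        measure≤ : measure x 0 ≤ suc k
        measure≤ = ≤-trans (+-mono-≤ occ≤k (𝟙≤1 (does (0 <? n)))) (≤-reflexive (+-comm k 1))
          where
          open ≤-Reasoning
          pt : ∀ c → p * 𝟙 (occurs x c) ≤ cnt c
          pt c with occurs x c in occ
          ... | false = ≤-trans (≤-reflexive (*-zeroʳ p)) z≤n
          ... | true = ≤-trans (≤-reflexive (*-identityʳ p)) (p≤cnt c occ)
          occ≤k : ∑[ c < n ] 𝟙 (occurs x c) ≤ k
          occ≤k = *-cancelˡ-≤ p (begin
            p * ∑[ c < n ] 𝟙 (occurs x c)        ≡⟨ ∑-*ˡ p _ ⟨
            ∑[ c < n ] (p * 𝟙 (occurs x c))      ≤⟨ ∑-mono pt ⟩
            ∑[ c < n ] cnt c                     ≡⟨ trans ∑-cnt (trans n≡kp (*-comm k p)) ⟩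
            p * k                                ∎)

        rareMiss : ∀ c → occurs x c ≡ true → n * (n * n) * (∑[ d < n ] 𝟙 (not (does (c Fin.≟ lookup x d)))) ^ m ≤ n ^ m
        rareMiss c occ = begin
          n * (n * n) * z ^ m                ≤⟨ *-monoˡ-≤ (z ^ m) (cube≤ n q (<⇒≤ n<2^q)) ⟩
          2 ^ (3 * q) * z ^ m                ≤⟨ halving^ z (cnt c) k (3 * q) 0<k (≤-trans (≤-reflexive (trans z+cnt n≡kp)) (*-monoʳ-≤ k (p≤cnt c occ))) ⟩
          (z + cnt c) ^ m                    ≡⟨ cong (_^ m) z+cnt ⟩
          n ^ m                              ∎
          where
          open ≤-Reasoning
          z = ∑[ d < n ] 𝟙 (not (does (c Fin.≟ lookup x d)))
          z+cnt : z + cnt c ≡ n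
          z+cnt = begin-equality
            z + cnt c                                                                          ≡⟨ trans (+-comm z _) (cong (_+ z) (count≡∑ (c Fin.≟_) x)) ⟩
            ∑[ d < n ] 𝟙 (does (c Fin.≟ lookup x d)) + z                                       ≡⟨ ∑-+ _ _ ⟨
            ∑[ d < n ] (𝟙 (does (c Fin.≟ lookup x d)) + 𝟙 (not (does (c Fin.≟ lookup x d))))   ≡⟨ ∑-cong (λ d → 𝟙+𝟙-not (does (c Fin.≟ lookup x d))) ⟩
            ∑[ d < n ] 1                                                                       ≡⟨ trans (∑-const n 1) (*-identityʳ n) ⟩
            n                                                                                  ∎

        preserved : ∀ u → alive (end x verify u σ₀) ≡ true
        preserved u = preserves-concat x {B} {R * (2 + (n + 1))} (tabulate {n = B} (trials ∘ toℕ)) each u σ₀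
          where
          each : ∀ i → Preserves x (lookup (tabulate {n = B} (trials ∘ toℕ)) i)
          each i = subst (Preserves x) (sym (Vec.lookup∘tabulate (trials ∘ toℕ) i)) (preserves-concat x {R} {2 + (n + 1)} (Vec.replicate R (round (toℕ i))) λ j →
            subst (Preserves x) (sym (Vec.lookup-replicate j (round (toℕ i)))) (preserves-round x ok (toℕ i)))

        -- Turns the total error (k + 1)/n² of the sweeps into 1/n.
        suc-k≤n : suc k ≤ n
        suc-k≤n = begin
          suc k      ≤⟨ +-monoˡ-≤ k 0<k ⟩
          k + k      ≡⟨ trans (cong (k +_) (sym (*-identityʳ k))) (sym (*-suc k 1)) ⟩
          k * 2      ≤⟨ *-monoʳ-≤ k 1<p ⟩
          k * p      ≡⟨ n≡kp ⟨
          n          ∎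
          where open ≤-Reasoning

        rare : n * ∑ᵛ K wrongs ≤ n ^ K
        rare = *-cancelˡ-≤ n (begin
          n * (n * ∑ᵛ K wrongs)
            ≡⟨ trans (sym (*-assoc n n (∑ᵛ K wrongs))) (cong (n * n *_) ∑-wrongs) ⟩
          n * n * ∑ᵛ K₁ (λ u → ∑[ d < n ] ∑ᵛ K₂ (g u d))
            ≡⟨ trans (sym (∑ᵛ-*ˡ (n * n) _)) (∑ᵛ-cong λ u → sym (∑-*ˡ (n * n) _)) ⟩
          ∑ᵛ K₁ (λ u → ∑[ d < n ] (n * n * ∑ᵛ K₂ (g u d)))
            ≤⟨ ∑ᵛ-mono (λ u → ∑-mono λ d → each u d) ⟩
          ∑ᵛ K₁ (λ u → ∑[ d < n ] (suc k * n ^ K₂))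
            ≡⟨ trans (∑ᵛ-cong λ u → ∑-const n _) (∑ᵛ-const K₁ _) ⟩
          n ^ K₁ * (n * (suc k * n ^ K₂))
            ≤⟨ *-monoʳ-≤ (n ^ K₁) (*-monoʳ-≤ n (*-monoˡ-≤ (n ^ K₂) suc-k≤n)) ⟩
          n ^ K₁ * (n * (n * n ^ K₂))
            ≡⟨ eq (n ^ K₁) n (n ^ K₂) ⟩
          n * (n ^ K₁ * (n * n ^ K₂))
            ≡⟨ cong (n *_) n^K ⟨
          n * n ^ K ∎)
          where
          open ≤-Reasoning
          g : Vec (Fin n) K₁ → Fin n → Vec (Fin n) K₂ → ℕ
          g u d w = 𝟙 (not (does (swept x m (suc k) w (after u d) ≟ᶠ f)))
          each : ∀ u d → n * n * ∑ᵛ K₂ (g u d) ≤ suc k * n ^ K₂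
          each u d = subst (λ Y → n * n * ∑ᵛ K₂ (λ w → 𝟙 (not (does (swept x m (suc k) w (after u d) ≟ᶠ Y)))) ≤ suc k * n ^ K₂) (sym f≡)
            (∑-wrong x m (∑-bad x m rareMiss) (suc k) (after u d) (preserved u) (toℕ-clamp ≤-refl) measure≤)
          eq : ∀ a b c → a * (b * (b * c)) ≡ b * (a * (b * c))
          eq = solve-∀

      module Broken (c : Fin n) (p∤ : ¬ p ∣ cnt c) where

        f≡⊥ : f ≡ ⊥
        f≡⊥ = ¬promise⇒ x p λ ok → p∤ (ok c)

        survives : Survival x verify (3 ^ R) (4 ^ R)
        survives = survival-concat x {B} {R * (2 + (n + 1))} (tabulate {n = B} (trials ∘ toℕ)) each₁ a (subst (λ fs → Survival x fs (3 ^ R) (4 ^ R)) (sym (Vec.lookup∘tabulate (trials ∘ toℕ) a))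
          (subst (λ b → Survival x (trials b) (3 ^ R) (4 ^ R)) (sym (Fin.toℕ-fromℕ< (A<B c))) (survival-replicate x {2 + (n + 1)} R (survival-round x c p∤))))
          where
          a : Fin B
          a = fromℕ< (A<B c)
          1^ : ∀ R → 1 ^ R ≡ 1
          1^ = ^-zeroˡ
          each₁ : ∀ i → Survival x (lookup (tabulate {n = B} (trials ∘ toℕ)) i) 1 1
          each₁ i = subst (λ fs → Survival x fs 1 1) (sym (Vec.lookup∘tabulate (trials ∘ toℕ) i))
            (subst₂ (Survival x (trials (toℕ i))) (1^ R) (1^ R) (survival-replicate x {2 + (n + 1)} R (survival-round₁ x (toℕ i))))

        -- A dead run emits nothing, and the empty set is the right answer when the promise fails.
        wrong≤alive : ∀ u d w → 𝟙 (not (does (swept x m (suc k) w (after u d) ≟ᶠ f))) ≤ 𝟙 (alive (end x verify u σ₀))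
        wrong≤alive u d w = go (alive (end x verify u σ₀)) refl
          where
          go : ∀ b → alive (end x verify u σ₀) ≡ b → 𝟙 (not (does (swept x m (suc k) w (after u d) ≟ᶠ f))) ≤ 𝟙 b
          go true _ = 𝟙≤1 _
          go false dead = ≤-reflexive (cong (𝟙 ∘ not) (dec-true (swept x m (suc k) w (after u d) ≟ᶠ f)
            (trans (dead-sweeps x m (suc k) w (after u d) dead) (sym f≡⊥))))

        rare : n * ∑ᵛ K wrongs ≤ n ^ K
        rare = *-cancelˡ-≤ (3 ^ R) ⦃ m^n≢0 3 R ⦄ (begin
          3 ^ R * (n * ∑ᵛ K wrongs)
            ≡⟨ trans (sym (*-assoc (3 ^ R) n (∑ᵛ K wrongs))) (cong₂ _*_ (*-comm (3 ^ R) n) ∑-wrongs) ⟩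
          n * 3 ^ R * ∑ᵛ K₁ (λ u → ∑[ d < n ] ∑ᵛ K₂ (λ w → 𝟙 (not (does (swept x m (suc k) w (after u d) ≟ᶠ f)))))
            ≤⟨ *-mono-≤ (survival-probability n q (<⇒≤ n<2^q)) (∑ᵛ-mono λ u → ∑-mono λ d → ∑ᵛ-mono λ w → wrong≤alive u d w) ⟩
          4 ^ R * ∑ᵛ K₁ (λ u → ∑[ d < n ] ∑ᵛ K₂ (λ w → 𝟙 (alive (end x verify u σ₀))))
            ≡⟨ cong (4 ^ R *_) (trans (∑ᵛ-cong λ u → trans (∑-cong λ d → ∑ᵛ-const K₂ _) (trans (∑-const n _) (sym (*-assoc n (n ^ K₂) _)))) (∑ᵛ-*ˡ (n * n ^ K₂) _)) ⟩
          4 ^ R * (n * n ^ K₂ * ∑ᵛ K₁ (λ u → 𝟙 (alive (end x verify u σ₀))))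
            ≡⟨ eq₁ (4 ^ R) (n * n ^ K₂) _ ⟩
          n * n ^ K₂ * (4 ^ R * ∑ᵛ K₁ (λ u → 𝟙 (alive (end x verify u σ₀))))
            ≤⟨ *-monoʳ-≤ (n * n ^ K₂) (bound survives σ₀) ⟩
          n * n ^ K₂ * (3 ^ R * 1 * n ^ K₁)
            ≡⟨ eq₂ (n * n ^ K₂) (3 ^ R) (n ^ K₁) ⟩
          3 ^ R * (n ^ K₁ * (n * n ^ K₂))
            ≡⟨ cong (3 ^ R *_) n^K ⟨
          3 ^ R * n ^ K ∎)
          where
          open ≤-Reasoning
          eq₁ : ∀ a b c → a * (b * c) ≡ b * (a * c)
          eq₁ = solve-∀
          eq₂ : ∀ a b c → a * (b * 1 * c) ≡ b * (c * a)
          eq₂ = solve-∀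

      rarely-wrong : n * ∑ᵛ K wrongs ≤ n ^ K
      rarely-wrong with Fin.all? (λ c → p ∣? cnt c)
      ... | yes ok = Kept.rare ok
      ... | no ¬ok with c , p∤ ← Fin.¬∀⟶∃¬ n (λ c → p ∣ cnt c) (λ c → p ∣? cnt c) ¬ok = Broken.rare c p∤

  open Randomized encoding σ₀ 1<n steps
  open Program {n} {n} {n} encoding σ₀ using (program; oblivious-program; time-program; space-program)

  -- Space and time of the algorithm

  private
    L = ⌊log₂ n ⌋
    1≤L : 1 ≤ L
    1≤L = ⌊log₂⌋-mono-≤ {2} 1<n

    -- The strict bound `n<2^q` covers registers with n + 1 values; 7 = 1 + 3 · 2 by `1≤L` and
    -- `q≤2L`.
    W≤ : W ≤ 2 ^ (7 * L)
    W≤ = begin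
      2 * (suc n * (suc n * suc n))       ≤⟨ *-monoʳ-≤ 2 (cube≤ (suc n) q n<2^q) ⟩
      2 ^ suc (3 * q)                     ≤⟨ ^-monoʳ-≤ 2 (+-mono-≤ 1≤L (*-monoʳ-≤ 3 q≤2L)) ⟩
      2 ^ (L + 3 * (2 * L))               ≡⟨ cong (2 ^_) (eq L) ⟩
      2 ^ (7 * L)                         ∎
      where
      open ≤-Reasoning
      eq : ∀ L → L + 3 * (2 * L) ≡ 7 * L
      eq = solve-∀

    -- This is p² · max{1, n/p²}, so time is compared after multiplication by p².
    X = p ^ 2 ⊔ n

    p²*B≤ : p ^ 2 * B ≤ 8 * X
    p²*B≤ = begin
      p ^ 2 * B                                    ≡⟨ cong (λ z → p * z * B) (*-identityʳ p) ⟩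
      p * p * B                                    ≤⟨ *-monoˡ-≤ B (*-mono-≤ p≤2h p≤2h) ⟩
      2 * h * (2 * h) * B                          ≡⟨ eq₁ h (n / h / h) ⟩
      4 * (h * h + n / h / h * h * h)              ≤⟨ *-monoʳ-≤ 4 (+-mono-≤ (*-mono-≤ h≤p h≤p) (≤-trans (*-monoˡ-≤ h (m/n*n≤m (n / h) h)) (m/n*n≤m n h))) ⟩
      4 * (p * p + n)                              ≤⟨ *-monoʳ-≤ 4 (+-mono-≤ (≤-trans (≤-reflexive (cong (p *_) (sym (*-identityʳ p)))) (m≤m⊔n (p ^ 2) n)) (m≤n⊔m (p ^ 2) n)) ⟩
      4 * (X + X)                                  ≡⟨ eq₂ X ⟩
      8 * X                                        ∎
      where
      open ≤-Reasoning
      p≤2h : p ≤ 2 * h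
      p≤2h = ≤-pred (begin
        suc p                     ≡⟨ m≡m%n+[m/n]*n (suc p) 2 ⟩
        suc p % 2 + h * 2         ≤⟨ +-monoˡ-≤ (h * 2) (≤-pred (m%n<n (suc p) 2)) ⟩
        suc (h * 2)               ≡⟨ cong suc (*-comm h 2) ⟩
        suc (2 * h)               ∎)
      h≤p : h ≤ p
      h≤p = *-cancelˡ-≤ 2 (≤-trans 2h≤ (≤-trans (+-monoˡ-≤ p (<⇒≤ 1<p)) (≤-reflexive (cong (p +_) (sym (+-identityʳ p))))))
      eq₁ : ∀ h d → 2 * h * (2 * h) * suc d ≡ 4 * (h * h + d * h * h)
      eq₁ = solve-∀
      eq₂ : ∀ X → 4 * (X + X) ≡ 8 * X
      eq₂ = solve-∀

    sweepsLength≡ : ∀ m j → sweepsLength m j ≡ j * suc m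
    sweepsLength≡ m zero = refl
    sweepsLength≡ m (suc j) = trans (+-suc m _) (cong (λ z → suc (m + z)) (sweepsLength≡ m j))

    trials≤ : R * (2 + (n + 1)) ≤ 18 * (n * L)
    trials≤ = begin
      3 * q * (2 + (n + 1))          ≤⟨ *-mono-≤ (*-monoʳ-≤ 3 q≤2L) n+3≤ ⟩
      3 * (2 * L) * (3 * n)          ≡⟨ eq L n ⟩
      18 * (n * L)                   ∎
      where
      open ≤-Reasoning
      n+3≤ : 2 + (n + 1) ≤ 3 * n
      n+3≤ = begin
        2 + (n + 1)      ≡⟨ cong (2 +_) (+-comm n 1) ⟩
        3 + n            ≤⟨ +-monoˡ-≤ n (≤-trans (n≤1+n 3) (+-mono-≤ {2} {n} 1<n (≤-trans 1<n (≤-reflexive (sym (+-identityʳ n)))))) ⟩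
        (n + (n + 0)) + n ≡⟨ eq′ n ⟩
        3 * n            ∎
        where
        eq′ : ∀ n → (n + (n + 0)) + n ≡ 3 * n
        eq′ = solve-∀
      eq : ∀ L n → 3 * (2 * L) * (3 * n) ≡ 18 * (n * L)
      eq = solve-∀

    enumeration≤ : suc K₂ ≤ 15 * (k * k * L)
    enumeration≤ = begin
      suc K₂                              ≡⟨ cong suc (sweepsLength≡ m (suc k)) ⟩
      suc (suc k * suc m)                 ≤⟨ +-mono-≤ one (*-mono-≤ suck≤ sucm≤) ⟩
      k * k * L + (k + k) * (7 * (k * L)) ≡⟨ eq k L ⟩
      15 * (k * k * L)                    ∎
      where
      open ≤-Reasoning
      one : 1 ≤ k * k * L
      one = *-mono-≤ {1} {k * k} {1} (*-mono-≤ {1} {k} {1} 0<k 0<k) 1≤L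
      suck≤ : suc k ≤ k + k
      suck≤ = +-monoˡ-≤ k 0<k
      sucm≤ : suc m ≤ 7 * (k * L)
      sucm≤ = begin
        suc (k * (3 * q))                    ≤⟨ +-mono-≤ (*-mono-≤ {1} {k} {1} 0<k 1≤L) (*-monoʳ-≤ k (*-monoʳ-≤ 3 q≤2L)) ⟩
        k * L + k * (3 * (2 * L))            ≡⟨ eq′ k L ⟩
        7 * (k * L)                          ∎
        where
        eq′ : ∀ k L → k * L + k * (3 * (2 * L)) ≡ 7 * (k * L)
        eq′ = solve-∀
      eq : ∀ k L → k * k * L + (k + k) * (7 * (k * L)) ≡ 15 * (k * k * L)
      eq = solve-∀

    -- 159 = 8 · 18 + 15, for verification and enumeration. In the latter p²k² = n², and one factor
    -- n is absorbed by `X`.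
    time≤ : p ^ 2 * K ≤ X * (159 * (n * L))
    time≤ = begin
      p ^ 2 * (K₁ + suc K₂)                                ≡⟨ *-distribˡ-+ (p ^ 2) K₁ (suc K₂) ⟩
      p ^ 2 * K₁ + p ^ 2 * suc K₂                          ≤⟨ +-mono-≤ verify≤ sweeps≤ ⟩
      8 * X * (18 * (n * L)) + X * (15 * (n * L))          ≡⟨ eq X (n * L) ⟩
      X * (159 * (n * L))                                  ∎
      where
      open ≤-Reasoning
      eq : ∀ X y → 8 * X * (18 * y) + X * (15 * y) ≡ X * (159 * y)
      eq = solve-∀
      verify≤ : p ^ 2 * K₁ ≤ 8 * X * (18 * (n * L))
      verify≤ = begin
        p ^ 2 * (B * (R * (2 + (n + 1))))      ≡⟨ *-assoc (p ^ 2) B _ ⟨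
        p ^ 2 * B * (R * (2 + (n + 1)))        ≤⟨ *-mono-≤ p²*B≤ trials≤ ⟩
        8 * X * (18 * (n * L))                 ∎
      sweeps≤ : p ^ 2 * suc K₂ ≤ X * (15 * (n * L))
      sweeps≤ = begin
        p ^ 2 * suc K₂                                 ≤⟨ *-monoʳ-≤ (p ^ 2) enumeration≤ ⟩
        p ^ 2 * (15 * (k * k * L))                     ≡⟨ cong (λ z → p * z * (15 * (k * k * L))) (*-identityʳ p) ⟩
        p * p * (15 * (k * k * L))                     ≡⟨ eq′ p k L ⟩
        k * p * (15 * (k * p * L))                     ≡⟨ cong (λ z → z * (15 * (z * L))) n≡kp ⟨
        n * (15 * (n * L))                             ≤⟨ *-monoˡ-≤ (15 * (n * L)) (m≤n⊔m (p ^ 2) n) ⟩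
        X * (15 * (n * L))                             ∎
        where
        eq′ : ∀ p k L → p * p * (15 * (k * k * L)) ≡ k * p * (15 * (k * p * L))
        eq′ = solve-∀

  upper-bound : Σ[ R ∈ RandomizedBP n n n ] ∃[ S ] ∃[ T ]
        S ≤ 7 * ⌊log₂ n ⌋
      × p ^ 2 * T ≤ (p ^ 2 ⊔ n) * (159 * (n * ⌊log₂ n ⌋))
      × Always Oblivious R
      × Always (λ P → HasSpace P S) R
      × Always (λ P → HasTime P T) R
      × ComputesWithProbability R (1-2/ n 1<n) (NonOccurringElements n p)
      × OneWayRandomness R
  upper-bound = randomized , 7 * L , K , ≤-refl , time≤
    , (λ i → oblivious-program (instantiate steps (decode K i)))
    , (λ i → space-program (instantiate steps (decode K i)) {7 * L} W≤)
    , (λ i → ≤-trans (time-program (instantiate steps (decode K i))) (≤-reflexive (length-instantiate steps (decode K i))))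
    , computesᴾ (NonOccurringElements n p) rarely-wrong
    , oneWay

theorem1p1 : (∃[ c₁ ] ∃[ c₂ ] ∀ n p → (n>1 : n > 1) → Prime p → p ∣ n →
    Σ[ R ∈ RandomizedBP n n n ] ∃[ S ] ∃[ T ]
    S ≤ c₁ * ⌊log₂ n ⌋
    × p ^ 2 * T ≤ (p ^ 2 ⊔ n) * (c₂ * (n * ⌊log₂ n ⌋))
    × Always Oblivious R
    × Always (λ P → HasSpace P S) R
    × Always (λ P → HasTime P T) R
    × ComputesWithProbability R (1-2/ n n>1) (NonOccurringElements n p)
    × OneWayRandomness R)
    ×
    (∃[ c₃ ] ∀ n p → n > 1 → Prime p → p ∣ n →
    ∀ (P : BranchingProgram n n n) S T →
    Oblivious P → HasSpace P S → HasTime P T →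
    Computes P (NonOccurringElements n p) →
    n ^ 3 ≤ c₃ * (p * (T ^ 2 * (S + ⌊log₂ T ⌋))))
theorem1p1 =
  -- q = ⌊log₂ n⌋ + 1 is at most twice the logarithm, as n ≥ 2 makes the latter at least 1.
  (7 , 159 , λ n p 1<n prime p∣n → Algorithm.upper-bound 1<n (1<p prime) prime p∣n
    (suc ⌊log₂ n ⌋) (m<2^[1+⌊log₂m⌋] n)
    (≤-trans (+-monoˡ-≤ ⌊log₂ n ⌋ (⌊log₂⌋-mono-≤ {2} 1<n)) (≤-reflexive (cong (⌊log₂ n ⌋ +_) (sym (+-identityʳ _))))))
  , 1152 , λ n p 1<n prime p∣n → lower-bound 1<n (1<p prime) p∣n
  where
  1<p : ∀ {p} → Prime p → 1 < p
  1<p pr = nonTrivial⇒n>1 _ ⦃ prime⇒nonTrivial pr ⦄
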